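{- Let $G$ be a graph with $n$ vertices and chromatic polynomial $P_G$. Define integers $h_0,\dots,h_n$ by $$h_0+h_1t+\cdots+h_nt^n=(1-t)^n\sum_{j=0}^\infty\big[(j+1)^n-P_G(j+1)\big]t^j.$$ Then (1) $h_0\le h_1\le\cdots\le h_{\lfloor (n-2)/2\rfloor}$; (2) for $i\le (n-2)/2$, $h_i\le h_{n-2-i}$; (3) $(h_0,\,h_1-h_0,\,\dots,\,h_{\lceil (n-2)/2\rceil}-h_{\lceil (n-2)/2\rceil-1})$ is an M-vector.
   Context: A sequence of nonnegative integers $(m_0,\dots,m_d)$ is an M-vector if it is the Hilbert function of a homogeneous quotient of a polynomial ring (standard graded), equivalently the degree sequence of an order ideal of monomials; by Macaulay's theorem this holds iff $m_0=1$ and $m_{i+1}\le m_i^{\langle i\rangle}$ for $1\le i\le d-1$, where writing $m_i=\binom{a_i}{i}+\binom{a_{i-1}}{i-1}+\cdots+\binom{a_j}{j}$ with $a_i>a_{i-1}>\cdots>a_j\ge j\ge1$, one sets $m_i^{\langle i\rangle}=\binom{a_i+1}{i+1}+\cdots+\binom{a_j+1}{j+1}$.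
   Formalization: The formal theorem assumes that G has at least one edge; for an edgeless graph P_G(k)=k^n, so all h_i=0 and the vector in (3) starts with 0, which is not an M-vector since m_0=1 is required. -}

module Defs where

open import Data.Bool using (Bool; true; false; not; _∧_; _∨_; T)
open import Data.Bool.ListAction using (and)
open import Data.Nat as ℕ using (ℕ; zero; suc; _≡ᵇ_)
open import Data.Nat.Combinatorics using (_C_)
open import Data.Integer as ℤ using (ℤ; +_; _-_; _*_; _+_; -_)
open import Data.Fin as Fin using (Fin)
open import Data.List using (List; []; _∷_; [_]; map; concatMap; allFin; cartesianProduct; length; filterᵇ; sum)
open import Data.Vec as Vec using (Vec; lookup)
open import Data.Product using (Σ; _×_; _,_; proj₁; proj₂; ∃; ∃-syntax)
open import Data.List.Membership.Propositional using (_∈_)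
open import Data.List.Relation.Unary.Unique.Propositional using (Unique)
open import Data.Vec.Relation.Binary.Pointwise.Inductive using (Pointwise)
open import Relation.Binary.PropositionalEquality using (_≡_)
open import Relation.Nullary.Decidable using (⌊_⌋)

record Graph (n : ℕ) : Set where
  field
    Adj    : Fin n → Fin n → Bool
    sym    : ∀ u v → Adj u v ≡ Adj v u
    irrefl : ∀ v → Adj v v ≡ false

open Graph public

HasEdge : ∀ {n} → Graph n → Set
HasEdge {n} G = Σ (Fin n) λ u → Σ (Fin n) λ v → T (Adj G u v)

allColourings : ∀ n k → List (Vec (Fin k) n)
allColourings zero    k = [ Vec.[] ]
allColourings (suc n) k =
  concatMap (λ c → map (λ x → x Vec.∷ c) (allFin k)) (allColourings n k)

isProper : ∀ {n k} → Graph n → Vec (Fin k) n → Bool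
isProper {n} G c =
  and (map (λ uv → not (Adj G (proj₁ uv) (proj₂ uv))
                   ∨ not ⌊ lookup c (proj₁ uv) Fin.≟ lookup c (proj₂ uv) ⌋)
           (cartesianProduct (allFin n) (allFin n)))

chromPoly : ∀ {n} → Graph n → ℕ → ℕ
chromPoly {n} G k = length (filterᵇ (isProper G) (allColourings n k))

-- The h-numbers:
--   Σ_i h_i t^i = (1-t)^n Σ_{j≥0} a_j t^j,  a_j = (j+1)^n - P_G(j+1),
-- so h_i = Σ_{k=0}^{i} (-1)^k (n choose k) a_{i-k}.

aCoeff : ∀ {n} → Graph n → ℕ → ℤ
aCoeff {n} G j = + (suc j ℕ.^ n) - + chromPoly G (suc j)

sumUpTo : ℕ → (ℕ → ℤ) → ℤ
sumUpTo zero    f = f 0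
sumUpTo (suc i) f = sumUpTo i f + f (suc i)

sign : ℕ → ℤ
sign zero    = + 1
sign (suc k) = - sign k

hCoeff : ∀ {n} → Graph n → ℕ → ℤ
hCoeff {n} G i = sumUpTo i (λ k → sign k * + (n C k) * aCoeff G (i ℕ.∸ k))

Monomial : ℕ → Set
Monomial r = Vec ℕ r

degree : ∀ {r} → Monomial r → ℕ
degree m = Vec.sum m

_∣ᵐ_ : ∀ {r} → Monomial r → Monomial r → Set
m′ ∣ᵐ m = Pointwise ℕ._≤_ m′ m

record OrderIdeal (r : ℕ) : Set where
  field
    elems  : List (Monomial r)
    unique : Unique elems
    closed : ∀ {m m′} → m ∈ elems → m′ ∣ᵐ m → m′ ∈ elems

open OrderIdeal public

countDeg : ∀ {r} → OrderIdeal r → ℕ → ℕ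
countDeg I i = length (filterᵇ (λ m → degree m ≡ᵇ i) (elems I))

IsMVector : (ℕ → ℤ) → ℕ → Set
IsMVector m d =
  m 0 ≡ + 1 ×
  Σ ℕ λ r → Σ (OrderIdeal r) λ I →
    (∀ i → i ℕ.≤ d → + countDeg I i ≡ m i) ×
    (∀ i → d ℕ.< i → countDeg I i ≡ 0)

diffSeq : (ℕ → ℤ) → ℕ → ℤ
diffSeq h zero    = h 0
diffSeq h (suc k) = h (suc k) - h k

{-# OPTIONS --safe #-}

-- Let W_V(X) = (1-t)^{|V|+1} Σ_K N(K) t^K, where N(K) is the number of proper colourings of the
-- graph V with colours 0, …, K in which the vertices of X avoid colour K; for X = ∅ and V without
-- edges this is the Eulerian polynomial E_{|V|}.  If v ∈ X has colour c, then the other vertices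
-- split into those of colour ≤ c and those of colour > c, so that
--   W_{V+v}(X) = t Σ_{L⊔R=V} W_L(N(v)) W_R(X),   E_{m+1} = t Σ E_L E_R + (1-t) E_m,
-- and if X = ∅ then permuting colours lets any vertex v be replaced by an isolated one, with
-- N(v) in the role of X.  By these recursions W is a nonnegative combination of polynomials
-- t^a (1+t)^b with 2a + b ≥ |V| - 1, whose coefficients increase up to the middle.
--
-- Now (1-t) Σ h_i t^i = E_n - W_G(∅).  More generally, for a list of graphs, the difference
-- D = Π E - Π W satisfies D = (1-t) E_V Π′E + t Σ_{L⊔R=V} D_{L,R}, where the D_{L,R} belong to lists
-- with fewer vertices.  Hence D / (1-t) is a combination of t^a (1+t)^b as above, which gives the
-- inequalities between the h_i.  For the M-vector property, Macaulay's inequalities pass from q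
-- and p to q + t p as soon as p ≤ q + t p coefficientwise; in the recursion for D this follows
-- because E_{l+r} - E_l E_r and Π W are again such combinations.

module Submission where

open import Defs
open import Data.Nat using (ℕ; suc; _∸_; _/_; _≤_; _*_)
open import Data.Integer using () renaming (_≤_ to _≤ℤ_)
open import Data.Product using (_×_)

open import Algebra.Bundles using (CommutativeRing)
import Algebra.Solver.Ring as RingSolver
import Algebra.Solver.Ring.AlmostCommutativeRing as ACR
open import Algebra.Structures using (IsCommutativeRing)
open import Data.Bool using (Bool; true; false; not; _∧_; _∨_; T)
open import Data.Bool.ListAction using (and)
open import Data.Bool.Properties using (∧-comm)
open import Data.Empty using (⊥; ⊥-elim)
open import Data.Fin as Fin using (Fin)
import Data.Fin.Properties as FinP
open import Data.List using (List; []; _∷_; _++_; map; length; take; replicate; concatMap; allFin; cartesianProduct; filterᵇ)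
open import Data.List.Membership.Propositional using (_∈_)
open import Data.List.Membership.Propositional.Properties using (∈-map⁺; ∈-map⁻; ∈-++⁺ˡ; ∈-++⁺ʳ; ∈-++⁻; ∈-cartesianProduct⁺; ∈-allFin)
open import Data.List.Properties using (length-map; length-++; length-take; length-replicate; filter-all; filter-none; filter-++; ++-identityʳ; map-++; map-∘; map-id; map-tabulate)
open import Data.List.Relation.Binary.Permutation.Propositional as Perm using (_↭_; ↭-sym; ↭-trans)
open import Data.List.Relation.Binary.Permutation.Propositional.Properties using (↭-length; All-resp-↭) renaming (map⁺ to ↭-map⁺)
open import Data.List.Relation.Unary.All as All using (All)
import Data.List.Relation.Unary.All.Properties as AllP
open import Data.List.Relation.Unary.AllPairs as AllPairs using (AllPairs)
open import Data.List.Relation.Unary.Any using (here; there)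
open import Data.List.Relation.Unary.Unique.Propositional using (Unique)
import Data.List.Relation.Unary.Unique.Propositional.Properties as Unique
open import Data.Maybe using (Maybe; just; nothing)
open import Data.Nat as ℕ using (zero; _+_; _<_; z≤n; s≤s; s≤s⁻¹; _≡ᵇ_)
open import Data.Nat.Combinatorics using (_C_; nCk+nC[k+1]≡[n+1]C[k+1]; k>n⇒nCk≡0)
open import Data.Nat.DivMod using (m/n*n≤m)
open import Data.Nat.Induction using (<-rec)
import Data.Nat.Properties as ℕP
open import Data.Nat.Properties
open import Data.Nat.Tactic.RingSolver using (solve-∀)
open import Data.Product using (Σ; _,_; proj₁; proj₂; ∃)
open import Data.Sum using (_⊎_; inj₁; inj₂)
open import Data.Unit using (tt)
open import Data.Vec as Vec using (Vec; lookup)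
open import Data.Vec.Properties using (lookup∘tabulate)
open import Data.Vec.Relation.Binary.Pointwise.Inductive as PW using ()
open import Function using (_∘_; id; flip)
open import Relation.Binary.Definitions using (tri<; tri≈; tri>)
open import Relation.Binary.PropositionalEquality using (_≡_; refl; trans; cong; cong₂; subst; subst₂; module ≡-Reasoning) renaming (sym to ≡-sym)
open import Relation.Nullary using (¬_; yes; no)
open import Relation.Nullary.Decidable using (⌊_⌋; T?)

-- Macaulay's numerical function

-- Splitting at a vertex breaks a graph into two that are coloured independently, so a class closed
-- under the recursion consists of products; hence the lists of rooted graphs. The obstacle is the
-- M-vector property. The recursion writes D as a sum of shifted M-vectors, and order ideals
-- realising the summands need not contain one another, so they cannot simply be glued. What
-- survives is numerical: only the Hilbert functions are kept, containment is replaced by a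
-- comparison of sizes, and gluing x P onto Q becomes the inequality `Gain` for Macaulay's
-- functions, proved by induction on the degree together with statements on their increments. One
-- order ideal is built at the very end, from initial colexicographic segments. The summand (1-t)
-- E_V Π′E needs Macaulay's inequalities too. It is itself a difference, namely of a system of
-- isolated points with one vertex fewer, so the same induction covers it. This may fall one degree
-- short; the symmetry of the Eulerian polynomials supplies that degree.

multiset# : ℕ → ℕ → ℕ
multiset# zero    N       = 1
multiset# (suc i) zero    = 0
multiset# (suc i) (suc N) = multiset# (suc i) N + multiset# i (suc N)

multiset#-1 : ∀ N → multiset# 1 N ≡ N
multiset#-1 zero    = refl
multiset#-1 (suc N) = trans (cong (_+ 1) (multiset#-1 N)) (+-comm N 1)

multiset#-pos : ∀ i N → 0 < multiset# i (suc N)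
multiset#-pos zero    N = s≤s z≤n
multiset#-pos (suc i) N = <-≤-trans (multiset#-pos i N) (m≤n+m _ _)

multiset#-step : ∀ i N → multiset# i N ≤ multiset# i (suc N)
multiset#-step zero    N = ≤-refl
multiset#-step (suc i) N = m≤m+n _ _

multiset#-mono : ∀ i {M N} → M ≤ N → multiset# i M ≤ multiset# i N
multiset#-mono i {M} {N} M≤N = subst (λ z → multiset# i M ≤ multiset# i z) (m+[n∸m]≡n M≤N) (go (N ∸ M))
  where
  go : ∀ d → multiset# i M ≤ multiset# i (M + d)
  go zero    = ≤-reflexive (cong (multiset# i) (≡-sym (+-identityʳ M)))
  go (suc d) = ≤-trans (go d) (≤-trans (multiset#-step i (M + d)) (≤-reflexive (cong (multiset# i) (≡-sym (+-suc M d)))))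

-- Since `multiset# i N` is the binomial coefficient C(N+i-1, i), this is the leading term of
-- Macaulay's representation of n in degree k + 2, with top N + k + 1 for N = `index`. The bound on
-- `offset` says that the remaining terms have smaller tops.
record Block (k n : ℕ) : Set where
  constructor block
  field
    index offset : ℕ
    decompose    : n ≡ multiset# (2 + k) index + offset
    offset<      : offset < multiset# (1 + k) (suc index)

locate : ∀ k n → Block k n
locate k zero = block 0 0 refl (multiset#-pos (suc k) 0)
locate k (suc n) with locate k n
... | block N b eq b< with suc b <? multiset# (1 + k) (suc N)
...   | yes lt = block N (suc b) (trans (cong suc eq) (≡-sym (+-suc _ b))) lt
...   | no ≮   = block (suc N) 0
                   (trans (cong suc eq) (trans (≡-sym (+-suc _ b))
                     (trans (cong (multiset# (2 + k) N +_) (≤-antisym b< (≮⇒≥ ≮))) (≡-sym (+-identityʳ _)))))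
                   (multiset#-pos (suc k) (suc N))

-- macaulay k n is Macaulay's n^⟨k+1⟩: the number of monomials of degree k + 2 all of whose
-- divisors lie among the n colexicographically first monomials of degree k + 1.
macaulay : ℕ → ℕ → ℕ
macaulay zero    n = multiset# 2 n
macaulay (suc k) n = multiset# (3 + k) (Block.index (locate k n)) + macaulay k (Block.offset (locate k n))

block-index-unique : ∀ k {N b N′ b′} → b < multiset# (1 + k) (suc N) →
  multiset# (2 + k) N + b ≡ multiset# (2 + k) N′ + b′ → ¬ (N < N′)
block-index-unique k {N} {b} {N′} {b′} b< eq N<N′ = <-irrefl eq
  (<-≤-trans (+-monoʳ-< (multiset# (2 + k) N) b<)
    (≤-trans (multiset#-mono (2 + k) N<N′) (m≤m+n _ b′)))

macaulay-block< : ∀ k N {b} → b < multiset# (1 + k) (suc N) →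
  macaulay (suc k) (multiset# (2 + k) N + b) ≡ multiset# (3 + k) N + macaulay k b
macaulay-block< k N {b} b< with locate k (multiset# (2 + k) N + b)
... | block N′ b′ eq b′< with <-cmp N N′
...   | tri< lt _ _ = ⊥-elim (block-index-unique k b< eq lt)
...   | tri> _ _ gt = ⊥-elim (block-index-unique k b′< (≡-sym eq) gt)
...   | tri≈ _ refl _ = cong (λ z → multiset# (3 + k) N + macaulay k z) (≡-sym (+-cancelˡ-≡ (multiset# (2 + k) N) _ _ eq))

macaulay-0 : ∀ k → macaulay k 0 ≡ 0
macaulay-0 zero    = refl
macaulay-0 (suc k) = macaulay-0 k

macaulay-full : ∀ k N → macaulay k (multiset# (1 + k) N) ≡ multiset# (2 + k) N
macaulay-full zero    N = cong (multiset# 2) (multiset#-1 N)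
macaulay-full (suc k) N =
  trans (cong (macaulay (suc k)) (≡-sym (+-identityʳ (multiset# (2 + k) N))))
    (trans (macaulay-block< k N (multiset#-pos (suc k) N))
      (trans (cong (multiset# (3 + k) N +_) (macaulay-0 k)) (+-identityʳ (multiset# (3 + k) N))))

-- At the closed right end the representation jumps to index N + 1 and offset 0, but both sides are
-- `multiset# (3 + k) (suc N)`. Including this end is what allows arguments to run up to a block
-- boundary.
macaulay-block : ∀ k N {b} → b ≤ multiset# (1 + k) (suc N) →
  macaulay (suc k) (multiset# (2 + k) N + b) ≡ multiset# (3 + k) N + macaulay k b
macaulay-block k N {b} b≤ with m≤n⇒m<n∨m≡n b≤
... | inj₁ b<   = macaulay-block< k N b<
... | inj₂ refl = trans (macaulay-full (suc k) (suc N)) (cong (multiset# (3 + k) N +_) (≡-sym (macaulay-full k (suc N))))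

macaulay-suc : ∀ k n → macaulay k n < macaulay k (suc n)
macaulay-suc zero    n = subst (multiset# 2 n <_) (cong (multiset# 2 n +_) (≡-sym (multiset#-1 (suc n)))) (m<m+n _ (s≤s z≤n))
macaulay-suc (suc k) n = go (locate k n)
  where
  go : Block k n → macaulay (suc k) n < macaulay (suc k) (suc n)
  go (block N b refl b<) = subst₂ _<_ (≡-sym (macaulay-block< k N b<))
    (trans (≡-sym (macaulay-block k N b<)) (cong (macaulay (suc k)) (+-suc (multiset# (2 + k) N) b)))
    (+-monoʳ-< (multiset# (3 + k) N) (macaulay-suc k b))

macaulay-grow : ∀ k n b → macaulay k n + b ≤ macaulay k (n + b)
macaulay-grow k n zero    = ≤-reflexive (trans (+-identityʳ _) (cong (macaulay k) (≡-sym (+-identityʳ n))))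
macaulay-grow k n (suc b) = subst₂ _≤_ (≡-sym (+-suc _ b)) (cong (macaulay k) (≡-sym (+-suc n b)))
  (≤-trans (s≤s (macaulay-grow k n b)) (macaulay-suc k (n + b)))

macaulay-mono : ∀ k {m n} → m ≤ n → macaulay k m ≤ macaulay k n
macaulay-mono k {m} m≤n = ≤-trans (m≤m+n _ _) (≤-trans (macaulay-grow k m _) (≤-reflexive (cong (macaulay k) (m+[n∸m]≡n m≤n))))

-- Each step raises `macaulay k` by at least one, so going back from the full value at
-- `multiset# (1 + k) (suc M)` loses at least the distance.
macaulay-bound : ∀ k M {b} → b ≤ multiset# (1 + k) (suc M) → macaulay k b ≤ multiset# (2 + k) M + b
macaulay-bound k M {b} b≤ = +-cancelʳ-≤ d _ _ (≤-trans (macaulay-grow k b d)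
  (≤-reflexive (trans (cong (macaulay k) b+d) (trans (macaulay-full k (suc M))
    (trans (cong (multiset# (2 + k) M +_) (≡-sym b+d)) (≡-sym (+-assoc _ b d)))))))
  where
  d = multiset# (1 + k) (suc M) ∸ b
  b+d : b + d ≡ multiset# (1 + k) (suc M)
  b+d = m+[n∸m]≡n b≤

-- Increments of Macaulay's function

Superadditive : ℕ → Set
Superadditive k = ∀ a b → macaulay k a + macaulay k b ≤ macaulay k (a + b)

-- Among the windows of given length inside [0 , multiset# (1 + k) N), the last one has the
-- largest increment of macaulay k.
LastWindowMax : ℕ → Set
LastWindowMax k = ∀ N a b d → a + b + d ≡ multiset# (1 + k) N →
  macaulay k (a + b) + macaulay k (a + d) ≤ macaulay k a + macaulay k (a + b + d)

-- The last hypothesis bounds x by the increment of `macaulay k` over the window of length β that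
-- starts at `multiset# (1 + k) N`. At an earlier start o the increment can be smaller; the cap x ≤
-- o + β makes up for that.
WindowGain : ℕ → Set
WindowGain k = ∀ N o β x → o ≤ multiset# (1 + k) N → x ≤ o + β →
  multiset# (2 + k) N + x ≤ macaulay k (multiset# (1 + k) N + β) →
  macaulay k o + x ≤ macaulay k (o + β)

-- macaulay (k+1) a + min (macaulay k b) (a + b) ≤ macaulay (k+1) (a + b)
Gain : ℕ → Set
Gain k = ∀ a b x → x ≤ a + b → x ≤ macaulay k b → macaulay (suc k) a + x ≤ macaulay (suc k) (a + b)

-- Write a = S + o in block N, of length ℓ. If a + b stays in the block, superadditivity suffices.
-- If it ends in block N + 1, the length b′ reached there is compared with o, which leads to the
-- other two hypotheses. Beyond block N + 1, the cap x ≤ a + b is enough.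
gain : ∀ k → Superadditive k → LastWindowMax k → WindowGain k → Gain k
gain k sup lwm wg a b x x≤ x≤V with locate k a
... | block N o refl o< = result
  where
  TN = multiset# (3 + k) N
  S  = multiset# (2 + k) N
  ℓ  = multiset# (1 + k) (suc N)
  V  = macaulay k
  V′ = macaulay (suc k)
  Vℓ : V ℓ ≡ S + ℓ
  Vℓ = macaulay-full k (suc N)
  crossing : ∀ b′ → o + b ≡ ℓ + b′ → V o + x ≤ (S + ℓ) + V b′ →
    b′ ≤ multiset# (1 + k) (suc (suc N)) → TN + V o + x ≤ V′ (S + o + b)
  crossing b′ eq le b′≤ = begin
    TN + V o + x             ≡⟨ +-assoc TN _ x ⟩
    TN + (V o + x)           ≤⟨ +-monoʳ-≤ TN le ⟩
    TN + ((S + ℓ) + V b′)    ≡⟨ ≡-sym (+-assoc TN _ _) ⟩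
    multiset# (3 + k) (suc N) + V b′ ≡⟨ ≡-sym (macaulay-block k (suc N) b′≤) ⟩
    V′ (S + ℓ + b′)          ≡⟨ cong V′ (trans (+-assoc S ℓ b′) (trans (cong (S +_) (≡-sym eq)) (≡-sym (+-assoc S o b)))) ⟩
    V′ (S + o + b)           ∎ where open ≤-Reasoning
  -- Over the blocks N and N + 1 the function V′ rises by S + ℓ and by S + ℓ + ℓ₂. The first rise
  -- pays for V o; the second, with unit growth over the last ρ steps, pays for x ≤ a + b.
  far : ∀ b′ → o + b ≡ ℓ + b′ → multiset# (1 + k) (suc (suc N)) ≤ b′ → TN + V o + x ≤ V′ (S + o + b)
  far b′ eq le = begin
    TN + V o + x             ≤⟨ +-mono-≤ (+-monoʳ-≤ TN (≤-trans (macaulay-mono k (<⇒≤ o<)) (≤-reflexive Vℓ))) x≤ ⟩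
    TN + (S + ℓ) + (S + o + b) ≡⟨ cong (TN + (S + ℓ) +_) (trans (+-assoc S o b) (trans (cong (S +_) (trans eq (cong (ℓ +_) (≡-sym ρeq)))) (re₁ S ℓ ℓ₂ ρ))) ⟩
    TN + (S + ℓ) + (S + ℓ + ℓ₂ + ρ) ≡⟨ ≡-sym (+-assoc (TN + (S + ℓ)) (S + ℓ + ℓ₂) ρ) ⟩
    multiset# (3 + k) (suc (suc N)) + ρ ≡⟨ cong (_+ ρ) (≡-sym (macaulay-full (suc k) (suc (suc N)))) ⟩
    V′ (S + ℓ + ℓ₂) + ρ       ≤⟨ macaulay-grow (suc k) (S + ℓ + ℓ₂) ρ ⟩
    V′ (S + ℓ + ℓ₂ + ρ)       ≡⟨ cong V′ (trans (≡-sym (re₁ S ℓ ℓ₂ ρ)) (trans (cong (λ z → S + (ℓ + z)) ρeq) (trans (cong (S +_) (≡-sym eq)) (≡-sym (+-assoc S o b))))) ⟩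
    V′ (S + o + b)           ∎
    where
    open ≤-Reasoning
    ℓ₂ = multiset# (1 + k) (suc (suc N))
    ρ = b′ ∸ ℓ₂
    ρeq : ℓ₂ + ρ ≡ b′
    ρeq = m+[n∸m]≡n le
    re₁ : ∀ S ℓ ℓ₂ ρ → S + (ℓ + (ℓ₂ + ρ)) ≡ S + ℓ + ℓ₂ + ρ
    re₁ = solve-∀
  -- S + ℓ = V ℓ absorbs x up to that size; only an excess x′ has to be gained between o and o + β,
  -- and this is `WindowGain` at N + 1.
  longer : ∀ β → b ≡ ℓ + β → V o + x ≤ (S + ℓ) + V (o + β)
  longer β refl with x ≤? S + ℓ
  ... | yes p = ≤-trans (≤-reflexive (+-comm (V o) x)) (+-mono-≤ p (macaulay-mono k (m≤m+n o β)))
  ... | no ¬p = begin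
    V o + x                   ≡⟨ cong (V o +_) (≡-sym xeq) ⟩
    V o + (S + ℓ + x′)        ≡⟨ re₂ (V o) (S + ℓ) x′ ⟩
    S + ℓ + (V o + x′)        ≤⟨ +-monoʳ-≤ (S + ℓ) (wg (suc N) o β x′ (<⇒≤ o<) x′≤ (≤-trans (≤-reflexive xeq) x≤V)) ⟩
    S + ℓ + V (o + β)         ∎
    where
    open ≤-Reasoning
    x′ = x ∸ (S + ℓ)
    xeq : S + ℓ + x′ ≡ x
    xeq = m+[n∸m]≡n (<⇒≤ (≰⇒> ¬p))
    re₂ : ∀ p q r → p + (q + r) ≡ q + (p + r)
    re₂ = solve-∀
    re₃ : ∀ S o ℓ β → S + o + (ℓ + β) ≡ S + ℓ + (o + β)
    re₃ = solve-∀
    x′≤ : x′ ≤ o + β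
    x′≤ = +-cancelˡ-≤ (S + ℓ) _ _ (≤-trans (≤-reflexive xeq) (≤-trans x≤ (≤-reflexive (re₃ S o ℓ β))))
  -- With d = ℓ ∸ o one has o = b′ + δ, b = b′ + d and ℓ = b′ + δ + d, the configuration of
  -- `LastWindowMax`.
  shorter : ∀ b′ δ → o ≡ b′ + δ → o + b ≡ ℓ + b′ → V o + x ≤ (S + ℓ) + V b′
  shorter b′ δ oeq eq = begin
    V o + x                    ≤⟨ +-monoʳ-≤ (V o) x≤V ⟩
    V o + V b                  ≡⟨ cong₂ (λ p q → V p + V q) oeq beq ⟩
    V (b′ + δ) + V (b′ + d)    ≤⟨ lwm (suc N) b′ δ d tot ⟩
    V b′ + V (b′ + δ + d)      ≡⟨ +-comm (V b′) _ ⟩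
    V (b′ + δ + d) + V b′      ≡⟨ cong (_+ V b′) (trans (cong V tot) Vℓ) ⟩
    S + ℓ + V b′               ∎
    where
    open ≤-Reasoning
    d = ℓ ∸ o
    tot : b′ + δ + d ≡ ℓ
    tot = trans (cong (_+ d) (≡-sym oeq)) (m+[n∸m]≡n (<⇒≤ o<))
    re₄ : ∀ b′ δ d → b′ + δ + (b′ + d) ≡ b′ + δ + d + b′
    re₄ = solve-∀
    beq : b ≡ b′ + d
    beq = +-cancelˡ-≡ o _ _ (trans eq (≡-sym (trans (cong (_+ (b′ + d)) oeq) (trans (re₄ b′ δ d) (cong (_+ b′) tot)))))
  result : TN + V o + x ≤ V′ (S + o + b)
  result with ≤-total (o + b) ℓ
  ... | inj₁ inside = begin
    TN + V o + x      ≤⟨ +-monoʳ-≤ (TN + V o) x≤V ⟩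
    TN + V o + V b    ≡⟨ +-assoc TN _ _ ⟩
    TN + (V o + V b)  ≤⟨ +-monoʳ-≤ TN (sup o b) ⟩
    TN + V (o + b)    ≡⟨ ≡-sym (macaulay-block k N inside) ⟩
    V′ (S + (o + b))  ≡⟨ cong V′ (≡-sym (+-assoc S o b)) ⟩
    V′ (S + o + b)    ∎ where open ≤-Reasoning
  ... | inj₂ cross with ≤-total (o + b ∸ ℓ) (multiset# (1 + k) (suc (suc N)))
  ...   | inj₂ fa = far _ (≡-sym (m+[n∸m]≡n cross)) fa
  ...   | inj₁ near with ≤-total o (o + b ∸ ℓ)
  ...     | inj₂ b′≤o = crossing _ eq (shorter _ (o ∸ (o + b ∸ ℓ)) (≡-sym (m+[n∸m]≡n b′≤o)) eq) near
    where eq = ≡-sym (m+[n∸m]≡n cross)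
  ...     | inj₁ o≤b′ = crossing _ eq (subst (λ z → V o + x ≤ (S + ℓ) + V z) (m+[n∸m]≡n o≤b′) (longer β beq)) near
    where
    eq = ≡-sym (m+[n∸m]≡n cross)
    β = o + b ∸ ℓ ∸ o
    re₅ : ∀ ℓ o β → ℓ + (o + β) ≡ o + (ℓ + β)
    re₅ = solve-∀
    beq : b ≡ ℓ + β
    beq = +-cancelˡ-≡ o _ _ (trans eq (trans (cong (ℓ +_) (≡-sym (m+[n∸m]≡n o≤b′))) (re₅ ℓ o β)))

-- b is added in pieces of known gain: its complete blocks in turn, then its offset. The cap in
-- `Gain` holds at each stage because the blocks added before already make the argument large
-- enough.
superadditive-suc : ∀ k → Gain k → Superadditive (suc k)
superadditive-suc k g a b with locate k b
... | block M β refl β< = begin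
  V′ a + (multiset# (3 + k) M + V β)   ≡⟨ ≡-sym (+-assoc (V′ a) _ _) ⟩
  V′ a + multiset# (3 + k) M + V β     ≤⟨ +-monoˡ-≤ (V β) (full M) ⟩
  V′ (a + multiset# (2 + k) M) + V β   ≤⟨ g _ β (V β) (≤-trans (macaulay-bound k M (<⇒≤ β<)) (+-monoˡ-≤ β (m≤n+m _ a))) ≤-refl ⟩
  V′ (a + multiset# (2 + k) M + β)     ≡⟨ cong V′ (+-assoc a _ β) ⟩
  V′ (a + (multiset# (2 + k) M + β))   ∎
  where
  open ≤-Reasoning
  V = macaulay k
  V′ = macaulay (suc k)
  full : ∀ M → V′ a + multiset# (3 + k) M ≤ V′ (a + multiset# (2 + k) M)
  full zero    = ≤-reflexive (trans (+-identityʳ _) (cong V′ (≡-sym (+-identityʳ a))))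
  full (suc M) = begin
    V′ a + (multiset# (3 + k) M + multiset# (2 + k) (suc M)) ≡⟨ ≡-sym (+-assoc (V′ a) _ _) ⟩
    V′ a + multiset# (3 + k) M + multiset# (2 + k) (suc M)   ≤⟨ +-monoˡ-≤ _ (full M) ⟩
    V′ (a + multiset# (2 + k) M) + multiset# (2 + k) (suc M)
      ≤⟨ g (a + multiset# (2 + k) M) (multiset# (1 + k) (suc M)) (multiset# (2 + k) (suc M)) (+-monoˡ-≤ (multiset# (1 + k) (suc M)) (m≤n+m (multiset# (2 + k) M) a)) (≤-reflexive (≡-sym (macaulay-full k (suc M)))) ⟩
    V′ (a + multiset# (2 + k) M + multiset# (1 + k) (suc M)) ≡⟨ cong V′ (+-assoc a _ _) ⟩
    V′ (a + multiset# (2 + k) (suc M)) ∎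

-- Either way x ≤ `macaulay k β`, so `Gain` applies. A short β keeps the window in block N, whose
-- increments are those of `macaulay k`; a long one makes `macaulay k β` exceed even
-- `multiset# (2 + k) N + β`, hence the cap o + β.
windowGain-suc : ∀ k → Gain k → WindowGain (suc k)
windowGain-suc k g N o β x o≤ x≤ le with ≤-total β (multiset# (1 + k) (suc N))
... | inj₁ short = g o β x x≤ (+-cancelˡ-≤ (multiset# (3 + k) N) _ _ (≤-trans le (≤-reflexive (macaulay-block k N short))))
... | inj₂ long = g o β x x≤ (begin
  x                          ≤⟨ x≤ ⟩
  o + β                      ≤⟨ +-monoˡ-≤ β o≤ ⟩
  multiset# (2 + k) N + β    ≡⟨ cong (multiset# (2 + k) N +_) (≡-sym β≡) ⟩
  multiset# (2 + k) N + (ℓ + ρ) ≡⟨ ≡-sym (+-assoc (multiset# (2 + k) N) ℓ ρ) ⟩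
  multiset# (2 + k) (suc N) + ρ ≡⟨ cong (_+ ρ) (≡-sym (macaulay-full k (suc N))) ⟩
  macaulay k ℓ + ρ           ≤⟨ macaulay-grow k ℓ ρ ⟩
  macaulay k (ℓ + ρ)         ≡⟨ cong (macaulay k) β≡ ⟩
  macaulay k β               ∎)
  where
  open ≤-Reasoning
  ℓ = multiset# (1 + k) (suc N)
  ρ = β ∸ ℓ
  β≡ : ℓ + ρ ≡ β
  β≡ = m+[n∸m]≡n long

-- Within block N this is an equality. Past its end the increments start again as those of
-- `macaulay k` from 0, and superadditivity merges the successive runs into one.
block-prefix : ∀ k → Superadditive k → ∀ y N →
  macaulay (suc k) (multiset# (2 + k) N + y) ≤ multiset# (3 + k) N + macaulay k y
block-prefix k sup = <-rec _ go
  where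
  go : ∀ y → (∀ {y′} → y′ < y → ∀ N → macaulay (suc k) (multiset# (2 + k) N + y′) ≤ multiset# (3 + k) N + macaulay k y′) →
    ∀ N → macaulay (suc k) (multiset# (2 + k) N + y) ≤ multiset# (3 + k) N + macaulay k y
  go y ih N with ≤-total y (multiset# (1 + k) (suc N))
  ... | inj₁ short = ≤-reflexive (macaulay-block k N short)
  ... | inj₂ long = begin
    macaulay (suc k) (S + y)            ≡⟨ cong (macaulay (suc k)) (trans (cong (S +_) (≡-sym y≡)) (≡-sym (+-assoc S ℓ ρ))) ⟩
    macaulay (suc k) (S + ℓ + ρ)        ≤⟨ ih ρ<y (suc N) ⟩
    multiset# (3 + k) N + (S + ℓ) + macaulay k ρ ≡⟨ +-assoc (multiset# (3 + k) N) _ _ ⟩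
    multiset# (3 + k) N + (S + ℓ + macaulay k ρ) ≡⟨ cong (λ z → multiset# (3 + k) N + (z + macaulay k ρ)) (≡-sym (macaulay-full k (suc N))) ⟩
    multiset# (3 + k) N + (macaulay k ℓ + macaulay k ρ) ≤⟨ +-monoʳ-≤ _ (sup ℓ ρ) ⟩
    multiset# (3 + k) N + macaulay k (ℓ + ρ) ≡⟨ cong (λ z → multiset# (3 + k) N + macaulay k z) y≡ ⟩
    multiset# (3 + k) N + macaulay k y   ∎
    where
    open ≤-Reasoning
    S = multiset# (2 + k) N
    ℓ = multiset# (1 + k) (suc N)
    ρ = y ∸ ℓ
    y≡ : ℓ + ρ ≡ y
    y≡ = m+[n∸m]≡n long
    ρ<y : ρ < y
    ρ<y = <-≤-trans (m<n+m ρ (multiset#-pos (1 + k) N)) (≤-reflexive y≡)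

-- A window inside a block K ≤ N is a window of `macaulay k`, so `LastWindowMax` compares it with
-- the last b positions of block N. A window that leaves its block is cut at the boundary: the part
-- y beyond behaves like a run from 0, which superadditivity replaces by a run from r.
shortWindow : ∀ k → Superadditive k → LastWindowMax k → ∀ N a b r →
  b + r ≡ multiset# (1 + k) (suc N) → a + b ≤ multiset# (2 + k) (suc N) →
  macaulay (suc k) (a + b) + macaulay k r ≤ macaulay (suc k) a + macaulay k (b + r)
shortWindow k sup lwm N a b r eq le with locate k a
... | block K o refl o< = result
  where
  open ≤-Reasoning
  TK = multiset# (3 + k) K
  S = multiset# (2 + k) K
  ℓK = multiset# (1 + k) (suc K)
  V = macaulay k
  V′ = macaulay (suc k)
  b≡0∨K≤N : ∀ b → S + o + b ≤ multiset# (2 + k) (suc N) → (b ≡ 0) ⊎ (K ≤ N)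
  b≡0∨K≤N zero _ = inj₁ refl
  b≡0∨K≤N (suc b′) le with K ≤? N
  ... | yes p = inj₂ p
  ... | no ¬p = ⊥-elim (<-irrefl refl (<-≤-trans (m<m+n _ (s≤s z≤n)) (≤-trans (+-monoˡ-≤ (suc b′) (m≤m+n S o)) (≤-trans le (multiset#-mono (2 + k) (≰⇒> ¬p))))))
  window : ∀ x d → o + x + d ≡ b + r → V (o + x) + V (o + d) ≤ V o + V (b + r)
  window x d e = ≤-trans (lwm (suc N) o x d (trans e eq)) (≤-reflexive (cong (λ z → V o + V z) e))
  main : K ≤ N → V′ (S + o + b) + V r ≤ TK + V o + V (b + r)
  main K≤N with ≤-total (o + b) ℓK
  ... | inj₁ inside = begin
    V′ (S + o + b) + V r     ≡⟨ cong (λ z → V′ z + V r) (+-assoc S o b) ⟩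
    V′ (S + (o + b)) + V r   ≡⟨ cong (_+ V r) (macaulay-block k K inside) ⟩
    TK + V (o + b) + V r     ≡⟨ +-assoc TK _ _ ⟩
    TK + (V (o + b) + V r)   ≡⟨ cong (λ z → TK + (V (o + b) + V z)) r≡ ⟩
    TK + (V (o + b) + V (o + d)) ≤⟨ +-monoʳ-≤ TK (window b d tot) ⟩
    TK + (V o + V (b + r))   ≡⟨ ≡-sym (+-assoc TK _ _) ⟩
    TK + V o + V (b + r)     ∎
    where
    d = b + r ∸ (o + b)
    tot : o + b + d ≡ b + r
    tot = m+[n∸m]≡n (≤-trans inside (≤-trans (multiset#-mono (1 + k) (s≤s K≤N)) (≤-reflexive (≡-sym eq))))
    r≡ : r ≡ o + d
    r≡ = +-cancelˡ-≡ b _ _ (trans (≡-sym tot) (trans (cong (_+ d) (+-comm o b)) (+-assoc b o d)))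
  ... | inj₂ cross = begin
    V′ (S + o + b) + V r     ≡⟨ cong (λ z → V′ z + V r) (trans (+-assoc S o b) (trans (cong (S +_) (≡-sym ob)) (≡-sym (+-assoc S ℓK y)))) ⟩
    V′ (S + ℓK + y) + V r    ≤⟨ +-monoˡ-≤ (V r) (block-prefix k sup y (suc K)) ⟩
    TK + (S + ℓK) + V y + V r ≡⟨ cong (λ z → TK + z + V y + V r) (≡-sym (trans (cong V ox) (macaulay-full k (suc K)))) ⟩
    TK + V (o + x) + V y + V r ≡⟨ re (TK + V (o + x)) (V y) (V r) ⟩
    TK + V (o + x) + (V y + V r) ≤⟨ +-monoʳ-≤ (TK + V (o + x)) (sup y r) ⟩
    TK + V (o + x) + V (y + r) ≡⟨ +-assoc TK _ _ ⟩
    TK + (V (o + x) + V (y + r)) ≡⟨ cong (λ z → TK + (V (o + x) + V z)) yr≡ ⟩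
    TK + (V (o + x) + V (o + d)) ≤⟨ +-monoʳ-≤ TK (window x d tot) ⟩
    TK + (V o + V (b + r))   ≡⟨ ≡-sym (+-assoc TK _ _) ⟩
    TK + V o + V (b + r)     ∎
    where
    x = ℓK ∸ o
    ox : o + x ≡ ℓK
    ox = m+[n∸m]≡n (<⇒≤ o<)
    y = o + b ∸ ℓK
    ob : ℓK + y ≡ o + b
    ob = m+[n∸m]≡n cross
    b≡ : b ≡ x + y
    b≡ = +-cancelˡ-≡ o _ _ (trans (≡-sym ob) (trans (cong (_+ y) (≡-sym ox)) (+-assoc o x y)))
    d = b + r ∸ ℓK
    dd : ℓK + d ≡ b + r
    dd = m+[n∸m]≡n (≤-trans (multiset#-mono (1 + k) (s≤s K≤N)) (≤-reflexive (≡-sym eq)))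
    tot : o + x + d ≡ b + r
    tot = trans (cong (_+ d) ox) dd
    re : ∀ p q r → p + q + r ≡ p + (q + r)
    re = solve-∀
    re₂ : ∀ x o d → o + x + d ≡ x + (o + d)
    re₂ = solve-∀
    yr≡ : y + r ≡ o + d
    yr≡ = +-cancelˡ-≡ x _ _ (trans (≡-sym (+-assoc x y r)) (trans (cong (_+ r) (≡-sym b≡)) (trans (≡-sym tot) (re₂ x o d))))
  result : V′ (S + o + b) + V r ≤ TK + V o + V (b + r)
  result with b≡0∨K≤N b le
  ... | inj₂ p = main p
  ... | inj₁ refl = ≤-reflexive (cong (_+ V r) (trans (cong V′ (+-identityʳ (S + o))) (macaulay-block< k K o<)))

-- The claim is symmetric in b and d. If one of them is at most the length ℓ of the last block, the
-- final window of that length lies in this block and `shortWindow` applies. If both are longer, b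
-- is shortened by ℓ and the last block is dropped.
lastWindowMax-suc : ∀ k → Superadditive k → LastWindowMax k → LastWindowMax (suc k)
lastWindowMax-suc k sup lwm = go
  where
  open ≤-Reasoning
  V = macaulay k
  V′ = macaulay (suc k)
  short : ∀ N a b d → a + b + d ≡ multiset# (2 + k) (suc N) → b ≤ multiset# (1 + k) (suc N) →
    V′ (a + b) + V′ (a + d) ≤ V′ a + V′ (a + b + d)
  short N a b d eq b≤ = begin
    V′ (a + b) + V′ (a + d)    ≡⟨ cong (λ z → V′ (a + b) + V′ z) ad≡ ⟩
    V′ (a + b) + V′ (S + r)    ≡⟨ cong (V′ (a + b) +_) (macaulay-block k N (≤-trans (m≤n+m r b) (≤-reflexive br))) ⟩
    V′ (a + b) + (T₃ + V r)    ≡⟨ re (V′ (a + b)) T₃ (V r) ⟩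
    T₃ + (V′ (a + b) + V r)    ≤⟨ +-monoʳ-≤ T₃ (shortWindow k sup lwm N a b r br (≤-trans (m≤m+n _ d) (≤-reflexive eq))) ⟩
    T₃ + (V′ a + V (b + r))    ≡⟨ re T₃ (V′ a) _ ⟩
    V′ a + (T₃ + V (b + r))    ≡⟨ cong (λ z → V′ a + (T₃ + z)) (trans (cong V br) (macaulay-full k (suc N))) ⟩
    V′ a + multiset# (3 + k) (suc N) ≡⟨ cong (V′ a +_) (≡-sym (trans (cong V′ eq) (macaulay-full (suc k) (suc N)))) ⟩
    V′ a + V′ (a + b + d)      ∎
    where
    T₃ = multiset# (3 + k) N
    S = multiset# (2 + k) N
    r = multiset# (1 + k) (suc N) ∸ b
    br : b + r ≡ multiset# (1 + k) (suc N)
    br = m+[n∸m]≡n b≤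
    re : ∀ p q s → p + (q + s) ≡ q + (p + s)
    re = solve-∀
    re₁ : ∀ a b d → a + b + d ≡ b + (a + d)
    re₁ = solve-∀
    ad≡ : a + d ≡ S + r
    ad≡ = +-cancelˡ-≡ b _ _ (trans (≡-sym (re₁ a b d)) (trans eq (trans (cong (S +_) (≡-sym br)) (re S b r))))
  go : LastWindowMax (suc k)
  go zero a b d eq with m+n≡0⇒m≡0 a (m+n≡0⇒m≡0 (a + b) eq) | m+n≡0⇒n≡0 a (m+n≡0⇒m≡0 (a + b) eq) | m+n≡0⇒n≡0 (a + b) eq
  ... | refl | refl | refl = ≤-refl
  go (suc N) a b d eq with ≤-total b (multiset# (1 + k) (suc N)) | ≤-total d (multiset# (1 + k) (suc N))
  ... | inj₁ b≤ | _ = short N a b d eq b≤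
  ... | inj₂ _ | inj₁ d≤ = begin
    V′ (a + b) + V′ (a + d)    ≡⟨ +-comm _ (V′ (a + d)) ⟩
    V′ (a + d) + V′ (a + b)    ≤⟨ short N a d b (trans (re a d b) eq) d≤ ⟩
    V′ a + V′ (a + d + b)      ≡⟨ cong (λ z → V′ a + V′ z) (re a d b) ⟩
    V′ a + V′ (a + b + d)      ∎
    where
    re : ∀ a d b → a + d + b ≡ a + b + d
    re = solve-∀
  ... | inj₂ b≥ | inj₂ d≥ = begin
    V′ (a + b) + V′ (a + d)        ≡⟨ cong (λ z → V′ z + V′ (a + d)) ab≡ ⟩
    V′ (a + b₁ + ℓ) + V′ (a + d)   ≤⟨ +-monoˡ-≤ (V′ (a + d)) step ⟩
    V′ (a + b₁) + V ℓ + V′ (a + d) ≡⟨ re (V′ (a + b₁)) (V ℓ) (V′ (a + d)) ⟩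
    V′ (a + b₁) + V′ (a + d) + V ℓ ≤⟨ +-monoˡ-≤ (V ℓ) (go N a b₁ d tot) ⟩
    V′ a + V′ (a + b₁ + d) + V ℓ   ≡⟨ cong (λ z → V′ a + z + V ℓ) (trans (cong V′ tot) (macaulay-full (suc k) N)) ⟩
    V′ a + multiset# (3 + k) N + V ℓ ≡⟨ +-assoc (V′ a) _ _ ⟩
    V′ a + (multiset# (3 + k) N + V ℓ) ≡⟨ cong (λ z → V′ a + (multiset# (3 + k) N + z)) (macaulay-full k (suc N)) ⟩
    V′ a + multiset# (3 + k) (suc N) ≡⟨ cong (V′ a +_) (≡-sym (trans (cong V′ eq) (macaulay-full (suc k) (suc N)))) ⟩
    V′ a + V′ (a + b + d)          ∎
    where
    ℓ = multiset# (1 + k) (suc N)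
    b₁ = b ∸ ℓ
    b≡ : b₁ + ℓ ≡ b
    b≡ = m∸n+n≡m b≥
    ab≡ : a + b ≡ a + b₁ + ℓ
    ab≡ = trans (cong (a +_) (≡-sym b≡)) (≡-sym (+-assoc a b₁ ℓ))
    re : ∀ p q s → p + q + s ≡ p + s + q
    re = solve-∀
    tot : a + b₁ + d ≡ multiset# (2 + k) N
    tot = +-cancelʳ-≡ ℓ _ _ (trans (re (a + b₁) d ℓ) (trans (cong (_+ d) (≡-sym ab≡)) eq))
    step : V′ (a + b₁ + ℓ) ≤ V′ (a + b₁) + V ℓ
    step = subst₂ _≤_ (trans (cong (V′ (a + b₁ + ℓ) +_) (macaulay-0 k)) (+-identityʳ _)) (cong (λ z → V′ (a + b₁) + V z) (+-identityʳ ℓ))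
      (shortWindow k sup lwm N (a + b₁) ℓ 0 (+-identityʳ ℓ) (≤-trans (≤-reflexive (≡-sym ab≡)) (≤-trans (m≤m+n _ d) (≤-reflexive eq))))

multiset#-2-suc : ∀ n → multiset# 2 (suc n) ≡ multiset# 2 n + suc n
multiset#-2-suc n = cong (multiset# 2 n +_) (multiset#-1 (suc n))

superadditive-0 : Superadditive 0
superadditive-0 a zero    = ≤-reflexive (trans (+-identityʳ _) (cong (multiset# 2) (≡-sym (+-identityʳ a))))
superadditive-0 a (suc b) = begin
  multiset# 2 a + multiset# 2 (suc b)       ≡⟨ cong (multiset# 2 a +_) (multiset#-2-suc b) ⟩
  multiset# 2 a + (multiset# 2 b + suc b)   ≡⟨ ≡-sym (+-assoc (multiset# 2 a) _ _) ⟩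
  multiset# 2 a + multiset# 2 b + suc b     ≤⟨ +-mono-≤ (superadditive-0 a b) (s≤s (m≤n+m b a)) ⟩
  multiset# 2 (a + b) + suc (a + b)         ≡⟨ ≡-sym (multiset#-2-suc (a + b)) ⟩
  multiset# 2 (suc (a + b))                 ≡⟨ cong (multiset# 2) (≡-sym (+-suc a b)) ⟩
  multiset# 2 (a + suc b)                   ∎
  where open ≤-Reasoning

lastWindowMax-0 : LastWindowMax 0
lastWindowMax-0 N a b d _ = go d
  where
  open ≤-Reasoning
  t = multiset# 2
  go : ∀ d → t (a + b) + t (a + d) ≤ t a + t (a + b + d)
  go zero = ≤-reflexive (trans (+-comm (t (a + b)) _) (cong₂ (λ p q → t p + t q) (+-identityʳ a) (≡-sym (+-identityʳ (a + b)))))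
  go (suc d) = begin
    t (a + b) + t (a + suc d)           ≡⟨ cong (λ z → t (a + b) + t z) (+-suc a d) ⟩
    t (a + b) + t (suc (a + d))         ≡⟨ cong (t (a + b) +_) (multiset#-2-suc (a + d)) ⟩
    t (a + b) + (t (a + d) + suc (a + d)) ≡⟨ ≡-sym (+-assoc (t (a + b)) _ _) ⟩
    t (a + b) + t (a + d) + suc (a + d) ≤⟨ +-mono-≤ (go d) (s≤s (+-monoˡ-≤ d (m≤m+n a b))) ⟩
    t a + t (a + b + d) + suc (a + b + d) ≡⟨ +-assoc (t a) _ _ ⟩
    t a + (t (a + b + d) + suc (a + b + d)) ≡⟨ cong (t a +_) (≡-sym (multiset#-2-suc (a + b + d))) ⟩
    t a + t (suc (a + b + d))           ≡⟨ cong (λ z → t a + t z) (≡-sym (+-suc (a + b) d)) ⟩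
    t a + t (a + b + suc d)             ∎

windowGain-0 : WindowGain 0
windowGain-0 N o zero x o≤ x≤ le = subst (λ z → macaulay 0 o + z ≤ macaulay 0 (o + 0)) (≡-sym x≡0)
  (≤-reflexive (trans (+-identityʳ _) (cong (multiset# 2) (≡-sym (+-identityʳ o)))))
  where
  x≡0 : x ≡ 0
  x≡0 = n≤0⇒n≡0 (+-cancelˡ-≤ (multiset# 2 N) _ _ (≤-trans le (≤-reflexive (trans (cong (multiset# 2) (trans (+-identityʳ _) (multiset#-1 N))) (≡-sym (+-identityʳ _))))))
-- The last step of the window alone raises `multiset# 2` by suc (o + β), which is at least x.
windowGain-0 N o (suc β) x o≤ x≤ le = begin
  multiset# 2 o + x                  ≤⟨ +-mono-≤ (macaulay-mono 0 (m≤m+n o β)) (≤-trans x≤ (≤-reflexive (+-suc o β))) ⟩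
  multiset# 2 (o + β) + suc (o + β)  ≡⟨ ≡-sym (multiset#-2-suc (o + β)) ⟩
  multiset# 2 (suc (o + β))          ≡⟨ cong (multiset# 2) (≡-sym (+-suc o β)) ⟩
  multiset# 2 (o + suc β)            ∎
  where open ≤-Reasoning

macaulay-properties : ∀ k → Superadditive k × LastWindowMax k × WindowGain k
macaulay-properties zero    = superadditive-0 , lastWindowMax-0 , windowGain-0
macaulay-properties (suc k) with macaulay-properties k
... | sup , lwm , wg = superadditive-suc k g , lastWindowMax-suc k sup lwm , windowGain-suc k g
  where g = gain k sup lwm wg

macaulay-gain : ∀ k → Gain k
macaulay-gain k with macaulay-properties k
... | sup , lwm , wg = gain k sup lwm wg

-- Order ideals of colexicographically initial monomials

data Consecutive {A : Set} (f : A → ℕ) : ℕ → List A → Set where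
  []  : ∀ {o} → Consecutive f o []
  _∷_ : ∀ {o x xs} → f x ≡ o → Consecutive f (suc o) xs → Consecutive f o (x ∷ xs)

consecutive-++ : ∀ {A : Set} {f : A → ℕ} {o xs ys} → Consecutive f o xs →
  Consecutive f (length xs + o) ys → Consecutive f o (xs ++ ys)
consecutive-++ [] c′ = c′
consecutive-++ {f = f} {o} {x ∷ xs} {ys} (eq ∷ c) c′ =
  eq ∷ consecutive-++ c (subst (λ z → Consecutive f z ys) (≡-sym (+-suc (length xs) o)) c′)

consecutive-map : ∀ {A B : Set} {f : A → ℕ} {g : B → ℕ} {h : A → B} {o xs} c →
  All (λ x → g (h x) ≡ c + f x) xs → Consecutive f o xs → Consecutive g (c + o) (map h xs)
consecutive-map c All.[] [] = []
consecutive-map {g = g} {h} {o} {x ∷ xs} c (e All.∷ es) (eq ∷ cs) =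
  trans e (cong (c +_) eq) ∷ subst (λ z → Consecutive g z (map h xs)) (+-suc c o) (consecutive-map c es cs)

consecutive-≥ : ∀ {A : Set} {f : A → ℕ} {o xs} → Consecutive f o xs → All (λ x → o ≤ f x) xs
consecutive-≥ [] = All.[]
consecutive-≥ (eq ∷ c) = ≤-reflexive (≡-sym eq) All.∷ All.map (≤-trans (n≤1+n _)) (consecutive-≥ c)

consecutive-unique : ∀ {A : Set} {f : A → ℕ} {o xs} → Consecutive f o xs → Unique xs
consecutive-unique [] = AllPairs.[]
consecutive-unique {f = f} (eq ∷ c) =
  All.map (λ o<fy x≡y → <-irrefl (trans (≡-sym eq) (cong f x≡y)) o<fy) (consecutive-≥ c) AllPairs.∷ consecutive-unique c

consecutive-take⁻ : ∀ {A : Set} {f : A → ℕ} {o xs m} n → Consecutive f o xs → m ∈ take n xs → f m < o + n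
consecutive-take⁻ {o = o} (suc n) (eq ∷ c) (here refl) = <-≤-trans (s≤s (≤-reflexive eq)) (≤-trans (s≤s (m≤m+n o n)) (≤-reflexive (≡-sym (+-suc o n))))
consecutive-take⁻ {o = o} (suc n) (eq ∷ c) (there m∈) = <-≤-trans (consecutive-take⁻ n c m∈) (≤-reflexive (≡-sym (+-suc o n)))

consecutive-take⁺ : ∀ {A : Set} {f : A → ℕ} {o xs m} n → Consecutive f o xs → m ∈ xs → f m < o + n → m ∈ take n xs
consecutive-take⁺ {f = f} {o} {m = m} zero c m∈ lt =
  ⊥-elim (<-irrefl refl (<-≤-trans lt (≤-trans (≤-reflexive (+-identityʳ o)) (All.lookup (consecutive-≥ c) m∈))))
consecutive-take⁺ (suc n) (eq ∷ c) (here refl) lt = here refl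
consecutive-take⁺ {o = o} (suc n) (eq ∷ c) (there m∈) lt = there (consecutive-take⁺ n c m∈ (<-≤-trans lt (≤-reflexive (+-suc o n))))

raise : ∀ {r} → Monomial (suc r) → Monomial (suc r)
raise (e Vec.∷ m) = suc e Vec.∷ m

monomials : ∀ r (i : ℕ) → List (Monomial r)
monomials zero    zero    = Vec.[] ∷ []
monomials zero    (suc i) = []
monomials (suc r) zero    = map (0 Vec.∷_) (monomials r 0)
monomials (suc r) (suc i) = map (0 Vec.∷_) (monomials r (suc i)) ++ map raise (monomials (suc r) i)

length-monomials : ∀ r i → length (monomials r i) ≡ multiset# i r
length-monomials zero    zero    = refl
length-monomials zero    (suc i) = refl
length-monomials (suc r) zero    = trans (length-map _ (monomials r 0)) (length-monomials r 0)
length-monomials (suc r) (suc i) = trans (length-++ (map (0 Vec.∷_) (monomials r (suc i))))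
  (cong₂ _+_ (trans (length-map _ (monomials r (suc i))) (length-monomials r (suc i)))
             (trans (length-map _ (monomials (suc r) i)) (length-monomials (suc r) i)))

monomials-degree : ∀ r i → All (λ m → degree m ≡ i) (monomials r i)
monomials-degree zero    zero    = refl All.∷ All.[]
monomials-degree zero    (suc i) = All.[]
monomials-degree (suc r) zero    = AllP.map⁺ (monomials-degree r 0)
monomials-degree (suc r) (suc i) = AllP.++⁺ (AllP.map⁺ (monomials-degree r (suc i)))
  (AllP.map⁺ (All.map (λ {m} → raised m) (monomials-degree (suc r) i)))
  where
  raised : ∀ (m : Monomial (suc r)) → degree m ≡ i → degree (raise m) ≡ suc i
  raised (e Vec.∷ m) eq = cong suc eq

∈-monomials : ∀ {r} (m : Monomial r) → m ∈ monomials r (degree m)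
∈-monomials Vec.[] = here refl
∈-monomials {suc r} (zero Vec.∷ m) with degree m | ∈-monomials m
... | zero  | m∈ = ∈-map⁺ (0 Vec.∷_) m∈
... | suc i | m∈ = ∈-++⁺ˡ (∈-map⁺ (0 Vec.∷_) m∈)
∈-monomials {suc r} (suc e Vec.∷ m) = ∈-++⁺ʳ (map (0 Vec.∷_) (monomials r (suc (e + degree m)))) (∈-map⁺ raise (∈-monomials (e Vec.∷ m)))

-- The position of a monomial among those of its degree in the colexicographic order in which
-- the head of the vector is the exponent of the largest variable.
rank : ∀ {r} → Monomial r → ℕ
rank Vec.[]              = 0
rank (zero Vec.∷ m)      = rank m
rank {suc r} (suc e Vec.∷ m) = multiset# (suc (e + degree m)) r + rank (e Vec.∷ m)

monomials-consecutive : ∀ r i → Consecutive rank 0 (monomials r i)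
monomials-consecutive zero    zero    = refl ∷ []
monomials-consecutive zero    (suc i) = []
monomials-consecutive (suc r) zero    = consecutive-map 0 (All.universal (λ _ → refl) _) (monomials-consecutive r 0)
monomials-consecutive (suc r) (suc i) = consecutive-++
  (consecutive-map 0 (All.universal (λ _ → refl) _) (monomials-consecutive r (suc i)))
  (subst (λ z → Consecutive rank z (map raise (monomials (suc r) i)))
    (cong (_+ 0) (≡-sym (trans (length-map _ (monomials r (suc i))) (length-monomials r (suc i)))))
    (consecutive-map (multiset# (suc i) r) (All.map (λ {m} → raised m) (monomials-degree (suc r) i)) (monomials-consecutive (suc r) i)))
  where
  raised : ∀ (m : Monomial (suc r)) → degree m ≡ i → rank (raise m) ≡ multiset# (suc i) r + rank m
  raised (e Vec.∷ m) refl = refl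

rank-bound : ∀ {r} (m : Monomial r) → rank m < multiset# (degree m) r
rank-bound {r} m = <-≤-trans (consecutive-take⁻ (length (monomials r (degree m))) (monomials-consecutive r (degree m))
    (subst (m ∈_) (≡-sym (take-length (monomials r (degree m)))) (∈-monomials m)))
  (≤-reflexive (length-monomials r (degree m)))
  where
  take-length : ∀ {A : Set} (xs : List A) → take (length xs) xs ≡ xs
  take-length []       = refl
  take-length (x ∷ xs) = cong (x ∷_) (take-length xs)

data _⋖_ : ∀ {r} → Monomial r → Monomial r → Set where
  here  : ∀ {r e} {m : Monomial r} → (e Vec.∷ m) ⋖ (suc e Vec.∷ m)
  there : ∀ {r e} {m m′ : Monomial r} → m ⋖ m′ → (e Vec.∷ m) ⋖ (e Vec.∷ m′)

⋖-degree : ∀ {r} {m m′ : Monomial r} → m ⋖ m′ → degree m′ ≡ suc (degree m)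
⋖-degree here = refl
⋖-degree {m = e Vec.∷ m} (there s) = trans (cong (e +_) (⋖-degree s)) (+-suc e (degree m))

rank-degree0 : ∀ {r} (m : Monomial r) → degree m ≡ 0 → rank m ≡ 0
rank-degree0 Vec.[] _ = refl
rank-degree0 (zero Vec.∷ m) eq = rank-degree0 m eq

-- The monomials that `macaulay k (rank m)` counts have all their divisors before m, so m′ is not
-- among this initial segment. In the proof, multiplication by the head variable is
-- `macaulay-bound`; otherwise the head variable is stripped from both monomials, which turns a
-- block decomposition of the rank into its offset.
macaulay-rank : ∀ {r} {m m′ : Monomial r} → m ⋖ m′ → ∀ k → degree m ≡ suc k → macaulay k (rank m) ≤ rank m′
macaulay-rank {suc r} {e Vec.∷ m} here k eq = ≤-trans
  (macaulay-bound k r (≤-trans (<⇒≤ (rank-bound (e Vec.∷ m))) (≤-reflexive (cong (λ z → multiset# z (suc r)) eq))))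
  (≤-reflexive (cong (λ z → multiset# (suc z) r + rank (e Vec.∷ m)) (≡-sym eq)))
macaulay-rank {m = zero Vec.∷ m} (there s) k eq = macaulay-rank s k eq
-- Here the smaller monomial is the head variable itself, of rank r.
macaulay-rank {suc r} {suc e Vec.∷ m} {.(suc e) Vec.∷ m′} (there s) zero eq = begin
  macaulay 0 (multiset# (suc (e + degree m)) r + rank (e Vec.∷ m)) ≡⟨ cong₂ (λ p q → macaulay 0 (multiset# (suc p) r + q)) e+d≡0 (rank-degree0 (e Vec.∷ m) e+d≡0) ⟩
  macaulay 0 (multiset# 1 r + 0) ≡⟨ cong (macaulay 0) (+-identityʳ (multiset# 1 r)) ⟩
  macaulay 0 (multiset# 1 r)     ≡⟨ macaulay-full 0 r ⟩
  multiset# 2 r                  ≡⟨ cong (λ z → multiset# (suc z) r) (≡-sym (trans (⋖-degree (there {e = e} s)) (cong suc e+d≡0))) ⟩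
  multiset# (suc (e + degree m′)) r ≤⟨ m≤m+n _ _ ⟩
  multiset# (suc (e + degree m′)) r + rank (e Vec.∷ m′) ∎
  where
  open ≤-Reasoning
  e+d≡0 : e + degree m ≡ 0
  e+d≡0 = suc-injective eq
macaulay-rank {suc r} {suc e Vec.∷ m} {.(suc e) Vec.∷ m′} (there s) (suc k) eq = begin
  macaulay (suc k) (multiset# (suc (e + degree m)) r + ρ) ≡⟨ cong (λ z → macaulay (suc k) (multiset# z r + ρ)) eq ⟩
  macaulay (suc k) (multiset# (2 + k) r + ρ) ≡⟨ macaulay-block k r (≤-trans (<⇒≤ (rank-bound (e Vec.∷ m))) (≤-reflexive (cong (λ z → multiset# z (suc r)) (suc-injective eq)))) ⟩
  multiset# (3 + k) r + macaulay k ρ ≤⟨ +-monoʳ-≤ _ (macaulay-rank (there {e = e} s) k (suc-injective eq)) ⟩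
  multiset# (3 + k) r + rank (e Vec.∷ m′) ≡⟨ cong (λ z → multiset# z r + rank (e Vec.∷ m′)) (≡-sym (trans (cong suc (⋖-degree (there {e = e} s))) (cong suc eq))) ⟩
  multiset# (suc (e + degree m′)) r + rank (e Vec.∷ m′) ∎
  where
  open ≤-Reasoning
  ρ = rank (e Vec.∷ m)

divides-step : ∀ {r} {m′ m : Monomial r} → m′ ∣ᵐ m → m′ ≡ m ⊎ (∃ λ m₁ → m′ ∣ᵐ m₁ × m₁ ⋖ m)
divides-step PW.[] = inj₁ refl
divides-step (e′≤e PW.∷ d) with divides-step d
... | inj₂ (m₁ , d′ , s) = inj₂ (_ , e′≤e PW.∷ d′ , there s)
divides-step {m = zero Vec.∷ m} (z≤n PW.∷ d) | inj₁ refl = inj₁ refl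
divides-step {m′ = e′ Vec.∷ _} {m = suc e Vec.∷ m} (e′≤e PW.∷ d) | inj₁ refl with m≤n⇒m<n∨m≡n e′≤e
... | inj₁ (s≤s e′≤) = inj₂ (e Vec.∷ m , e′≤ PW.∷ d , here)
... | inj₂ refl = inj₁ refl

-- Realising a sequence by an order ideal

record IsMacaulay (d : ℕ) (g : ℕ → ℕ) : Set where
  field
    start  : g 0 ≡ 1
    growth : ∀ i → 2 + i ≤ d → g (2 + i) ≤ macaulay i (g (1 + i))
open IsMacaulay

module Realisation (d : ℕ) (g : ℕ → ℕ) (M : IsMacaulay d g) where
  -- With g 1 variables the condition in degree one is automatic, and the growth condition then
  -- keeps each later g i within the number of monomials of degree i.
  r : ℕ
  r = g 1

  layer : ℕ → List (Monomial r)
  layer i = take (g i) (monomials r i)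

  layers : ℕ → List (Monomial r)
  layers zero    = layer 0
  layers (suc e) = layers e ++ layer (suc e)

  g-bound : ∀ i → i ≤ d → g i ≤ multiset# i r
  g-bound zero          _   = ≤-reflexive (start M)
  g-bound (suc zero)    _   = ≤-reflexive (≡-sym (multiset#-1 r))
  g-bound (suc (suc i)) i≤d = ≤-trans (growth M i i≤d)
    (≤-trans (macaulay-mono i (g-bound (suc i) (≤-trans (n≤1+n _) i≤d))) (≤-reflexive (macaulay-full i r)))

  layer-degree : ∀ i → All (λ m → degree m ≡ i) (layer i)
  layer-degree i = AllP.take⁺ (g i) (monomials-degree r i)

  layer⁻ : ∀ i {m} → m ∈ layer i → degree m ≡ i × rank m < g i
  layer⁻ i m∈ = All.lookup (layer-degree i) m∈ , consecutive-take⁻ (g i) (monomials-consecutive r i) m∈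

  layers⁻ : ∀ e {m} → m ∈ layers e → degree m ≤ e × rank m < g (degree m)
  layers⁻ zero m∈ with layer⁻ 0 m∈
  ... | eq , lt = ≤-reflexive eq , <-≤-trans lt (≤-reflexive (cong g (≡-sym eq)))
  layers⁻ (suc e) m∈ with ∈-++⁻ (layers e) m∈
  ... | inj₁ m∈′ = ≤-trans (proj₁ (layers⁻ e m∈′)) (n≤1+n e) , proj₂ (layers⁻ e m∈′)
  ... | inj₂ m∈′ with layer⁻ (suc e) m∈′
  ...   | eq , lt = ≤-reflexive eq , <-≤-trans lt (≤-reflexive (cong g (≡-sym eq)))

  layer⁺ : ∀ m → rank m < g (degree m) → m ∈ layer (degree m)
  layer⁺ m lt = consecutive-take⁺ (g (degree m)) (monomials-consecutive r (degree m)) (∈-monomials m) lt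

  layers⁺ : ∀ e m → degree m ≤ e → rank m < g (degree m) → m ∈ layers e
  layers⁺ zero m z lt = subst (λ z → m ∈ layer z) (n≤0⇒n≡0 z) (layer⁺ m lt)
  layers⁺ (suc e) m le lt with m≤n⇒m<n∨m≡n le
  ... | inj₁ (s≤s le′) = ∈-++⁺ˡ (layers⁺ e m le′ lt)
  ... | inj₂ eq = ∈-++⁺ʳ (layers e) (subst (λ z → m ∈ layer z) eq (layer⁺ m lt))

  layers-unique : ∀ e → Unique (layers e)
  layers-unique zero    = Unique.take⁺ (g 0) (consecutive-unique (monomials-consecutive r 0))
  layers-unique (suc e) = Unique.++⁺ (layers-unique e) (Unique.take⁺ (g (suc e)) (consecutive-unique (monomials-consecutive r (suc e))))
    (λ { (m∈ , m∈′) → <-irrefl refl (≤-trans (≤-reflexive (≡-sym (proj₁ (layer⁻ (suc e) m∈′)))) (proj₁ (layers⁻ e m∈))) })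

  -- If m₁ lay outside its initial segment, `macaulay-rank` would place m at or beyond
  -- `macaulay k (g (1 + k))`, which is at least g (2 + k).
  rank-down : ∀ {m₁ m : Monomial r} → m₁ ⋖ m → degree m ≤ d → rank m < g (degree m) → rank m₁ < g (degree m₁)
  rank-down {m₁} {m} s ≤d lt with degree m₁ in eq
  ... | zero  = subst₂ _<_ (≡-sym (rank-degree0 m₁ eq)) (≡-sym (start M)) (s≤s z≤n)
  ... | suc k with rank m₁ <? g (suc k)
  ...   | yes p = p
  ...   | no ¬p = ⊥-elim (<-irrefl refl (begin-strict
    g (2 + k)                ≤⟨ growth M k (subst (_≤ d) deg ≤d) ⟩
    macaulay k (g (1 + k))   ≤⟨ macaulay-mono k (≮⇒≥ ¬p) ⟩
    macaulay k (rank m₁)     ≤⟨ macaulay-rank s k eq ⟩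
    rank m                   <⟨ lt ⟩
    g (degree m)             ≡⟨ cong g deg ⟩
    g (2 + k)                ∎))
    where
    open ≤-Reasoning
    deg : degree m ≡ 2 + k
    deg = trans (⋖-degree s) (cong suc eq)

  closure : ∀ n {m m′ : Monomial r} → degree m ≤ n → degree m ≤ d → rank m < g (degree m) → m′ ∣ᵐ m →
    degree m′ ≤ d × rank m′ < g (degree m′)
  closure n ≤n ≤d lt div with divides-step div
  ... | inj₁ refl = ≤d , lt
  closure zero {m} ≤n ≤d lt div | inj₂ (m₁ , div′ , s) = ⊥-elim (<-irrefl refl (<-≤-trans (subst (0 <_) (≡-sym (⋖-degree s)) (s≤s z≤n)) ≤n))
  closure (suc n) {m} ≤n ≤d lt div | inj₂ (m₁ , div′ , s) =
    closure n (s≤s⁻¹ (subst (_≤ suc n) (⋖-degree s) ≤n)) (≤-trans (n≤1+n _) (subst (_≤ d) (⋖-degree s) ≤d)) (rank-down s ≤d lt) div′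

  ideal : OrderIdeal r
  ideal = record
    { elems  = layers d
    ; unique = layers-unique d
    ; closed = λ {m} {m′} m∈ div →
        let (≤d , lt) = layers⁻ d m∈ ; (≤d′ , lt′) = closure (degree m) ≤-refl ≤d lt div
        in layers⁺ d m′ ≤d′ lt′
    }

  sameDegree : ℕ → List (Monomial r) → List (Monomial r)
  sameDegree i = filterᵇ (λ m → degree m ≡ᵇ i)

  sameDegree-layer : ∀ i → sameDegree i (layer i) ≡ layer i
  sameDegree-layer i = filter-all (T? ∘ λ m → degree m ≡ᵇ i) (All.map (λ {m} eq → ≡⇒≡ᵇ (degree m) i eq) (layer-degree i))

  sameDegree-other : ∀ i e → ¬ (e ≡ i) → sameDegree i (layer e) ≡ []
  sameDegree-other i e ≢ = filter-none (T? ∘ λ m → degree m ≡ᵇ i)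
    (All.map (λ {m} eq t → ≢ (trans (≡-sym eq) (≡ᵇ⇒≡ (degree m) i t))) (layer-degree e))

  sameDegree-high : ∀ e i → e < i → sameDegree i (layers e) ≡ []
  sameDegree-high zero    i lt = sameDegree-other i 0 (<⇒≢ lt)
  sameDegree-high (suc e) i lt = trans (filter-++ (T? ∘ λ m → degree m ≡ᵇ i) (layers e) (layer (suc e)))
    (cong₂ _++_ (sameDegree-high e i (≤-trans (n≤1+n _) lt)) (sameDegree-other i (suc e) (<⇒≢ lt)))

  sameDegree-low : ∀ e i → i ≤ e → sameDegree i (layers e) ≡ layer i
  sameDegree-low zero    zero z≤n = sameDegree-layer 0
  sameDegree-low (suc e) i le = trans (filter-++ (T? ∘ λ m → degree m ≡ᵇ i) (layers e) (layer (suc e))) (go (m≤n⇒m<n∨m≡n le))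
    where
    go : i < suc e ⊎ i ≡ suc e → sameDegree i (layers e) ++ sameDegree i (layer (suc e)) ≡ layer i
    go (inj₁ (s≤s lt)) = trans (cong₂ _++_ (sameDegree-low e i lt) (sameDegree-other i (suc e) (λ eq → <-irrefl (≡-sym eq) (s≤s lt)))) (++-identityʳ _)
    go (inj₂ refl) = cong₂ _++_ (sameDegree-high e (suc e) ≤-refl) (sameDegree-layer (suc e))

  count : ∀ i → i ≤ d → countDeg ideal i ≡ g i
  count i i≤d = trans (cong length (sameDegree-low d i i≤d))
    (trans (length-take (g i) (monomials r i)) (m≤n⇒m⊓n≡m (≤-trans (g-bound i i≤d) (≤-reflexive (≡-sym (length-monomials r i))))))

  count-high : ∀ i → d < i → countDeg ideal i ≡ 0
  count-high i lt = cong length (sameDegree-high d i lt)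

open import Data.Integer as ℤ using (ℤ; +_)
import Data.Integer.Properties as ℤP
open import Data.Integer.Tactic.RingSolver using () renaming (solve-∀ to ℤ-solve-∀)

-- Formal power series over the integers

conv : (ℕ → ℤ) → (ℕ → ℤ) → ℕ → ℤ
conv f g zero    = f 0 ℤ.* g 0
conv f g (suc n) = f 0 ℤ.* g (suc n) ℤ.+ conv (f ∘ suc) g n

conv-cong : ∀ {f f′ g g′} → (∀ i → f i ≡ f′ i) → (∀ i → g i ≡ g′ i) → ∀ n → conv f g n ≡ conv f′ g′ n
conv-cong p q zero    = cong₂ ℤ._*_ (p 0) (q 0)
conv-cong p q (suc n) = cong₂ ℤ._+_ (cong₂ ℤ._*_ (p 0) (q (suc n))) (conv-cong (p ∘ suc) q n)

conv-sucʳ : ∀ f g n → conv f g (suc n) ≡ f (suc n) ℤ.* g 0 ℤ.+ conv f (g ∘ suc) n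
conv-sucʳ f g zero = ℤP.+-comm (f 0 ℤ.* g 1) _
conv-sucʳ f g (suc n) = trans (cong (λ z → f 0 ℤ.* g (2 ℕ.+ n) ℤ.+ z) (conv-sucʳ (f ∘ suc) g n))
  (swap (f 0 ℤ.* g (2 ℕ.+ n)) (f (2 ℕ.+ n) ℤ.* g 0) _)
  where
  swap : ∀ a b c → a ℤ.+ (b ℤ.+ c) ≡ b ℤ.+ (a ℤ.+ c)
  swap = ℤ-solve-∀

conv-comm : ∀ f g n → conv f g n ≡ conv g f n
conv-comm f g zero    = ℤP.*-comm (f 0) (g 0)
conv-comm f g (suc n) = trans (cong₂ ℤ._+_ (ℤP.*-comm (f 0) (g (suc n))) (conv-comm (f ∘ suc) g n)) (≡-sym (conv-sucʳ g f n))

conv-distribʳ : ∀ h f g n → conv (λ i → f i ℤ.+ g i) h n ≡ conv f h n ℤ.+ conv g h n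
conv-distribʳ h f g zero    = ℤP.*-distribʳ-+ (h 0) (f 0) (g 0)
conv-distribʳ h f g (suc n) = trans (cong₂ ℤ._+_ (ℤP.*-distribʳ-+ (h (suc n)) (f 0) (g 0)) (conv-distribʳ h (f ∘ suc) (g ∘ suc) n))
  (swap (f 0 ℤ.* h (suc n)) (g 0 ℤ.* h (suc n)) _ _)
  where
  swap : ∀ a b c d → a ℤ.+ b ℤ.+ (c ℤ.+ d) ≡ a ℤ.+ c ℤ.+ (b ℤ.+ d)
  swap = ℤ-solve-∀

conv-scale : ∀ c f g n → conv (λ i → c ℤ.* f i) g n ≡ c ℤ.* conv f g n
conv-scale c f g zero    = ℤP.*-assoc c (f 0) (g 0)
conv-scale c f g (suc n) = trans (cong₂ ℤ._+_ (ℤP.*-assoc c (f 0) (g (suc n))) (conv-scale c (f ∘ suc) g n)) (≡-sym (ℤP.*-distribˡ-+ c _ _))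

conv-assoc : ∀ f g h n → conv (conv f g) h n ≡ conv f (conv g h) n
conv-assoc f g h zero    = ℤP.*-assoc (f 0) (g 0) (h 0)
conv-assoc f g h (suc n) = begin
  f 0 ℤ.* g 0 ℤ.* h (suc n) ℤ.+ conv (conv f g ∘ suc) h n
    ≡⟨ cong (λ z → f 0 ℤ.* g 0 ℤ.* h (suc n) ℤ.+ z) (trans (conv-distribʳ h (λ i → f 0 ℤ.* g (suc i)) (conv (f ∘ suc) g) n)
         (cong₂ ℤ._+_ (conv-scale (f 0) (g ∘ suc) h n) (conv-assoc (f ∘ suc) g h n))) ⟩
  f 0 ℤ.* g 0 ℤ.* h (suc n) ℤ.+ (f 0 ℤ.* conv (g ∘ suc) h n ℤ.+ conv (f ∘ suc) (conv g h) n)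
    ≡⟨ regroup (f 0) (g 0) (h (suc n)) _ _ ⟩
  f 0 ℤ.* (g 0 ℤ.* h (suc n) ℤ.+ conv (g ∘ suc) h n) ℤ.+ conv (f ∘ suc) (conv g h) n ∎
  where
  open ≡-Reasoning
  regroup : ∀ a b c d e → a ℤ.* b ℤ.* c ℤ.+ (a ℤ.* d ℤ.+ e) ≡ a ℤ.* (b ℤ.* c ℤ.+ d) ℤ.+ e
  regroup = ℤ-solve-∀

record Ser : Set where
  constructor ser
  field coeff : ℕ → ℤ
open Ser

infix 4 _≈_
record _≈_ (f g : Ser) : Set where
  constructor pointwise
  field at : ∀ i → coeff f i ≡ coeff g i
open _≈_

constant : ℤ → ℕ → ℤ
constant c zero    = c
constant c (suc _) = + 0

conv-zeroˡ : ∀ f g n → (∀ i → f i ≡ + 0) → conv f g n ≡ + 0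
conv-zeroˡ f g zero    z = cong (λ z → z ℤ.* g 0) (z 0)
conv-zeroˡ f g (suc n) z = cong₂ ℤ._+_ (cong (λ z → z ℤ.* g (suc n)) (z 0)) (conv-zeroˡ (f ∘ suc) g n (z ∘ suc))

conv-constant : ∀ c g n → conv (constant c) g n ≡ c ℤ.* g n
conv-constant c g zero    = refl
conv-constant c g (suc n) = trans (cong (λ z → c ℤ.* g (suc n) ℤ.+ z) (conv-zeroˡ _ g n (λ _ → refl))) (ℤP.+-identityʳ _)

indeterminate : ℕ → ℤ
indeterminate zero    = + 0
indeterminate (suc n) = constant (+ 1) n

opaque
  infixl 6 _⊕_
  infixl 7 _⊛_
  _⊕_ _⊛_ : Ser → Ser → Ser
  f ⊕ g = ser λ i → coeff f i ℤ.+ coeff g i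
  f ⊛ g = ser (conv (coeff f) (coeff g))

  infix 8 ⊖_
  ⊖_ : Ser → Ser
  ⊖ f = ser λ i → ℤ.- coeff f i

  𝕔 : ℤ → Ser
  𝕔 c = ser (constant c)

  t : Ser
  t = ser indeterminate

  ⊕-coeff : ∀ f g i → coeff (f ⊕ g) i ≡ coeff f i ℤ.+ coeff g i
  ⊕-coeff f g i = refl

  ⊖-coeff : ∀ f i → coeff (⊖ f) i ≡ ℤ.- coeff f i
  ⊖-coeff f i = refl

  ⊛-coeff : ∀ f g i → coeff (f ⊛ g) i ≡ conv (coeff f) (coeff g) i
  ⊛-coeff f g i = refl

  𝕔-coeff : ∀ c i → coeff (𝕔 c) i ≡ constant c i
  𝕔-coeff c i = refl

  t⊛-coeff-0 : ∀ f → coeff (t ⊛ f) 0 ≡ + 0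
  t⊛-coeff-0 f = refl

  t⊛-coeff-suc : ∀ f i → coeff (t ⊛ f) (suc i) ≡ coeff f i
  t⊛-coeff-suc f i = trans (ℤP.+-identityˡ _) (trans (conv-cong {f = indeterminate ∘ suc} {f′ = constant (+ 1)} (λ _ → refl) (λ _ → refl) i)
    (trans (conv-constant (+ 1) (coeff f) i) (ℤP.*-identityˡ _)))

  series-isCommutativeRing : IsCommutativeRing _≈_ _⊕_ _⊛_ ⊖_ (𝕔 (+ 0)) (𝕔 (+ 1))
  series-isCommutativeRing = record
      { isRing = record
        { +-isAbelianGroup = record
          { isGroup = record
            { isMonoid = record
              { isSemigroup = record
                { isMagma = record
                  { isEquivalence = record
                    { refl = pointwise λ _ → refl
                    ; sym = λ p → pointwise λ i → ≡-sym (at p i)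
                    ; trans = λ p q → pointwise λ i → trans (at p i) (at q i) }
                  ; ∙-cong = λ p q → pointwise λ i → cong₂ ℤ._+_ (at p i) (at q i) }
                ; assoc = λ f g h → pointwise λ i → ℤP.+-assoc (coeff f i) (coeff g i) (coeff h i) }
              ; identity = (λ f → pointwise λ { zero → ℤP.+-identityˡ _ ; (suc i) → ℤP.+-identityˡ _ })
                         , (λ f → pointwise λ { zero → ℤP.+-identityʳ _ ; (suc i) → ℤP.+-identityʳ _ }) }
            ; inverse = (λ f → pointwise λ { zero → ℤP.+-inverseˡ (coeff f 0) ; (suc i) → ℤP.+-inverseˡ (coeff f (suc i)) })
                      , (λ f → pointwise λ { zero → ℤP.+-inverseʳ (coeff f 0) ; (suc i) → ℤP.+-inverseʳ (coeff f (suc i)) })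
            ; ⁻¹-cong = λ p → pointwise λ i → cong ℤ.-_ (at p i) }
          ; comm = λ f g → pointwise λ i → ℤP.+-comm (coeff f i) (coeff g i) }
        ; *-cong = λ p q → pointwise (conv-cong (at p) (at q))
        ; *-assoc = λ f g h → pointwise (conv-assoc (coeff f) (coeff g) (coeff h))
        ; *-identity = (λ f → pointwise λ i → trans (conv-constant (+ 1) (coeff f) i) (ℤP.*-identityˡ _))
                     , (λ f → pointwise λ i → trans (conv-comm (coeff f) _ i) (trans (conv-constant (+ 1) (coeff f) i) (ℤP.*-identityˡ _)))
        ; distrib = (λ f g h → pointwise λ i → trans (conv-comm (coeff f) _ i)
                      (trans (conv-distribʳ (coeff f) (coeff g) (coeff h) i) (cong₂ ℤ._+_ (conv-comm (coeff g) _ i) (conv-comm (coeff h) _ i))))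
                  , (λ f g h → pointwise (conv-distribʳ (coeff f) (coeff g) (coeff h)))
        }
      ; *-comm = λ f g → pointwise (conv-comm (coeff f) (coeff g))
      }

  𝕔-+ : ∀ a b → 𝕔 (a ℤ.+ b) ≈ 𝕔 a ⊕ 𝕔 b
  𝕔-+ a b = pointwise λ { zero → refl ; (suc _) → refl }

  𝕔-* : ∀ a b → 𝕔 (a ℤ.* b) ≈ 𝕔 a ⊛ 𝕔 b
  𝕔-* a b = pointwise λ { zero → refl ; (suc i) → ≡-sym (trans (conv-constant a (constant b) (suc i)) (ℤP.*-zeroʳ a)) }

  𝕔-neg : ∀ a → 𝕔 (ℤ.- a) ≈ ⊖ 𝕔 a
  𝕔-neg a = pointwise λ { zero → refl ; (suc _) → refl }

seriesRing : CommutativeRing _ _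
seriesRing = record { isCommutativeRing = series-isCommutativeRing }

module S where
  open CommutativeRing seriesRing public using (refl; sym; trans; +-cong; *-cong; +-assoc; +-comm; *-assoc; *-comm; +-identityˡ; +-identityʳ; *-identityˡ; *-identityʳ; zeroˡ; zeroʳ; distribˡ; distribʳ; -‿cong)

series-ACR : ACR.AlmostCommutativeRing _ _
series-ACR = ACR.fromCommutativeRing seriesRing

𝕔-decide : ∀ a b → Maybe (𝕔 a ≈ 𝕔 b)
𝕔-decide a b with a ℤP.≟ b
... | yes refl = just S.refl
... | no  _    = nothing

𝕔-morphism : ℤ.+-*-rawRing ACR.-Raw-AlmostCommutative⟶ series-ACR
𝕔-morphism = record { ⟦_⟧ = 𝕔 ; +-homo = 𝕔-+ ; *-homo = 𝕔-* ; -‿homo = 𝕔-neg ; 0-homo = S.refl ; 1-homo = S.refl }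

module SeriesSolver = RingSolver ℤ.+-*-rawRing series-ACR 𝕔-morphism 𝕔-decide
open SeriesSolver using (solve; _:=_; _:+_; _:*_; :-_; con)

-- Nonnegative combinations of t^a (1+t)^b

infixl 6 _⊝_
_⊝_ : Ser → Ser → Ser
f ⊝ g = f ⊕ ⊖ g

𝟘 𝟙 1-t 1+t : Ser
𝟘 = 𝕔 (+ 0)
𝟙 = 𝕔 (+ 1)
1-t = 𝟙 ⊝ t
1+t = 𝟙 ⊕ t

infixr 8 _^ˢ_
_^ˢ_ : Ser → ℕ → Ser
f ^ˢ zero  = 𝟙
f ^ˢ suc n = f ⊛ f ^ˢ n

^ˢ-+ : ∀ f m n → f ^ˢ (m ℕ.+ n) ≈ f ^ˢ m ⊛ f ^ˢ n
^ˢ-+ f zero    n = S.sym (S.*-identityˡ _)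
^ˢ-+ f (suc m) n = S.trans (S.*-cong S.refl (^ˢ-+ f m n)) (S.sym (S.*-assoc _ _ _))

⊝-coeff : ∀ f g i → coeff (f ⊝ g) i ≡ coeff f i ℤ.- coeff g i
⊝-coeff f g i = trans (⊕-coeff f (⊖ g) i) (cong (ℤ._+_ (coeff f i)) (⊖-coeff g i))

𝟘-coeff : ∀ i → coeff 𝟘 i ≡ + 0
𝟘-coeff zero    = 𝕔-coeff (+ 0) 0
𝟘-coeff (suc i) = 𝕔-coeff (+ 0) (suc i)

1-t⊛ : ∀ f → 1-t ⊛ f ≈ f ⊝ t ⊛ f
1-t⊛ f = solve 2 (λ t f → (con (+ 1) :+ :- t) :* f := f :+ :- (t :* f)) S.refl t f

1+t⊛ : ∀ f → 1+t ⊛ f ≈ f ⊕ t ⊛ f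
1+t⊛ f = solve 2 (λ t f → (con (+ 1) :+ t) :* f := f :+ t :* f) S.refl t f

1-t⊛-coeff-0 : ∀ f → coeff (1-t ⊛ f) 0 ≡ coeff f 0
1-t⊛-coeff-0 f = trans (at (1-t⊛ f) 0) (trans (⊝-coeff f (t ⊛ f) 0) (trans (cong (ℤ._-_ (coeff f 0)) (t⊛-coeff-0 f)) (ℤP.+-identityʳ _)))

1-t⊛-coeff-suc : ∀ f i → coeff (1-t ⊛ f) (suc i) ≡ coeff f (suc i) ℤ.- coeff f i
1-t⊛-coeff-suc f i = trans (at (1-t⊛ f) (suc i)) (trans (⊝-coeff f (t ⊛ f) (suc i)) (cong (ℤ._-_ (coeff f (suc i))) (t⊛-coeff-suc f i)))

1+t⊛-coeff-0 : ∀ f → coeff (1+t ⊛ f) 0 ≡ coeff f 0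
1+t⊛-coeff-0 f = trans (at (1+t⊛ f) 0) (trans (⊕-coeff f (t ⊛ f) 0) (trans (cong (ℤ._+_ (coeff f 0)) (t⊛-coeff-0 f)) (ℤP.+-identityʳ _)))

1+t⊛-coeff-suc : ∀ f i → coeff (1+t ⊛ f) (suc i) ≡ coeff f (suc i) ℤ.+ coeff f i
1+t⊛-coeff-suc f i = trans (at (1+t⊛ f) (suc i)) (trans (⊕-coeff f (t ⊛ f) (suc i)) (cong (ℤ._+_ (coeff f (suc i))) (t⊛-coeff-suc f i)))

minus-injective : ∀ {a b c} → a ℤ.- c ≡ b ℤ.- c → a ≡ b
minus-injective {a} {b} {c} eq = trans (≡-sym (cancel a c)) (trans (cong (ℤ._+ c) eq) (cancel b c))
  where
  cancel : ∀ a c → a ℤ.- c ℤ.+ c ≡ a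
  cancel = ℤ-solve-∀

1-t-cancel : ∀ f g → 1-t ⊛ f ≈ 1-t ⊛ g → f ≈ g
1-t-cancel f g eq = pointwise go
  where
  go : ∀ i → coeff f i ≡ coeff g i
  go zero    = trans (≡-sym (1-t⊛-coeff-0 f)) (trans (at eq 0) (1-t⊛-coeff-0 g))
  go (suc i) = minus-injective (trans (cong (λ z → coeff f (suc i) ℤ.- z) (≡-sym (go i)))
    (trans (≡-sym (1-t⊛-coeff-suc f i)) (trans (at eq (suc i)) (1-t⊛-coeff-suc g i))))

Σˢ : ∀ {A : Set} → List A → (A → Ser) → Ser
Σˢ []       f = 𝟘
Σˢ (x ∷ xs) f = f x ⊕ Σˢ xs f

Σˢ-cong : ∀ {A : Set} (xs : List A) {f g : A → Ser} → (∀ x → f x ≈ g x) → Σˢ xs f ≈ Σˢ xs g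
Σˢ-cong []       p = S.refl
Σˢ-cong (x ∷ xs) p = S.+-cong (p x) (Σˢ-cong xs p)

Σˢ-++ : ∀ {A : Set} (xs ys : List A) f → Σˢ (xs ++ ys) f ≈ Σˢ xs f ⊕ Σˢ ys f
Σˢ-++ []       ys f = S.sym (S.+-identityˡ _)
Σˢ-++ (x ∷ xs) ys f = S.trans (S.+-cong S.refl (Σˢ-++ xs ys f)) (S.sym (S.+-assoc _ _ _))

Σˢ-map : ∀ {A B : Set} (h : A → B) xs f → Σˢ (map h xs) f ≈ Σˢ xs (f ∘ h)
Σˢ-map h []       f = S.refl
Σˢ-map h (x ∷ xs) f = S.+-cong S.refl (Σˢ-map h xs f)

Σˢ-⊕ : ∀ {A : Set} (xs : List A) f g → Σˢ xs (λ x → f x ⊕ g x) ≈ Σˢ xs f ⊕ Σˢ xs g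
Σˢ-⊕ []       f g = S.sym (S.+-identityˡ _)
Σˢ-⊕ (x ∷ xs) f g = S.trans (S.+-cong S.refl (Σˢ-⊕ xs f g))
  (solve 4 (λ a b c d → a :+ b :+ (c :+ d) := a :+ c :+ (b :+ d)) S.refl _ _ _ _)

Σˢ-⊖ : ∀ {A : Set} (xs : List A) f → Σˢ xs (λ x → ⊖ f x) ≈ ⊖ Σˢ xs f
Σˢ-⊖ []       f = solve 0 (con (+ 0) := :- con (+ 0)) S.refl
Σˢ-⊖ (x ∷ xs) f = S.trans (S.+-cong S.refl (Σˢ-⊖ xs f)) (solve 2 (λ a b → :- a :+ :- b := :- (a :+ b)) S.refl _ _)

Σˢ-⊛ : ∀ {A : Set} (xs : List A) f g → Σˢ xs (λ x → f x ⊛ g) ≈ Σˢ xs f ⊛ g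
Σˢ-⊛ []       f g = S.sym (S.zeroˡ g)
Σˢ-⊛ (x ∷ xs) f g = S.trans (S.+-cong S.refl (Σˢ-⊛ xs f g)) (S.sym (S.distribʳ g _ _))

generator : ℕ → ℕ → Ser
generator a b = t ^ˢ a ⊛ 1+t ^ˢ b

data Span (P : ℕ → ℕ → Set) : Ser → Set where
  zero : Span P 𝟘
  plus : ∀ {f g} → Span P f → Span P g → Span P (f ⊕ g)
  gen  : ∀ {a b} → P a b → Span P (generator a b)
  resp : ∀ {f g} → f ≈ g → Span P f → Span P g

-- t^a (1+t)^b is palindromic about (2a+b)/2 and increases up to there. `Sym c` fixes this centre at
-- c/2, so that its members have a nonnegative γ-vector; `Cone c` also admits later centres, which
-- preserves the increase up to c/2.
Cone Sym : ℕ → Ser → Set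
Cone c = Span (λ a b → c ≤ a ℕ.+ a ℕ.+ b)
Sym  c = Span (λ a b → a ℕ.+ a ℕ.+ b ≡ c)

span-map : ∀ {P Q : ℕ → ℕ → Set} {f} → (∀ {a b} → P a b → Q a b) → Span P f → Span Q f
span-map h zero       = zero
span-map h (plus p q) = plus (span-map h p) (span-map h q)
span-map h (gen p)    = gen (h p)
span-map h (resp e p) = resp e (span-map h p)

span-⊛ : ∀ {P Q R : ℕ → ℕ → Set} {f g} → (∀ {a b a′ b′} → P a b → Q a′ b′ → R (a ℕ.+ a′) (b ℕ.+ b′)) →
  Span P f → Span Q g → Span R (f ⊛ g)
span-⊛ h zero q = resp (S.sym (S.zeroˡ _)) zero
span-⊛ h (plus p p′) q = resp (S.sym (S.distribʳ _ _ _)) (plus (span-⊛ h p q) (span-⊛ h p′ q))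
span-⊛ h (resp e p) q = resp (S.*-cong e S.refl) (span-⊛ h p q)
span-⊛ h (gen p) zero = resp (S.sym (S.zeroʳ _)) zero
span-⊛ h (gen p) (plus q q′) = resp (S.sym (S.distribˡ _ _ _)) (plus (span-⊛ h (gen p) q) (span-⊛ h (gen p) q′))
span-⊛ h (gen p) (resp e q) = resp (S.*-cong S.refl e) (span-⊛ h (gen p) q)
span-⊛ h (gen {a} {b} p) (gen {a′} {b′} q) = resp
  (S.trans (S.*-cong (^ˢ-+ t a a′) (^ˢ-+ 1+t b b′))
    (solve 4 (λ x y z w → (x :* y) :* (z :* w) := (x :* z) :* (y :* w)) S.refl _ _ _ _))
  (gen (h p q))

span-Σ : ∀ {P : ℕ → ℕ → Set} {A : Set} {xs : List A} {f} → All (λ x → Span P (f x)) xs → Span P (Σˢ xs f)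
span-Σ All.[]       = zero
span-Σ (p All.∷ ps) = plus p (span-Σ ps)

private
  doubles : ∀ a b a′ b′ → (a ℕ.+ a′) ℕ.+ (a ℕ.+ a′) ℕ.+ (b ℕ.+ b′) ≡ (a ℕ.+ a ℕ.+ b) ℕ.+ (a′ ℕ.+ a′ ℕ.+ b′)
  doubles = solve-∀

cone-weaken : ∀ {c c′ f} → c′ ≤ c → Cone c f → Cone c′ f
cone-weaken le = span-map (ℕP.≤-trans le)

cone-⊛ : ∀ {c d f g} → Cone c f → Cone d g → Cone (c ℕ.+ d) (f ⊛ g)
cone-⊛ = span-⊛ λ {a} {b} {a′} {b′} p q → ℕP.≤-trans (ℕP.+-mono-≤ p q) (ℕP.≤-reflexive (≡-sym (doubles a b a′ b′)))

sym-⊛ : ∀ {c d f g} → Sym c f → Sym d g → Sym (c ℕ.+ d) (f ⊛ g)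
sym-⊛ = span-⊛ λ {a} {b} {a′} {b′} p q → trans (doubles a b a′ b′) (cong₂ ℕ._+_ p q)

sym⇒cone : ∀ {c f} → Sym c f → Cone c f
sym⇒cone = span-map (λ eq → ℕP.≤-reflexive (≡-sym eq))

sym-𝟙 : Sym 0 𝟙
sym-𝟙 = resp (S.*-identityˡ _) (gen {a = 0} {b = 0} refl)

sym-t : Sym 2 t
sym-t = resp (solve 1 (λ t → (t :* con (+ 1)) :* con (+ 1) := t) S.refl t) (gen {a = 1} {b = 0} refl)

sym-1+t : Sym 1 1+t
sym-1+t = resp (solve 1 (λ t → con (+ 1) :* (t :* con (+ 1)) := t) S.refl 1+t) (gen {a = 0} {b = 1} refl)

binom : ℕ → ℕ → ℕ
binom zero    zero    = 1
binom zero    (suc j) = 0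
binom (suc b) zero    = 1
binom (suc b) (suc j) = binom b (suc j) ℕ.+ binom b j

binom-0 : ∀ b → binom b 0 ≡ 1
binom-0 zero    = refl
binom-0 (suc b) = refl

1+t^-coeff : ∀ b j → coeff (1+t ^ˢ b) j ≡ + binom b j
1+t^-coeff zero    zero    = 𝕔-coeff (+ 1) 0
1+t^-coeff zero    (suc j) = 𝕔-coeff (+ 1) (suc j)
1+t^-coeff (suc b) zero    = trans (1+t⊛-coeff-0 (1+t ^ˢ b)) (trans (1+t^-coeff b 0) (cong +_ (binom-0 b)))
1+t^-coeff (suc b) (suc j) = trans (1+t⊛-coeff-suc (1+t ^ˢ b) j) (cong₂ ℤ._+_ (1+t^-coeff b (suc j)) (1+t^-coeff b j))

binom-top : ∀ b j → b < j → binom b j ≡ 0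
binom-top zero    (suc j) _        = refl
binom-top (suc b) (suc j) (s≤s lt) = cong₂ ℕ._+_ (binom-top b (suc j) (ℕP.m≤n⇒m≤1+n lt)) (binom-top b j lt)

binom-sym : ∀ b j j′ → j ℕ.+ j′ ≡ b → binom b j ≡ binom b j′
binom-sym zero    zero    zero    eq = refl
binom-sym (suc b) zero    zero    ()
binom-sym (suc b) zero    (suc j′) eq = ≡-sym (cong₂ ℕ._+_ (binom-top b (suc j′) (ℕP.≤-reflexive (≡-sym eq)))
  (trans (≡-sym (binom-sym b 0 j′ (ℕP.suc-injective eq))) (binom-0 b)))
binom-sym (suc b) (suc j) zero    eq = cong₂ ℕ._+_ (binom-top b (suc j) (ℕP.≤-reflexive (≡-sym (trans (≡-sym (ℕP.+-identityʳ (suc j))) eq))))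
  (trans (binom-sym b j 0 (ℕP.suc-injective eq)) (binom-0 b))
binom-sym (suc b) (suc j) (suc j′) eq = trans (ℕP.+-comm (binom b (suc j)) _)
  (cong₂ ℕ._+_ (binom-sym b j (suc j′) (ℕP.suc-injective eq))
               (binom-sym b (suc j) j′ (trans (≡-sym (ℕP.+-suc j j′)) (ℕP.suc-injective eq))))

-- Pascal's rule on both sides, with the summands paired crosswise: j + 1 against j′, and j against
-- j′ + 1. In each pair the sum of the indices drops by one together with the upper entry.
binom-mono : ∀ b j j′ → j ≤ j′ → j ℕ.+ j′ ≤ b → binom b j ≤ binom b j′
binom-mono b j j′ j≤j′ le with ℕP.m≤n⇒m<n∨m≡n j≤j′
... | inj₂ refl = ℕP.≤-refl
binom-mono (suc b) zero (suc j′) _ (s≤s le) | inj₁ _ = ℕP.≤-trans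
  (ℕP.≤-trans (ℕP.≤-reflexive (≡-sym (binom-0 b))) (binom-mono b 0 j′ z≤n le)) (ℕP.m≤n+m _ (binom b (suc j′)))
binom-mono (suc b) (suc j) (suc j′) _ (s≤s le) | inj₁ (s≤s lt) = ℕP.≤-trans
  (ℕP.+-mono-≤ (binom-mono b (suc j) j′ lt (ℕP.≤-trans (ℕP.≤-reflexive (≡-sym (ℕP.+-suc j j′))) le))
               (binom-mono b j (suc j′) (ℕP.≤-trans (ℕP.n≤1+n j) (ℕP.≤-trans lt (ℕP.n≤1+n j′))) le))
  (ℕP.≤-reflexive (ℕP.+-comm (binom b j′) _))

generator-suc : ∀ a b → generator (suc a) b ≈ t ⊛ generator a b
generator-suc a b = S.*-assoc t (t ^ˢ a) (1+t ^ˢ b)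

generator-coeff-0 : ∀ b i → coeff (generator 0 b) i ≡ + binom b i
generator-coeff-0 b i = trans (at (S.*-identityˡ (1+t ^ˢ b)) i) (1+t^-coeff b i)

generator-coeff-suc-0 : ∀ a b → coeff (generator (suc a) b) 0 ≡ + 0
generator-coeff-suc-0 a b = trans (at (generator-suc a b) 0) (t⊛-coeff-0 (generator a b))

generator-coeff-suc : ∀ a b i → coeff (generator (suc a) b) (suc i) ≡ coeff (generator a b) i
generator-coeff-suc a b i = trans (at (generator-suc a b) (suc i)) (t⊛-coeff-suc (generator a b) i)

generator-≥0 : ∀ a b i → + 0 ℤ.≤ coeff (generator a b) i
generator-≥0 zero    b i       = subst (+ 0 ℤ.≤_) (≡-sym (generator-coeff-0 b i)) (ℤ.+≤+ z≤n)
generator-≥0 (suc a) b zero    = ℤP.≤-reflexive (≡-sym (generator-coeff-suc-0 a b))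
generator-≥0 (suc a) b (suc i) = subst (+ 0 ℤ.≤_) (≡-sym (generator-coeff-suc a b i)) (generator-≥0 a b i)

private
  halve : ∀ {i j} a b → suc i ℕ.+ suc j ≤ suc a ℕ.+ suc a ℕ.+ b → i ℕ.+ j ≤ a ℕ.+ a ℕ.+ b
  halve {i} {j} a b le = ℕP.+-cancelˡ-≤ 2 _ _ (ℕP.≤-trans (ℕP.≤-reflexive (cong suc (≡-sym (ℕP.+-suc i j))))
    (ℕP.≤-trans le (ℕP.≤-reflexive (cong (λ z → suc (z ℕ.+ b)) (ℕP.+-suc a a)))))

generator-mono : ∀ a b i j → i ≤ j → i ℕ.+ j ≤ a ℕ.+ a ℕ.+ b → coeff (generator a b) i ℤ.≤ coeff (generator a b) j
generator-mono zero    b i j i≤j le = subst₂ ℤ._≤_ (≡-sym (generator-coeff-0 b i)) (≡-sym (generator-coeff-0 b j)) (ℤ.+≤+ (binom-mono b i j i≤j le))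
generator-mono (suc a) b zero j _ le = subst (ℤ._≤ coeff (generator (suc a) b) j) (≡-sym (generator-coeff-suc-0 a b)) (generator-≥0 (suc a) b j)
generator-mono (suc a) b (suc i) (suc j) (s≤s i≤j) le =
  subst₂ ℤ._≤_ (≡-sym (generator-coeff-suc a b i)) (≡-sym (generator-coeff-suc a b j)) (generator-mono a b i j i≤j (halve a b le))

cone-≥0 : ∀ {c f} → Cone c f → ∀ i → + 0 ℤ.≤ coeff f i
cone-≥0 zero i = ℤP.≤-reflexive (≡-sym (𝟘-coeff i))
cone-≥0 (plus {f} {g} p q) i = subst (+ 0 ℤ.≤_) (≡-sym (⊕-coeff f g i)) (ℤP.+-mono-≤ (cone-≥0 p i) (cone-≥0 q i))
cone-≥0 (gen {a} {b} _) i = generator-≥0 a b i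
cone-≥0 (resp e p) i = subst (+ 0 ℤ.≤_) (at e i) (cone-≥0 p i)

-- One inequality for two purposes: j = i + 1 gives the increase up to the middle, and j = c ∸ i the
-- comparison of the lower half with the upper.
cone-mono : ∀ {c f} → Cone c f → ∀ i j → i ≤ j → i ℕ.+ j ≤ c → coeff f i ℤ.≤ coeff f j
cone-mono zero i j _ _ = ℤP.≤-reflexive (trans (𝟘-coeff i) (≡-sym (𝟘-coeff j)))
cone-mono (plus {f} {g} p q) i j i≤j le = subst₂ ℤ._≤_ (≡-sym (⊕-coeff f g i)) (≡-sym (⊕-coeff f g j)) (ℤP.+-mono-≤ (cone-mono p i j i≤j le) (cone-mono q i j i≤j le))
cone-mono (gen {a} {b} c≤) i j i≤j le = generator-mono a b i j i≤j (ℕP.≤-trans le c≤)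
cone-mono (resp e p) i j i≤j le = subst₂ ℤ._≤_ (at e i) (at e j) (cone-mono p i j i≤j le)

cone-1-t-≥0 : ∀ {c f} → Cone c f → ∀ i → i ℕ.+ i ≤ suc c → + 0 ℤ.≤ coeff (1-t ⊛ f) i
cone-1-t-≥0 {f = f} p zero    _  = subst (+ 0 ℤ.≤_) (≡-sym (1-t⊛-coeff-0 f)) (cone-≥0 p 0)
cone-1-t-≥0 {f = f} p (suc i) le = subst (+ 0 ℤ.≤_) (≡-sym (1-t⊛-coeff-suc f i))
  (ℤP.i≤j⇒0≤j-i (cone-mono p i (suc i) (ℕP.n≤1+n i) (ℕ.s≤s⁻¹ le)))

generator-sym : ∀ a b i j → i ℕ.+ j ≡ a ℕ.+ a ℕ.+ b → coeff (generator a b) i ≡ coeff (generator a b) j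
generator-sym zero b i j eq = trans (generator-coeff-0 b i) (trans (cong +_ (binom-sym b i j eq)) (≡-sym (generator-coeff-0 b j)))
generator-sym (suc a) b zero zero eq = refl
generator-sym (suc a) b zero (suc j) eq = trans (generator-coeff-suc-0 a b)
  (≡-sym (trans (generator-coeff-suc a b j) (generator-above a b j (ℕP.≤-trans (ℕP.≤-reflexive (cong (λ z → z ℕ.+ b) (≡-sym (ℕP.+-suc a a)))) (ℕP.≤-reflexive (≡-sym (ℕP.suc-injective eq)))))))
  where
  generator-above : ∀ a b j → a ℕ.+ a ℕ.+ b < j → coeff (generator a b) j ≡ + 0
  generator-above zero    b j lt = trans (generator-coeff-0 b j) (cong +_ (binom-top b j lt))
  generator-above (suc a) b (suc j) (s≤s lt) = trans (generator-coeff-suc a b j)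
    (generator-above a b j (ℕP.≤-trans (s≤s (ℕP.+-monoˡ-≤ b (ℕP.+-monoʳ-≤ a (ℕP.n≤1+n a)))) lt))
generator-sym (suc a) b (suc i) zero eq = ≡-sym (generator-sym (suc a) b zero (suc i) (trans (≡-sym (ℕP.+-identityʳ (suc i))) eq))
generator-sym (suc a) b (suc i) (suc j) eq = trans (generator-coeff-suc a b i)
  (trans (generator-sym a b i j (ℕP.suc-injective (ℕP.suc-injective (trans (cong suc (≡-sym (ℕP.+-suc i j))) (trans eq (cong (λ z → suc (z ℕ.+ b)) (ℕP.+-suc a a)))))))
         (≡-sym (generator-coeff-suc a b j)))

sym-coeff : ∀ {c f} → Sym c f → ∀ i j → i ℕ.+ j ≡ c → coeff f i ≡ coeff f j
sym-coeff zero i j _ = trans (𝟘-coeff i) (≡-sym (𝟘-coeff j))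
sym-coeff (plus {f} {g} p q) i j eq = trans (⊕-coeff f g i) (trans (cong₂ ℤ._+_ (sym-coeff p i j eq) (sym-coeff q i j eq)) (≡-sym (⊕-coeff f g j)))
sym-coeff (gen {a} {b} c≡) i j eq = generator-sym a b i j (trans eq (≡-sym c≡))
sym-coeff (resp e p) i j eq = trans (≡-sym (at e i)) (trans (sym-coeff p i j eq) (at e j))

-- Counting colourings

Σℕ : ∀ {A : Set} → List A → (A → ℕ) → ℕ
Σℕ []       f = 0
Σℕ (x ∷ xs) f = f x ℕ.+ Σℕ xs f

Σℕ-cong : ∀ {A : Set} (xs : List A) {f g : A → ℕ} → (∀ {x} → x ∈ xs → f x ≡ g x) → Σℕ xs f ≡ Σℕ xs g
Σℕ-cong []       p = refl
Σℕ-cong (x ∷ xs) p = cong₂ ℕ._+_ (p (here refl)) (Σℕ-cong xs (p ∘ there))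

Σℕ-++ : ∀ {A : Set} (xs ys : List A) f → Σℕ (xs ++ ys) f ≡ Σℕ xs f ℕ.+ Σℕ ys f
Σℕ-++ []       ys f = refl
Σℕ-++ (x ∷ xs) ys f = trans (cong (f x ℕ.+_) (Σℕ-++ xs ys f)) (≡-sym (ℕP.+-assoc (f x) _ _))

Σℕ-map : ∀ {A B : Set} (h : A → B) xs f → Σℕ (map h xs) f ≡ Σℕ xs (f ∘ h)
Σℕ-map h []       f = refl
Σℕ-map h (x ∷ xs) f = cong (f (h x) ℕ.+_) (Σℕ-map h xs f)

Σℕ-0 : ∀ {A : Set} (xs : List A) → Σℕ xs (λ _ → 0) ≡ 0
Σℕ-0 []       = refl
Σℕ-0 (x ∷ xs) = Σℕ-0 xs

Σℕ-const : ∀ {A : Set} (xs : List A) c → Σℕ xs (λ _ → c) ≡ length xs ℕ.* c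
Σℕ-const []       c = refl
Σℕ-const (x ∷ xs) c = cong (c ℕ.+_) (Σℕ-const xs c)

Σℕ-+ : ∀ {A : Set} (xs : List A) f g → Σℕ xs (λ x → f x ℕ.+ g x) ≡ Σℕ xs f ℕ.+ Σℕ xs g
Σℕ-+ []       f g = refl
Σℕ-+ (x ∷ xs) f g = trans (cong (f x ℕ.+ g x ℕ.+_) (Σℕ-+ xs f g)) (swap (f x) (g x) _ _)
  where
  swap : ∀ a b c d → a ℕ.+ b ℕ.+ (c ℕ.+ d) ≡ a ℕ.+ c ℕ.+ (b ℕ.+ d)
  swap = solve-∀

Σℕ-*ʳ : ∀ {A : Set} (xs : List A) f c → Σℕ xs (λ x → f x ℕ.* c) ≡ Σℕ xs f ℕ.* c
Σℕ-*ʳ []       f c = refl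
Σℕ-*ʳ (x ∷ xs) f c = trans (cong (f x ℕ.* c ℕ.+_) (Σℕ-*ʳ xs f c)) (≡-sym (ℕP.*-distribʳ-+ c (f x) _))

Σℕ-*ˡ : ∀ {A : Set} (xs : List A) f c → Σℕ xs (λ x → c ℕ.* f x) ≡ c ℕ.* Σℕ xs f
Σℕ-*ˡ []       f c = ≡-sym (ℕP.*-zeroʳ c)
Σℕ-*ˡ (x ∷ xs) f c = trans (cong (c ℕ.* f x ℕ.+_) (Σℕ-*ˡ xs f c)) (≡-sym (ℕP.*-distribˡ-+ c (f x) _))

Σℕ-swap : ∀ {A B : Set} (xs : List A) (ys : List B) (f : A → B → ℕ) → Σℕ xs (λ x → Σℕ ys (f x)) ≡ Σℕ ys (λ y → Σℕ xs (λ x → f x y))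
Σℕ-swap []       ys f = ≡-sym (Σℕ-0 ys)
Σℕ-swap (x ∷ xs) ys f = trans (cong (Σℕ ys (f x) ℕ.+_) (Σℕ-swap xs ys f)) (≡-sym (Σℕ-+ ys (f x) _))

Σℕ-↭ : ∀ {A : Set} {xs ys : List A} f → xs ↭ ys → Σℕ xs f ≡ Σℕ ys f
Σℕ-↭ f Perm.refl = refl
Σℕ-↭ f (Perm.prep x p) = cong (f x ℕ.+_) (Σℕ-↭ f p)
Σℕ-↭ f (Perm.swap x y p) = trans (cong (λ z → f x ℕ.+ (f y ℕ.+ z)) (Σℕ-↭ f p)) (swap (f x) (f y) _)
  where
  swap : ∀ a b c → a ℕ.+ (b ℕ.+ c) ≡ b ℕ.+ (a ℕ.+ c)
  swap = solve-∀
Σℕ-↭ f (Perm.trans p q) = trans (Σℕ-↭ f p) (Σℕ-↭ f q)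

-- Intervals of colours, splittings and counts of colourings

range : ℕ → List ℕ
range zero    = []
range (suc n) = 0 ∷ map suc (range n)

length-range : ∀ n → length (range n) ≡ n
length-range zero    = refl
length-range (suc n) = cong suc (trans (length-map suc (range n)) (length-range n))

range-< : ∀ n {x} → x ∈ range n → x < n
range-< (suc n) (here refl) = s≤s z≤n
range-< (suc n) (there x∈) with ∈-map⁻ suc x∈
... | y , y∈ , refl = s≤s (range-< n y∈)

range-+ : ∀ m n → range (m ℕ.+ n) ≡ range m ++ map (m ℕ.+_) (range n)
range-+ zero    n = ≡-sym (map-id (range n))
range-+ (suc m) n = cong (0 ∷_) (trans (cong (map suc) (range-+ m n))
  (trans (map-++ suc (range m) _) (cong (map suc (range m) ++_) (≡-sym (map-∘ (range n))))))

splits : ∀ {A : Set} → List A → List (List A × List A)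
splits []      = ([] , []) ∷ []
splits (w ∷ V) = map (λ (L , R) → w ∷ L , R) (splits V) ++ map (λ (L , R) → L , w ∷ R) (splits V)

splits-length : ∀ {A : Set} (V : List A) → All (λ (L , R) → length L ℕ.+ length R ≡ length V) (splits V)
splits-length []      = refl All.∷ All.[]
splits-length (w ∷ V) = AllP.++⁺ (AllP.map⁺ (All.map (cong suc) (splits-length V)))
  (AllP.map⁺ (All.map (λ { {L , R} eq → trans (ℕP.+-suc (length L) (length R)) (cong suc eq) }) (splits-length V)))

_∧∧_ : Bool → ℕ → ℕ
true  ∧∧ n = n
false ∧∧ n = 0

∧∧-∧ : ∀ a b n → (a ∧ b) ∧∧ n ≡ a ∧∧ (b ∧∧ n)
∧∧-∧ true  b n = refl
∧∧-∧ false b n = refl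

Σℕ-∧∧ : ∀ {A : Set} b (xs : List A) f → b ∧∧ Σℕ xs f ≡ Σℕ xs (λ x → b ∧∧ f x)
Σℕ-∧∧ true  xs f = refl
Σℕ-∧∧ false xs f = ≡-sym (Σℕ-0 xs)

module Colourings {A : Set} (adj : A → A → Bool) (adj-sym : ∀ u v → adj u v ≡ adj v u) where

  module _ {C : Set} (same : C → C → Bool) where
    clashFree : A → C → A → C → Bool
    clashFree w x w′ x′ = not (adj w w′ ∧ same x x′)

    -- The number of colourings of V with colours from cs in which w may take colour x only if
    -- ok w x, and adjacent members of V take different colours.
    count : List C → List A → (A → C → Bool) → ℕ
    count cs []      ok = 1
    count cs (w ∷ V) ok = Σℕ cs λ x → ok w x ∧∧ count cs V (λ w′ x′ → ok w′ x′ ∧ clashFree w x w′ x′)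

  -- A count sees colours only through `same` and `ok`. The list ps indexes both palettes, so no
  -- inverse of φ or ψ is required.
  count-relabel : ∀ {B C D : Set} {sameC : C → C → Bool} {sameD : D → D → Bool} (φ : B → C) (ψ : B → D) (ps : List B) →
    (∀ {p q} → p ∈ ps → q ∈ ps → sameC (φ p) (φ q) ≡ sameD (ψ p) (ψ q)) →
    ∀ V {ok ok′} → (∀ {w p} → w ∈ V → p ∈ ps → ok w (φ p) ≡ ok′ w (ψ p)) →
    count sameC (map φ ps) V ok ≡ count sameD (map ψ ps) V ok′
  count-relabel φ ψ ps eq []      oks = refl
  count-relabel φ ψ ps eq (w ∷ V) oks = trans (Σℕ-map φ ps _) (trans
    (Σℕ-cong ps λ {x} x∈ → cong₂ _∧∧_ (oks (here refl) x∈) (count-relabel φ ψ ps eq V λ {w′} {q} w′∈ q∈ →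
      cong₂ _∧_ (oks (there w′∈) q∈) (cong (λ z → not (adj w w′ ∧ z)) (eq x∈ q∈))))
    (≡-sym (Σℕ-map ψ ps _)))

  count-cong : ∀ {C : Set} {same : C → C → Bool} cs V {ok ok′} → (∀ {w x} → w ∈ V → x ∈ cs → ok w x ≡ ok′ w x) →
    count same cs V ok ≡ count same cs V ok′
  count-cong {same = same} cs V {ok} {ok′} oks = subst₂ (λ a b → count same a V ok ≡ count same b V ok′) (map-id cs) (map-id cs)
    (count-relabel id id cs (λ _ _ → refl) V oks)

  count-↭-colours : ∀ {C : Set} {same : C → C → Bool} {cs ds} V {ok} → cs ↭ ds → count same cs V ok ≡ count same ds V ok
  count-↭-colours []      p = refl
  count-↭-colours {same = same} {cs} {ds} (w ∷ V) {ok} p = trans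
    (Σℕ-cong cs λ {x} _ → cong (ok w x ∧∧_) (count-↭-colours V p)) (Σℕ-↭ _ p)

  module _ {C : Set} (same : C → C → Bool) (same-sym : ∀ x y → same x y ≡ same y x) where
    -- For two neighbouring vertices, the sums over their colours commute and the clash condition
    -- between them is symmetric.
    count-↭ : ∀ cs {V V′} {ok} → V ↭ V′ → count same cs V ok ≡ count same cs V′ ok
    count-↭ cs Perm.refl = refl
    count-↭ cs {ok = ok} (Perm.prep w p) = Σℕ-cong cs λ {x} _ → cong (ok w x ∧∧_) (count-↭ cs p)
    count-↭ cs {ok = ok} (Perm.swap {V} {V′} u w p) = begin
      Σℕ cs (λ x → ok u x ∧∧ Σℕ cs (λ y → (ok w y ∧ clashFree same u x w y) ∧∧ count same cs V (okᵘ x y)))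
        ≡⟨ Σℕ-cong cs (λ {x} _ → Σℕ-∧∧ (ok u x) cs _) ⟩
      Σℕ cs (λ x → Σℕ cs (λ y → ok u x ∧∧ ((ok w y ∧ clashFree same u x w y) ∧∧ count same cs V (okᵘ x y))))
        ≡⟨ Σℕ-swap cs cs _ ⟩
      Σℕ cs (λ y → Σℕ cs (λ x → ok u x ∧∧ ((ok w y ∧ clashFree same u x w y) ∧∧ count same cs V (okᵘ x y))))
        ≡⟨ Σℕ-cong cs (λ {y} _ → Σℕ-cong cs λ {x} _ → exchange x y) ⟩
      Σℕ cs (λ y → Σℕ cs (λ x → ok w y ∧∧ ((ok u x ∧ clashFree same w y u x) ∧∧ count same cs V′ (okʷ x y))))
        ≡⟨ ≡-sym (Σℕ-cong cs (λ {y} _ → Σℕ-∧∧ (ok w y) cs _)) ⟩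
      Σℕ cs (λ y → ok w y ∧∧ Σℕ cs (λ x → (ok u x ∧ clashFree same w y u x) ∧∧ count same cs V′ (okʷ x y))) ∎
      where
      open ≡-Reasoning
      okᵘ okʷ : C → C → A → C → Bool
      okᵘ x y w′ x′ = (ok w′ x′ ∧ clashFree same u x w′ x′) ∧ clashFree same w y w′ x′
      okʷ x y w′ x′ = (ok w′ x′ ∧ clashFree same w y w′ x′) ∧ clashFree same u x w′ x′
      perm∧ : ∀ a b c → (a ∧ b) ∧ c ≡ (a ∧ c) ∧ b
      perm∧ true  b c = ∧-comm b c
      perm∧ false b c = refl
      guards : ∀ a b c n → a ∧∧ ((b ∧ c) ∧∧ n) ≡ b ∧∧ ((a ∧ c) ∧∧ n)
      guards true  true  c n = refl
      guards true  false c n = refl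
      guards false true  c n = refl
      guards false false c n = refl
      exchange : ∀ x y → ok u x ∧∧ ((ok w y ∧ clashFree same u x w y) ∧∧ count same cs V (okᵘ x y)) ≡
                         ok w y ∧∧ ((ok u x ∧ clashFree same w y u x) ∧∧ count same cs V′ (okʷ x y))
      exchange x y = trans (guards (ok u x) (ok w y) _ _) (cong₂ (λ a n → ok w y ∧∧ ((ok u x ∧ a) ∧∧ n))
        (cong₂ (λ a b → not (a ∧ b)) (adj-sym u w) (same-sym x y))
        (trans (count-↭ cs p) (count-cong cs V′ λ {w′} {x′} _ _ → perm∧ (ok w′ x′) _ _)))
    count-↭ cs (Perm.trans p q) = trans (count-↭ cs p) (count-↭ cs q)

  module _ {C : Set} (same : C → C → Bool) (cs ds : List C)
    (disjoint : ∀ {x y} → x ∈ cs → y ∈ ds → same x y ≡ false × same y x ≡ false) where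

    private
      unclash : ∀ a b {c} → c ≡ false → a ∧ not (b ∧ c) ≡ a
      unclash true  true  refl = refl
      unclash true  false refl = refl
      unclash false b     refl = refl

    -- A colouring sorts V into the vertices L with colours from cs and R with colours from ds.
    -- Vertices of different groups cannot clash, so the two counts multiply.
    count-splits : ∀ V {ok ok₁ ok₂} → (∀ {w x} → x ∈ cs → ok w x ≡ ok₁ w x) → (∀ {w x} → x ∈ ds → ok w x ≡ ok₂ w x) →
      count same (cs ++ ds) V ok ≡ Σℕ (splits V) (λ (L , R) → count same cs L ok₁ ℕ.* count same ds R ok₂)
    count-splits [] e₁ e₂ = refl
    count-splits (w ∷ V) {ok} {ok₁} {ok₂} e₁ e₂ = begin
      Σℕ (cs ++ ds) (λ x → ok w x ∧∧ count same (cs ++ ds) V (λ w′ x′ → ok w′ x′ ∧ clashFree same w x w′ x′))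
        ≡⟨ Σℕ-++ cs ds _ ⟩
      Σℕ cs F ℕ.+ Σℕ ds F ≡⟨ cong₂ ℕ._+_ left right ⟩
      Σℕ (splits V) (λ (L , R) → count same cs (w ∷ L) ok₁ ℕ.* count same ds R ok₂) ℕ.+
      Σℕ (splits V) (λ (L , R) → count same cs L ok₁ ℕ.* count same ds (w ∷ R) ok₂)
        ≡⟨ cong₂ ℕ._+_ (≡-sym (Σℕ-map _ (splits V) _)) (≡-sym (Σℕ-map _ (splits V) _)) ⟩
      Σℕ (map (λ (L , R) → w ∷ L , R) (splits V)) g ℕ.+ Σℕ (map (λ (L , R) → L , w ∷ R) (splits V)) g
        ≡⟨ ≡-sym (Σℕ-++ (map (λ (L , R) → w ∷ L , R) (splits V)) _ g) ⟩
      Σℕ (splits (w ∷ V)) g ∎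
      where
      open ≡-Reasoning
      F : C → ℕ
      F x = ok w x ∧∧ count same (cs ++ ds) V (λ w′ x′ → ok w′ x′ ∧ clashFree same w x w′ x′)
      g : List A × List A → ℕ
      g (L , R) = count same cs L ok₁ ℕ.* count same ds R ok₂
      ∧∧-* : ∀ b m n → b ∧∧ (m ℕ.* n) ≡ (b ∧∧ m) ℕ.* n
      ∧∧-* true  m n = refl
      ∧∧-* false m n = refl
      ∧∧-*ʳ : ∀ b m n → b ∧∧ (m ℕ.* n) ≡ m ℕ.* (b ∧∧ n)
      ∧∧-*ʳ true  m n = refl
      ∧∧-*ʳ false m n = ≡-sym (ℕP.*-zeroʳ m)
      left : Σℕ cs F ≡ Σℕ (splits V) (λ (L , R) → count same cs (w ∷ L) ok₁ ℕ.* count same ds R ok₂)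
      left = begin
        Σℕ cs F ≡⟨ Σℕ-cong cs (λ {x} x∈ → trans (cong₂ _∧∧_ (e₁ x∈) (count-splits V
                     {ok₁ = λ w′ x′ → ok₁ w′ x′ ∧ clashFree same w x w′ x′} {ok₂ = ok₂}
                     (λ x′∈ → cong (_∧ _) (e₁ x′∈))
                     (λ {w′} {x′} x′∈ → trans (unclash (ok w′ x′) (adj w w′) (proj₁ (disjoint x∈ x′∈))) (e₂ x′∈))))
                   (trans (Σℕ-∧∧ (ok₁ w x) (splits V) _) (Σℕ-cong (splits V) λ {LR} _ → ∧∧-* (ok₁ w x) (count same cs (proj₁ LR) _) _))) ⟩
        Σℕ cs (λ x → Σℕ (splits V) (λ (L , R) → (ok₁ w x ∧∧ count same cs L (λ w′ x′ → ok₁ w′ x′ ∧ clashFree same w x w′ x′)) ℕ.* count same ds R ok₂))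
          ≡⟨ Σℕ-swap cs (splits V) _ ⟩
        Σℕ (splits V) (λ (L , R) → Σℕ cs (λ x → (ok₁ w x ∧∧ count same cs L (λ w′ x′ → ok₁ w′ x′ ∧ clashFree same w x w′ x′)) ℕ.* count same ds R ok₂))
          ≡⟨ Σℕ-cong (splits V) (λ _ → Σℕ-*ʳ cs _ _) ⟩
        Σℕ (splits V) (λ (L , R) → count same cs (w ∷ L) ok₁ ℕ.* count same ds R ok₂) ∎
      right : Σℕ ds F ≡ Σℕ (splits V) (λ (L , R) → count same cs L ok₁ ℕ.* count same ds (w ∷ R) ok₂)
      right = begin
        Σℕ ds F ≡⟨ Σℕ-cong ds (λ {x} x∈ → trans (cong₂ _∧∧_ (e₂ x∈) (count-splits V
                     {ok₁ = ok₁} {ok₂ = λ w′ x′ → ok₂ w′ x′ ∧ clashFree same w x w′ x′}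
                     (λ {w′} {x′} x′∈ → trans (unclash (ok w′ x′) (adj w w′) (proj₂ (disjoint x′∈ x∈))) (e₁ x′∈))
                     (λ x′∈ → cong (_∧ _) (e₂ x′∈))))
                   (trans (Σℕ-∧∧ (ok₂ w x) (splits V) _) (Σℕ-cong (splits V) λ {LR} _ → ∧∧-*ʳ (ok₂ w x) (count same cs (proj₁ LR) _) _))) ⟩
        Σℕ ds (λ x → Σℕ (splits V) (λ (L , R) → count same cs L ok₁ ℕ.* (ok₂ w x ∧∧ count same ds R (λ w′ x′ → ok₂ w′ x′ ∧ clashFree same w x w′ x′))))
          ≡⟨ Σℕ-swap ds (splits V) _ ⟩
        Σℕ (splits V) (λ (L , R) → Σℕ ds (λ x → count same cs L ok₁ ℕ.* (ok₂ w x ∧∧ count same ds R (λ w′ x′ → ok₂ w′ x′ ∧ clashFree same w x w′ x′))))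
          ≡⟨ Σℕ-cong (splits V) (λ {LR} _ → Σℕ-*ˡ ds _ (count same cs (proj₁ LR) ok₁)) ⟩
        Σℕ (splits V) (λ (L , R) → count same cs L ok₁ ℕ.* count same ds (w ∷ R) ok₂) ∎

  edgeFree : List A → Set
  edgeFree = AllPairs (λ u v → adj u v ≡ false)

  count-edgeFree : ∀ {C : Set} {same : C → C → Bool} (cs : List C) V (okc : C → Bool) {ok} → edgeFree V →
    All (λ w → ∀ x → ok w x ≡ okc x) V → count same cs V ok ≡ Σℕ cs (λ x → okc x ∧∧ 1) ℕ.^ length V
  count-edgeFree cs []      okc AllPairs.[] All.[] = refl
  count-edgeFree {same = same} cs (w ∷ V) okc {ok} (e AllPairs.∷ es) (o All.∷ os) = trans
    (Σℕ-cong cs λ {x} _ → trans (cong₂ _∧∧_ (o x)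
      (count-edgeFree cs V okc es (All.zipWith (λ { (eq , f) x′ → trans (cong₂ (λ a b → a ∧ not (b ∧ same x x′)) (f x′) eq) (∧-true (okc x′)) }) (e , os))))
      (unit (okc x) _))
    (Σℕ-*ʳ cs (λ x → okc x ∧∧ 1) _)
    where
    ∧-true : ∀ b → b ∧ true ≡ b
    ∧-true true  = refl
    ∧-true false = refl
    unit : ∀ b n → b ∧∧ n ≡ (b ∧∧ 1) ℕ.* n
    unit true  n = ≡-sym (ℕP.+-identityʳ n)
    unit false n = refl

-- Comparison of colours, binomial sums and generating series

≡ᵇ-refl : ∀ n → (n ≡ᵇ n) ≡ true
≡ᵇ-refl zero    = refl
≡ᵇ-refl (suc n) = ≡ᵇ-refl n

≡ᵇ-sym : ∀ m n → (m ≡ᵇ n) ≡ (n ≡ᵇ m)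
≡ᵇ-sym zero    zero    = refl
≡ᵇ-sym zero    (suc n) = refl
≡ᵇ-sym (suc m) zero    = refl
≡ᵇ-sym (suc m) (suc n) = ≡ᵇ-sym m n

≡ᵇ-< : ∀ {m n} → m < n → (m ≡ᵇ n) ≡ false
≡ᵇ-< {zero}  {suc n} _        = refl
≡ᵇ-< {suc m} {suc n} (s≤s lt) = ≡ᵇ-< lt

≡ᵇ-> : ∀ {m n} → m < n → (n ≡ᵇ m) ≡ false
≡ᵇ-> {m} {n} lt = trans (≡ᵇ-sym n m) (≡ᵇ-< lt)

≡ᵇ-+ : ∀ k m n → (k ℕ.+ m ≡ᵇ k ℕ.+ n) ≡ (m ≡ᵇ n)
≡ᵇ-+ zero    m n = refl
≡ᵇ-+ (suc k) m n = ≡ᵇ-+ k m n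

not-∧-false : ∀ a {b} → b ≡ false → not (a ∧ b) ≡ true
not-∧-false true  refl = refl
not-∧-false false refl = refl

range-∷ʳ : ∀ n → range (suc n) ≡ range n ++ n ∷ []
range-∷ʳ n = trans (cong range (ℕP.+-comm 1 n)) (trans (range-+ n 1) (cong (λ z → range n ++ z ∷ []) (ℕP.+-identityʳ n)))

-- The increasing enumeration of the natural numbers other than the first argument.
skip : ℕ → ℕ → ℕ
skip zero    i       = suc i
skip (suc c) zero    = zero
skip (suc c) (suc i) = suc (skip c i)

skip-≡ᵇ : ∀ c i j → (skip c i ≡ᵇ skip c j) ≡ (i ≡ᵇ j)
skip-≡ᵇ zero    i       j       = refl
skip-≡ᵇ (suc c) zero    zero    = refl
skip-≡ᵇ (suc c) zero    (suc j) = refl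
skip-≡ᵇ (suc c) (suc i) zero    = refl
skip-≡ᵇ (suc c) (suc i) (suc j) = skip-≡ᵇ c i j

skip-≢ : ∀ c i → (skip c i ≡ᵇ c) ≡ false
skip-≢ zero    i       = refl
skip-≢ (suc c) zero    = refl
skip-≢ (suc c) (suc i) = skip-≢ c i

range-skip : ∀ c K → c ≤ K → range (suc K) ↭ c ∷ map (skip c) (range K)
range-skip zero    K       _       = Perm.refl
range-skip (suc c) (suc K) (s≤s le) = ↭-trans (Perm.prep 0 (↭-map⁺ suc (range-skip c K le)))
  (↭-trans (Perm.swap 0 (suc c) Perm.refl) (Perm.prep (suc c) (Perm.prep 0 (Perm.↭-reflexive
    (trans (≡-sym (map-∘ (range K))) (map-∘ (range K)))))))

conv-ℕ : ∀ (f g : ℕ → ℕ) n → conv (λ i → + f i) (λ i → + g i) n ≡ + Σℕ (range (suc n)) (λ c → f c ℕ.* g (n ℕ.∸ c))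
conv-ℕ f g zero    = trans (≡-sym (ℤP.pos-* (f 0) (g 0))) (cong +_ (≡-sym (ℕP.+-identityʳ _)))
conv-ℕ f g (suc n) = cong₂ ℤ._+_ (≡-sym (ℤP.pos-* (f 0) (g (suc n))))
  (trans (conv-ℕ (f ∘ suc) g n) (cong +_ (≡-sym (Σℕ-map suc (range (suc n)) _))))

Σˢ-coeff : ∀ {B : Set} (xs : List B) (F : B → Ser) (G : B → ℕ) i → (∀ x → coeff (F x) i ≡ + G x) → coeff (Σˢ xs F) i ≡ + Σℕ xs G
Σˢ-coeff []       F G i e = 𝟘-coeff i
Σˢ-coeff (x ∷ xs) F G i e = trans (⊕-coeff (F x) (Σˢ xs F) i) (cong₂ ℤ._+_ (e x) (Σˢ-coeff xs F G i e))

Σˢ-congAll : ∀ {B : Set} {xs : List B} {f g : B → Ser} → All (λ x → f x ≈ g x) xs → Σˢ xs f ≈ Σˢ xs g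
Σˢ-congAll All.[]       = S.refl
Σˢ-congAll (p All.∷ ps) = S.+-cong p (Σˢ-congAll ps)

ℕseries : (ℕ → ℕ) → Ser
ℕseries f = ser λ i → + f i

Σ-conv : ∀ {B : Set} (xs : List B) (f g : B → ℕ → ℕ) n →
  coeff (Σˢ xs (λ x → ℕseries (f x) ⊛ ℕseries (g x))) n ≡ + Σℕ (range (suc n)) (λ c → Σℕ xs (λ x → f x c ℕ.* g x (n ℕ.∸ c)))
Σ-conv xs f g n = trans (Σˢ-coeff xs _ (λ x → Σℕ (range (suc n)) (λ c → f x c ℕ.* g x (n ℕ.∸ c))) n
    (λ x → trans (⊛-coeff (ℕseries (f x)) (ℕseries (g x)) n) (conv-ℕ (f x) (g x) n)))
  (cong +_ (Σℕ-swap xs (range (suc n)) _))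

-- One entry for each of the 2^m splittings of m points, so that (l, r) occurs C(m, l) times and
-- sums over the list are binomial sums.
sizes : ℕ → List (ℕ × ℕ)
sizes zero    = (0 , 0) ∷ []
sizes (suc m) = map (λ (l , r) → suc l , r) (sizes m) ++ map (λ (l , r) → l , suc r) (sizes m)

sizes-sum : ∀ m → All (λ (l , r) → l ℕ.+ r ≡ m) (sizes m)
sizes-sum zero    = refl All.∷ All.[]
sizes-sum (suc m) = AllP.++⁺ (AllP.map⁺ (All.map (cong suc) (sizes-sum m)))
  (AllP.map⁺ (All.map (λ { {l , r} eq → trans (ℕP.+-suc l r) (cong suc eq) }) (sizes-sum m)))

Σˢ-sizes-suc : ∀ m (G : ℕ → ℕ → Ser) →
  Σˢ (sizes (suc m)) (λ (l , r) → G l r) ≈ Σˢ (sizes m) (λ (l , r) → G (suc l) r) ⊕ Σˢ (sizes m) (λ (l , r) → G l (suc r))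
Σˢ-sizes-suc m G = S.trans (Σˢ-++ (map (λ (l , r) → suc l , r) (sizes m)) _ _)
  (S.+-cong (Σˢ-map (λ (l , r) → suc l , r) (sizes m) _) (Σˢ-map (λ (l , r) → l , suc r) (sizes m) _))

Σˢ-splits : ∀ {A : Set} (V : List A) (G : ℕ → ℕ → Ser) →
  Σˢ (splits V) (λ (L , R) → G (length L) (length R)) ≈ Σˢ (sizes (length V)) (λ (l , r) → G l r)
Σˢ-splits []      G = S.refl
Σˢ-splits (w ∷ V) G = S.trans (Σˢ-++ (map (λ (L , R) → w ∷ L , R) (splits V)) _ _)
  (S.trans (S.+-cong
    (S.trans (Σˢ-map (λ (L , R) → w ∷ L , R) (splits V) _) (Σˢ-splits V (λ l r → G (suc l) r)))
    (S.trans (Σˢ-map (λ (L , R) → L , w ∷ R) (splits V) _) (Σˢ-splits V (λ l r → G l (suc r)))))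
  (S.sym (Σˢ-sizes-suc (length V) G)))

Σℕ-binomial : ∀ a b m → Σℕ (sizes m) (λ (l , r) → a ℕ.^ l ℕ.* b ℕ.^ r) ≡ (a ℕ.+ b) ℕ.^ m
Σℕ-binomial a b zero    = refl
Σℕ-binomial a b (suc m) = begin
  Σℕ (sizes (suc m)) (λ (l , r) → a ℕ.^ l ℕ.* b ℕ.^ r)
    ≡⟨ trans (Σℕ-++ (map (λ (l , r) → suc l , r) (sizes m)) _ _) (cong₂ ℕ._+_ (Σℕ-map _ (sizes m) _) (Σℕ-map _ (sizes m) _)) ⟩
  Σℕ (sizes m) (λ (l , r) → a ℕ.^ suc l ℕ.* b ℕ.^ r) ℕ.+ Σℕ (sizes m) (λ (l , r) → a ℕ.^ l ℕ.* b ℕ.^ suc r)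
    ≡⟨ cong₂ ℕ._+_
        (trans (Σℕ-cong (sizes m) λ { {l , r} _ → ℕP.*-assoc a (a ℕ.^ l) _ }) (Σℕ-*ˡ (sizes m) _ a))
        (trans (Σℕ-cong (sizes m) λ { {l , r} _ → move (a ℕ.^ l) b (b ℕ.^ r) }) (Σℕ-*ˡ (sizes m) _ b)) ⟩
  a ℕ.* Σℕ (sizes m) (λ (l , r) → a ℕ.^ l ℕ.* b ℕ.^ r) ℕ.+ b ℕ.* Σℕ (sizes m) (λ (l , r) → a ℕ.^ l ℕ.* b ℕ.^ r)
    ≡⟨ ≡-sym (ℕP.*-distribʳ-+ _ a b) ⟩
  (a ℕ.+ b) ℕ.* Σℕ (sizes m) (λ (l , r) → a ℕ.^ l ℕ.* b ℕ.^ r) ≡⟨ cong ((a ℕ.+ b) ℕ.*_) (Σℕ-binomial a b m) ⟩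
  (a ℕ.+ b) ℕ.^ suc m ∎
  where
  open ≡-Reasoning
  move : ∀ x y z → x ℕ.* (y ℕ.* z) ≡ y ℕ.* (x ℕ.* z)
  move = solve-∀

powerSeries : ℕ → Ser
powerSeries m = ℕseries λ K → suc K ℕ.^ m

-- In degree K this is (K+1)^(m+1) = K (K+1)^m + (K+1)^m: for each of the K pairs c + c′ = K - 1,
-- the binomial theorem sums (c+1)^l (c′+1)^r over all splittings to (K+1)^m.
powerSeries-suc : ∀ m → powerSeries (suc m) ≈ t ⊛ Σˢ (sizes m) (λ (l , r) → powerSeries l ⊛ powerSeries r) ⊕ powerSeries m
powerSeries-suc m = pointwise λ
  { zero → ≡-sym (trans (⊕-coeff (t ⊛ Q) (powerSeries m) 0) (trans (cong (ℤ._+ + (1 ℕ.^ m)) (t⊛-coeff-0 Q))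
             (cong +_ (≡-sym (ℕP.*-identityˡ (1 ℕ.^ m))))))
  ; (suc n) → ≡-sym (trans (⊕-coeff (t ⊛ Q) (powerSeries m) (suc n)) (trans (cong (ℤ._+ + (suc (suc n) ℕ.^ m))
      (trans (t⊛-coeff-suc Q n) (trans (Σ-conv (sizes m) (λ (l , r) K → suc K ℕ.^ l) (λ (l , r) K → suc K ℕ.^ r) n) (cong +_ (total n)))))
      (cong +_ (ℕP.+-comm (suc n ℕ.* suc (suc n) ℕ.^ m) _)))) }
  where
  Q = Σˢ (sizes m) (λ (l , r) → powerSeries l ⊛ powerSeries r)
  total : ∀ n → Σℕ (range (suc n)) (λ c → Σℕ (sizes m) (λ (l , r) → suc c ℕ.^ l ℕ.* suc (n ℕ.∸ c) ℕ.^ r)) ≡ suc n ℕ.* suc (suc n) ℕ.^ m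
  total n = trans (Σℕ-cong (range (suc n)) λ {c} c∈ → trans (Σℕ-binomial (suc c) (suc (n ℕ.∸ c)) m)
      (cong (ℕ._^ m) (trans (ℕP.+-suc (suc c) _) (cong (suc ∘ suc) (ℕP.m+[n∸m]≡n (ℕ.s≤s⁻¹ (range-< (suc n) c∈)))))))
    (trans (Σℕ-const (range (suc n)) _) (cong (ℕ._* suc (suc n) ℕ.^ m) (length-range (suc n))))

-- E m is the numerator of Σ_K (K+1)^m t^K = E m / (1-t)^{m+1}, an Eulerian polynomial.
E : ℕ → Ser
E m = 1-t ^ˢ suc m ⊛ powerSeries m

numerator-⊛ : ∀ {l r m f g} → l ℕ.+ r ≡ m → 1-t ^ˢ suc (suc m) ⊛ (f ⊛ g) ≈ (1-t ^ˢ suc l ⊛ f) ⊛ (1-t ^ˢ suc r ⊛ g)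
numerator-⊛ {l} {r} {f = f} {g} refl = S.trans (S.*-cong (S.*-cong S.refl (S.*-cong S.refl (^ˢ-+ 1-t l r))) S.refl)
  (solve 5 (λ x y z f g → (x :* (x :* (y :* z))) :* (f :* g) := ((x :* y) :* f) :* ((x :* z) :* g)) S.refl 1-t (1-t ^ˢ l) (1-t ^ˢ r) f g)

numerator-Σ : ∀ {B : Set} (xs : List B) m (l r : B → ℕ) (f g : B → Ser) → All (λ x → l x ℕ.+ r x ≡ m) xs →
  1-t ^ˢ suc (suc m) ⊛ (t ⊛ Σˢ xs (λ x → f x ⊛ g x)) ≈ t ⊛ Σˢ xs (λ x → (1-t ^ˢ suc (l x) ⊛ f x) ⊛ (1-t ^ˢ suc (r x) ⊛ g x))
numerator-Σ xs m l r f g eqs = S.trans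
  (solve 3 (λ p t s → p :* (t :* s) := t :* (s :* p)) S.refl (1-t ^ˢ suc (suc m)) t _)
  (S.*-cong S.refl (S.trans (S.sym (Σˢ-⊛ xs _ _)) (Σˢ-congAll (All.map (λ {x} eq → S.trans (S.*-comm _ _) (numerator-⊛ {l x} {r x} eq)) eqs))))

E-suc : ∀ m → E (suc m) ≈ t ⊛ Σˢ (sizes m) (λ (l , r) → E l ⊛ E r) ⊕ 1-t ⊛ E m
E-suc m = S.trans (S.*-cong S.refl (powerSeries-suc m)) (S.trans (S.distribˡ _ _ _)
  (S.+-cong (numerator-Σ (sizes m) m proj₁ proj₂ (powerSeries ∘ proj₁) (powerSeries ∘ proj₂) (sizes-sum m)) (S.*-assoc _ _ _)))

geometric : ∀ {f} → (∀ i → coeff f i ≡ + 1) → 1-t ^ˢ 1 ⊛ f ≈ 𝟙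
geometric {f} one = S.trans (S.*-cong (S.*-identityʳ 1-t) S.refl) (pointwise λ
  { zero → trans (1-t⊛-coeff-0 f) (trans (one 0) (≡-sym (𝕔-coeff (+ 1) 0)))
  ; (suc i) → trans (1-t⊛-coeff-suc f i) (trans (cong₂ ℤ._-_ (one (suc i)) (one i)) (≡-sym (𝕔-coeff (+ 1) (suc i)))) })

E-0 : E 0 ≈ 𝟙
E-0 = geometric λ _ → refl

-- Rooted colourings and their recursion

module RootedColourings {A : Set} (adj : A → A → Bool) (adj-sym : ∀ u v → adj u v ≡ adj v u)
  (∗ : A) (∗-isolated : ∀ v → adj ∗ v ≡ false) where

  open Colourings adj adj-sym

  avoid : (A → Bool) → ℕ → A → ℕ → Bool
  avoid X K w x = not (X w ∧ (x ≡ᵇ K))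

  -- X is the neighbourhood of an additional vertex, the root, which has the last colour K.
  rooted# : List A → (A → Bool) → ℕ → ℕ
  rooted# V X K = count _≡ᵇ_ (range (suc K)) V (avoid X K)

  rooted#-0 : ∀ v V X → X v ≡ true → rooted# (v ∷ V) X 0 ≡ 0
  rooted#-0 v V X Xv = cong (λ z → (not (z ∧ true) ∧∧ count _≡ᵇ_ (range 1) V (λ w′ x′ → avoid X 0 w′ x′ ∧ clashFree _≡ᵇ_ v 0 w′ x′)) ℕ.+ 0) Xv

  rooted#-suc : ∀ v V X n → X v ≡ true →
    rooted# (v ∷ V) X (suc n) ≡ Σℕ (range (suc n)) (λ c → Σℕ (splits V) (λ (L , R) → rooted# L (adj v) c ℕ.* rooted# R X (n ℕ.∸ c)))
  rooted#-suc v V X n Xv = begin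
    Σℕ (range (suc (suc n))) F   ≡⟨ cong (λ z → Σℕ z F) (range-∷ʳ (suc n)) ⟩
    Σℕ (range (suc n) ++ suc n ∷ []) F  ≡⟨ Σℕ-++ (range (suc n)) _ F ⟩
    Σℕ (range (suc n)) F ℕ.+ (F (suc n) ℕ.+ 0) ≡⟨ cong₂ ℕ._+_ (Σℕ-cong (range (suc n)) (λ c∈ → below (ℕ.s≤s⁻¹ (range-< (suc n) c∈)))) (trans (ℕP.+-identityʳ _) last) ⟩
    Σℕ (range (suc n)) G ℕ.+ 0   ≡⟨ ℕP.+-identityʳ _ ⟩
    Σℕ (range (suc n)) G         ∎
    where
    open ≡-Reasoning
    F : ℕ → ℕ
    F c = avoid X (suc n) v c ∧∧ count _≡ᵇ_ (range (suc (suc n))) V (λ w′ x′ → avoid X (suc n) w′ x′ ∧ clashFree _≡ᵇ_ v c w′ x′)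
    G : ℕ → ℕ
    G c = Σℕ (splits V) (λ (L , R) → rooted# L (adj v) c ℕ.* rooted# R X (n ℕ.∸ c))
    last : F (suc n) ≡ 0
    last = cong (_∧∧ count _≡ᵇ_ (range (suc (suc n))) V (λ w′ x′ → avoid X (suc n) w′ x′ ∧ clashFree _≡ᵇ_ v (suc n) w′ x′)) (cong₂ (λ a b → not (a ∧ b)) Xv (≡ᵇ-refl n))
    below : ∀ {c} → c ≤ n → F c ≡ G c
    below {c} c≤n = begin
      F c ≡⟨ cong (_∧∧ count _≡ᵇ_ (range (suc (suc n))) V ok) (not-∧-false (X v) (≡ᵇ-< (s≤s c≤n))) ⟩
      count _≡ᵇ_ (range (suc (suc n))) V ok ≡⟨ cong (λ z → count _≡ᵇ_ z V ok) range≡ ⟩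
      count _≡ᵇ_ (range (suc c) ++ map (suc c ℕ.+_) (range (suc (n ℕ.∸ c)))) V ok
        ≡⟨ count-splits _≡ᵇ_ (range (suc c)) (map (suc c ℕ.+_) (range (suc (n ℕ.∸ c)))) apart V lower upper ⟩
      Σℕ (splits V) (λ (L , R) → rooted# L (adj v) c ℕ.* count _≡ᵇ_ (map (suc c ℕ.+_) (range (suc (n ℕ.∸ c)))) R (avoid X (suc n)))
        ≡⟨ Σℕ-cong (splits V) (λ { {L , R} _ → cong (rooted# L (adj v) c ℕ.*_) (shifted R) }) ⟩
      G c ∎
      where
      ok : A → ℕ → Bool
      ok w′ x′ = avoid X (suc n) w′ x′ ∧ clashFree _≡ᵇ_ v c w′ x′
      c+ : c ℕ.+ (n ℕ.∸ c) ≡ n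
      c+ = ℕP.m+[n∸m]≡n c≤n
      range≡ : range (suc (suc n)) ≡ range (suc c) ++ map (suc c ℕ.+_) (range (suc (n ℕ.∸ c)))
      range≡ = trans (cong (range ∘ suc) (trans (cong suc (≡-sym c+)) (≡-sym (ℕP.+-suc c (n ℕ.∸ c))))) (range-+ (suc c) (suc (n ℕ.∸ c)))
      above : ∀ {y} → y ∈ map (suc c ℕ.+_) (range (suc (n ℕ.∸ c))) → c < y
      above y∈ with ∈-map⁻ (suc c ℕ.+_) y∈
      ... | z , _ , refl = s≤s (ℕP.m≤m+n c z)
      apart : ∀ {x y} → x ∈ range (suc c) → y ∈ map (suc c ℕ.+_) (range (suc (n ℕ.∸ c))) → (x ≡ᵇ y) ≡ false × (y ≡ᵇ x) ≡ false
      apart x∈ y∈ = ≡ᵇ-< lt , ≡ᵇ-> lt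
        where lt = ℕP.≤-trans (range-< (suc c) x∈) (above y∈)
      -- Colours up to c are never the last colour, so X imposes nothing here; the clash with v
      -- becomes avoidance of c, the last colour of the lower range.
      lower : ∀ {w x} → x ∈ range (suc c) → ok w x ≡ avoid (adj v) c w x
      lower {w} {x} x∈ = cong₂ _∧_ (not-∧-false (X w) (≡ᵇ-< (ℕP.≤-trans (range-< (suc c) x∈) (s≤s c≤n)))) (cong (λ z → not (adj v w ∧ z)) (≡ᵇ-sym c x))
      upper : ∀ {w x} → x ∈ map (suc c ℕ.+_) (range (suc (n ℕ.∸ c))) → ok w x ≡ avoid X (suc n) w x
      upper {w} {x} x∈ = trans (cong (avoid X (suc n) w x ∧_) (not-∧-false (adj v w) (≡ᵇ-< (above x∈)))) (∧-comm _ true)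
      shifted : ∀ R → count _≡ᵇ_ (map (suc c ℕ.+_) (range (suc (n ℕ.∸ c)))) R (avoid X (suc n)) ≡ rooted# R X (n ℕ.∸ c)
      shifted R = trans (count-relabel (suc c ℕ.+_) id (range (suc (n ℕ.∸ c))) (λ {p} {q} _ _ → ≡ᵇ-+ (suc c) p q) R
          (λ {w} {p} _ _ → cong (λ z → not (X w ∧ z)) (trans (cong (suc c ℕ.+ p ≡ᵇ_) (cong suc (≡-sym c+))) (≡ᵇ-+ (suc c) p (n ℕ.∸ c)))))
        (cong (λ z → count _≡ᵇ_ z R (avoid X (n ℕ.∸ c))) (map-id _))

  rootedSeries : List A → (A → Bool) → Ser
  rootedSeries V X = ℕseries (rooted# V X)

  rootedSeries-∷ : ∀ v V X → X v ≡ true →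
    rootedSeries (v ∷ V) X ≈ t ⊛ Σˢ (splits V) (λ (L , R) → rootedSeries L (adj v) ⊛ rootedSeries R X)
  rootedSeries-∷ v V X Xv = pointwise λ
    { zero    → trans (cong +_ (rooted#-0 v V X Xv)) (≡-sym (t⊛-coeff-0 Q))
    ; (suc n) → trans (cong +_ (rooted#-suc v V X n Xv))
        (≡-sym (trans (t⊛-coeff-suc Q n) (Σ-conv (splits V) (λ (L , R) → rooted# L (adj v)) (λ (L , R) → rooted# R X) n))) }
    where Q = Σˢ (splits V) (λ (L , R) → rootedSeries L (adj v) ⊛ rootedSeries R X)

  W : List A → (A → Bool) → Ser
  W V X = 1-t ^ˢ suc (length V) ⊛ rootedSeries V X

  W-∷ : ∀ v V X → X v ≡ true → W (v ∷ V) X ≈ t ⊛ Σˢ (splits V) (λ (L , R) → W L (adj v) ⊛ W R X)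
  W-∷ v V X Xv = S.trans (S.*-cong S.refl (rootedSeries-∷ v V X Xv))
    (numerator-Σ (splits V) (length V) (length ∘ proj₁) (length ∘ proj₂) (λ (L , R) → rootedSeries L (adj v)) (λ (L , R) → rootedSeries R X) (splits-length V))

  W-[] : ∀ X → W [] X ≈ 𝟙
  W-[] X = geometric λ _ → refl

  W-cong : ∀ V V′ {X X′} → length V ≡ length V′ → (∀ K → rooted# V X K ≡ rooted# V′ X′ K) → W V X ≈ W V′ X′
  W-cong V V′ len eq = S.*-cong (subst (λ z → 1-t ^ˢ suc (length V) ≈ 1-t ^ˢ suc z) len S.refl) (pointwise λ K → cong +_ (eq K))

  W-↭ : ∀ {V V′} X → V ↭ V′ → W V X ≈ W V′ X
  W-↭ {V} {V′} X p = W-cong V V′ (↭-length p) λ K → count-↭ _≡ᵇ_ ≡ᵇ-sym (range (suc K)) p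

  W-edgeFree : ∀ V X → edgeFree V → All (λ w → X w ≡ false) V → W V X ≈ E (length V)
  W-edgeFree V X ef fs = S.*-cong S.refl (pointwise λ K → cong +_ (trans
    (count-edgeFree (range (suc K)) V (λ _ → true) ef (All.map (λ eq x → cong (λ z → not (z ∧ (x ≡ᵇ K))) eq) fs))
    (cong (ℕ._^ length V) (trans (Σℕ-const (range (suc K)) 1) (trans (ℕP.*-identityʳ _) (length-range (suc K)))))))

  ∗-edgeFree : ∀ m → edgeFree (replicate m ∗)
  ∗-edgeFree zero    = AllPairs.[]
  ∗-edgeFree (suc m) = All.universal (λ v → ∗-isolated v) _ AllPairs.∷ ∗-edgeFree m

  -- Every point has the K colours other than the root's, so K^(m+1) replaces (K+1)^(m+1), a shift
  -- of the series by one degree. There has to be a point, because 0^0 = 1.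
  W-∗-full : ∀ m → W (replicate (suc m) ∗) (λ _ → true) ≈ t ⊛ E (suc m)
  W-∗-full m = S.trans (S.*-cong (subst (λ z → 1-t ^ˢ suc (length (replicate (suc m) ∗)) ≈ 1-t ^ˢ suc z) (length-replicate (suc m)) S.refl)
      (pointwise λ { zero → trans (cong +_ (number 0)) (≡-sym (t⊛-coeff-0 _)) ; (suc K) → trans (cong +_ (number (suc K))) (≡-sym (t⊛-coeff-suc _ K)) }))
    (solve 3 (λ p t q → p :* (t :* q) := t :* (p :* q)) S.refl _ t (powerSeries (suc m)))
    where
    number : ∀ K → rooted# (replicate (suc m) ∗) (λ _ → true) K ≡ K ℕ.^ suc m
    number K = trans (count-edgeFree (range (suc K)) (replicate (suc m) ∗) (λ x → not (x ≡ᵇ K)) (∗-edgeFree (suc m)) (All.universal (λ _ _ → refl) _))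
      (cong₂ ℕ._^_ colours (length-replicate (suc m)))
      where
      open ≡-Reasoning
      colours : Σℕ (range (suc K)) (λ x → not (x ≡ᵇ K) ∧∧ 1) ≡ K
      colours = begin
        Σℕ (range (suc K)) (λ x → not (x ≡ᵇ K) ∧∧ 1) ≡⟨ cong (λ z → Σℕ z (λ x → not (x ≡ᵇ K) ∧∧ 1)) (range-∷ʳ K) ⟩
        Σℕ (range K ++ K ∷ []) (λ x → not (x ≡ᵇ K) ∧∧ 1) ≡⟨ Σℕ-++ (range K) _ _ ⟩
        Σℕ (range K) (λ x → not (x ≡ᵇ K) ∧∧ 1) ℕ.+ ((not (K ≡ᵇ K) ∧∧ 1) ℕ.+ 0)
          ≡⟨ cong₂ ℕ._+_ (Σℕ-cong (range K) (λ {x} x∈ → cong (λ z → not z ∧∧ 1) (≡ᵇ-< (range-< K x∈)))) (cong (λ z → (not z ∧∧ 1) ℕ.+ 0) (≡ᵇ-refl K)) ⟩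
        Σℕ (range K) (λ _ → 1) ℕ.+ 0 ≡⟨ ℕP.+-identityʳ _ ⟩
        Σℕ (range K) (λ _ → 1) ≡⟨ trans (Σℕ-const (range K) 1) (trans (ℕP.*-identityʳ _) (length-range K)) ⟩
        K ∎

  -- A permutation of the colours takes c to K. Both orderings of the palette are images of `ps`,
  -- where `nothing` is the distinguished colour and `just i` the i-th of the others.
  count-recolour : ∀ V (X : A → Bool) c K → c ≤ K →
    count _≡ᵇ_ (range (suc K)) V (λ w x → not (X w ∧ (c ≡ᵇ x))) ≡ rooted# V X K
  count-recolour V X c K c≤K = begin
    count _≡ᵇ_ (range (suc K)) V ok ≡⟨ count-↭-colours V (range-skip c K c≤K) ⟩
    count _≡ᵇ_ (c ∷ map (skip c) (range K)) V ok ≡⟨ cong (λ z → count _≡ᵇ_ z V ok) (paired c) ⟩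
    count _≡ᵇ_ (map (colour c) ps) V ok ≡⟨ count-relabel (colour c) (colour K) ps (λ {p} {q} _ _ → trans (sameness c p q) (≡-sym (sameness K p q))) V
                                            (λ {w} {p} _ _ → cong (λ z → not (X w ∧ z)) (special p)) ⟩
    count _≡ᵇ_ (map (colour K) ps) V (avoid X K) ≡⟨ cong (λ z → count _≡ᵇ_ z V (avoid X K)) (≡-sym (paired K)) ⟩
    count _≡ᵇ_ (K ∷ map (skip K) (range K)) V (avoid X K) ≡⟨ count-↭-colours V (↭-sym (range-skip K K ℕP.≤-refl)) ⟩
    rooted# V X K ∎
    where
    open ≡-Reasoning
    ok : A → ℕ → Bool
    ok w x = not (X w ∧ (c ≡ᵇ x))
    ps : List (Maybe ℕ)
    ps = nothing ∷ map just (range K)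
    colour : ℕ → Maybe ℕ → ℕ
    colour c nothing  = c
    colour c (just i) = skip c i
    paired : ∀ c → c ∷ map (skip c) (range K) ≡ map (colour c) ps
    paired c = cong (c ∷_) (map-∘ (range K))
    same : Maybe ℕ → Maybe ℕ → Bool
    same nothing  nothing  = true
    same nothing  (just _) = false
    same (just _) nothing  = false
    same (just i) (just j) = i ≡ᵇ j
    sameness : ∀ c p q → (colour c p ≡ᵇ colour c q) ≡ same p q
    sameness c nothing  nothing  = ≡ᵇ-refl c
    sameness c nothing  (just j) = trans (≡ᵇ-sym c (skip c j)) (skip-≢ c j)
    sameness c (just i) nothing  = skip-≢ c i
    sameness c (just i) (just j) = skip-≡ᵇ c i j
    special : ∀ p → (c ≡ᵇ colour c p) ≡ (colour K p ≡ᵇ K)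
    special nothing  = trans (≡ᵇ-refl c) (≡-sym (≡ᵇ-refl K))
    special (just i) = trans (trans (≡ᵇ-sym c (skip c i)) (skip-≢ c i)) (≡-sym (skip-≢ K i))

  -- Once z has colour c, its neighbours must avoid c, in a number of ways independent of c. So z
  -- has K + 1 equivalent choices, like the isolated point, and c may be taken to be K for its
  -- neighbours.
  W-unrooted : ∀ z V X → All (λ w → X w ≡ false) (z ∷ V) → W (z ∷ V) X ≈ W (∗ ∷ V) (adj z)
  W-unrooted z V X (fz All.∷ fs) = W-cong (z ∷ V) (∗ ∷ V) refl λ K → Σℕ-cong (range (suc K)) λ {c} c∈ →
    trans (cong₂ _∧∧_ (free fz c K) (trans (count-cong (range (suc K)) V λ {w} {x} w∈ _ → cong (_∧ _) (free (All.lookup fs w∈) x K))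
            (count-recolour V (adj z) c K (ℕ.s≤s⁻¹ (range-< (suc K) c∈)))))
      (≡-sym (cong₂ _∧∧_ (free (trans (adj-sym z ∗) (∗-isolated z)) c K)
        (count-cong (range (suc K)) V λ {w} {x} _ _ → trans (cong (avoid (adj z) K w x ∧_) (free (∗-isolated w) c x)) (∧-comm _ true))))
    where
    free : ∀ {a} → a ≡ false → ∀ c K → not (a ∧ (c ≡ᵇ K)) ≡ true
    free refl c K = refl

-- Eulerian polynomials

-- Splittings of m + 1 points into two nonempty parts, with both sizes lowered by one. The two
-- leading entries are those in which the newest point is alone.
innerSizes : ℕ → List (ℕ × ℕ)
innerSizes zero    = []
innerSizes (suc m) = (0 , m) ∷ (m , 0) ∷ map (λ (l , r) → suc l , r) (innerSizes m) ++ map (λ (l , r) → l , suc r) (innerSizes m)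

innerSizes-sum : ∀ m → All (λ (l , r) → suc (l ℕ.+ r) ≡ m) (innerSizes m)
innerSizes-sum zero    = All.[]
innerSizes-sum (suc m) = refl All.∷ cong suc (ℕP.+-identityʳ m) All.∷ AllP.++⁺ (AllP.map⁺ (All.map (cong suc) (innerSizes-sum m)))
  (AllP.map⁺ (All.map (λ { {l , r} eq → cong suc (trans (ℕP.+-suc l r) eq) }) (innerSizes-sum m)))

Σˢ-inner : ∀ m (G : ℕ → ℕ → Ser) →
  Σˢ (sizes (suc m)) (λ (l , r) → G l r) ≈ G (suc m) 0 ⊕ G 0 (suc m) ⊕ Σˢ (innerSizes m) (λ (l , r) → G (suc l) (suc r))
Σˢ-inner zero    G = solve 2 (λ a b → a :+ (b :+ con (+ 0)) := a :+ b :+ con (+ 0)) S.refl (G 1 0) (G 0 1)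
Σˢ-inner (suc m) G = S.trans (Σˢ-sizes-suc (suc m) G)
  (S.trans (S.+-cong (Σˢ-inner m (λ l r → G (suc l) r)) (Σˢ-inner m (λ l r → G l (suc r))))
  (S.trans (solve 6 (λ a b c d e f → (a :+ b :+ c) :+ (d :+ e :+ f) := a :+ e :+ (b :+ (d :+ (c :+ f)))) S.refl _ _ _ _ _ _)
  (S.+-cong S.refl (S.+-cong S.refl (S.+-cong S.refl (S.sym (S.trans (Σˢ-++ (map (λ (l , r) → suc l , r) (innerSizes m)) _ _)
    (S.+-cong (Σˢ-map (λ (l , r) → suc l , r) (innerSizes m) _) (Σˢ-map (λ (l , r) → l , suc r) (innerSizes m) _)))))))))

E-1 : E 1 ≈ 𝟙
E-1 = S.trans (E-suc 0) (S.trans (S.+-cong (S.*-cong S.refl (S.+-cong (S.*-cong E-0 E-0) S.refl)) (S.*-cong S.refl E-0))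
  (solve 1 (λ t → t :* (con (+ 1) :* con (+ 1) :+ con (+ 0)) :+ (con (+ 1) :+ :- t) :* con (+ 1) := con (+ 1)) S.refl t))

-- The two splittings with an empty part contribute 2 t E (m+1), which turns the factor 1 - t into 1
-- + t. No negative term remains.
E-inner : ∀ m → E (2 ℕ.+ m) ≈ 1+t ⊛ E (suc m) ⊕ t ⊛ Σˢ (innerSizes m) (λ (l , r) → E (suc l) ⊛ E (suc r))
E-inner m = S.trans (E-suc (suc m)) (S.trans (S.+-cong (S.*-cong S.refl (S.trans (Σˢ-inner m (λ l r → E l ⊛ E r))
    (S.+-cong (S.+-cong (S.*-cong S.refl E-0) (S.*-cong E-0 S.refl)) S.refl))) S.refl)
  (solve 3 (λ t e s → t :* (e :* con (+ 1) :+ con (+ 1) :* e :+ s) :+ (con (+ 1) :+ :- t) :* e := (con (+ 1) :+ t) :* e :+ t :* s)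
    S.refl t (E (suc m)) (Σˢ (innerSizes m) (λ (l , r) → E (suc l) ⊛ E (suc r)))))

E-sym : ∀ m → Sym (m ℕ.∸ 1) (E m)
E-sym m = go m m ℕP.≤-refl
  where
  go : ∀ n m → m ≤ n → Sym (m ℕ.∸ 1) (E m)
  go n zero          _ = resp (S.sym E-0) sym-𝟙
  go n (suc zero)    _ = resp (S.sym E-1) sym-𝟙
  go (suc n) (suc (suc m)) (s≤s le) = resp (S.sym (S.trans (E-inner m) (S.+-cong S.refl (S.trans (S.*-comm t _) (S.sym (Σˢ-⊛ (innerSizes m) _ t))))))
    (plus (sym-⊛ sym-1+t (go n (suc m) le)) (span-Σ (All.map (λ { {l , r} eq → inner l r eq }) (innerSizes-sum m))))
    where
    inner : ∀ l r → suc (l ℕ.+ r) ≡ m → Sym (suc m) (E (suc l) ⊛ E (suc r) ⊛ t)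
    inner l r eq = subst (λ z → Sym z (E (suc l) ⊛ E (suc r) ⊛ t)) (trans (ℕP.+-comm (l ℕ.+ r) 2) (cong suc eq))
      (sym-⊛ (sym-⊛ (go n (suc l) (ℕP.≤-trans (s≤s (ℕP.m≤m+n l r)) (ℕP.≤-trans (ℕP.≤-reflexive eq) (ℕP.≤-trans (ℕP.n≤1+n m) le))))
                    (go n (suc r) (ℕP.≤-trans (s≤s (ℕP.m≤n+m r l)) (ℕP.≤-trans (ℕP.≤-reflexive eq) (ℕP.≤-trans (ℕP.n≤1+n m) le))))) sym-t)

E-cone : ∀ m → Cone (m ℕ.∸ 1) (E m)
E-cone m = sym⇒cone (E-sym m)

-- All splittings but the one with empty right part, whose term has to be isolated in the expansion
-- of `E-product`.
otherSizes : ℕ → List (ℕ × ℕ)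
otherSizes zero    = []
otherSizes (suc m) = map (λ (l , r) → suc l , r) (otherSizes m) ++ map (λ (l , r) → l , suc r) (sizes m)

otherSizes-sum : ∀ m → All (λ (l , r) → l ℕ.+ r ≡ m) (otherSizes m)
otherSizes-sum zero    = All.[]
otherSizes-sum (suc m) = AllP.++⁺ (AllP.map⁺ (All.map (cong suc) (otherSizes-sum m)))
  (AllP.map⁺ (All.map (λ { {l , r} eq → trans (ℕP.+-suc l r) (cong suc eq) }) (sizes-sum m)))

Σˢ-head : ∀ m (G : ℕ → ℕ → Ser) → Σˢ (sizes m) (λ (l , r) → G l r) ≈ G m 0 ⊕ Σˢ (otherSizes m) (λ (l , r) → G l r)
Σˢ-head zero    G = S.refl
Σˢ-head (suc m) G = S.trans (Σˢ-sizes-suc m G) (S.trans (S.+-cong (Σˢ-head m (λ l r → G (suc l) r)) S.refl)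
  (S.trans (S.+-assoc _ _ _) (S.+-cong S.refl (S.sym (S.trans (Σˢ-++ (map (λ (l , r) → suc l , r) (otherSizes m)) _ _)
    (S.+-cong (Σˢ-map (λ (l , r) → suc l , r) (otherSizes m) _) (Σˢ-map (λ (l , r) → l , suc r) (sizes m) _)))))))

Σˢ-flip : ∀ m (G : ℕ → ℕ → Ser) → Σˢ (sizes m) (λ (l , r) → G l r) ≈ Σˢ (sizes m) (λ (l , r) → G r l)
Σˢ-flip zero    G = S.refl
Σˢ-flip (suc m) G = S.trans (Σˢ-sizes-suc m G) (S.trans (S.+-cong (Σˢ-flip m (λ l r → G (suc l) r)) (Σˢ-flip m (λ l r → G l (suc r))))
  (S.trans (S.+-comm _ _) (S.sym (Σˢ-sizes-suc m (flip G)))))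

-- A splitting of l + m points is a splitting of the l points together with one of the m points.
Σˢ-sizes-+ : ∀ l m (G : ℕ → ℕ → Ser) →
  Σˢ (sizes (l ℕ.+ m)) (λ (a , b) → G a b) ≈ Σˢ (sizes m) (λ (r₁ , r₂) → Σˢ (sizes l) (λ (l₁ , l₂) → G (l₁ ℕ.+ r₁) (l₂ ℕ.+ r₂)))
Σˢ-sizes-+ zero    m G = Σˢ-cong (sizes m) λ _ → S.sym (S.+-identityʳ _)
Σˢ-sizes-+ (suc l) m G = S.trans (Σˢ-sizes-suc (l ℕ.+ m) G)
  (S.trans (S.+-cong (Σˢ-sizes-+ l m (λ a b → G (suc a) b)) (Σˢ-sizes-+ l m (λ a b → G a (suc b))))
  (S.trans (S.sym (Σˢ-⊕ (sizes m) _ _)) (Σˢ-cong (sizes m) λ (r₁ , r₂) → S.sym (Σˢ-sizes-suc l (λ l₁ l₂ → G (l₁ ℕ.+ r₁) (l₂ ℕ.+ r₂))))))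

private
  ∸-split : ∀ l r m → l ℕ.+ r ≡ m → m ≤ 2 ℕ.+ ((l ℕ.∸ 1) ℕ.+ (r ℕ.∸ 1))
  ∸-split l r m refl = ℕP.≤-trans (ℕP.+-mono-≤ (below l) (below r)) (ℕP.≤-reflexive (cong suc (ℕP.+-suc (l ℕ.∸ 1) (r ℕ.∸ 1))))
    where
    below : ∀ l → l ≤ suc (l ℕ.∸ 1)
    below zero    = z≤n
    below (suc l) = ℕP.≤-refl

cone-0 : ∀ {c f} → f ≈ 𝟘 → Cone c f
cone-0 eq = resp (S.sym eq) zero

cone-t⊛ : ∀ {c f} → Cone c f → Cone (2 ℕ.+ c) (t ⊛ f)
cone-t⊛ = cone-⊛ (sym⇒cone sym-t)

cone-Σ-t : ∀ {c} {B : Set} {xs : List B} {f} → All (λ x → Cone c (t ⊛ f x)) xs → Cone c (t ⊛ Σˢ xs f)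
cone-Σ-t {xs = xs} {f} ps = resp (S.trans (Σˢ-cong xs λ x → S.*-comm t (f x)) (S.trans (Σˢ-⊛ xs f t) (S.*-comm _ t))) (span-Σ ps)

-- E (l + r) counts the same colourings as E l ⊛ E r without requiring the first l points to
-- precede the others.
E-product : ∀ l r → Cone (l ℕ.+ r ℕ.∸ 2) (E (l ℕ.+ r) ⊝ E l ⊛ E r)
E-product zero    r = cone-0 (S.trans (S.+-cong S.refl (S.-‿cong (S.*-cong E-0 S.refl)))
  (solve 1 (λ e → e :+ :- (con (+ 1) :* e) := con (+ 0)) S.refl (E r)))
E-product (suc l′) r = go r r ℕP.≤-refl
  where
  l = suc l′
  D : ℕ → Ser
  D r = E (l ℕ.+ r) ⊝ E l ⊛ E r
  go : ∀ n r → r ≤ n → Cone (l ℕ.+ r ℕ.∸ 2) (D r)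
  go n zero _ = cone-0 (S.trans (S.+-cong (subst (λ z → E (l ℕ.+ 0) ≈ E z) (ℕP.+-identityʳ l) S.refl) (S.-‿cong (S.*-cong S.refl E-0)))
    (solve 1 (λ e → e :+ :- (e :* con (+ 1)) := con (+ 0)) S.refl (E l)))
  go (suc n) (suc m) (s≤s m≤n) = resp (S.sym expand) (cone-weaken target
      (plus (plus (plus (plus c₁ c₂) c₃) c₄) c₅))
    where
    c = l′ ℕ.+ m
    target : l ℕ.+ suc m ℕ.∸ 2 ≤ c
    target = ℕP.≤-reflexive (cong (ℕ._∸ 1) (ℕP.+-suc l′ m))
    -- In a splitting of l + m points the l points go all to the left, all to the right, or to both
    -- sides. From the first case E l ⊛ E r₁ ⊛ E r₂ is subtracted; the terms r₁ = m of the first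
    -- case and r₁ = 0 of the second are set apart and yield (1+t) D m and t E l E m.
    A₁ A₂ A₃ : Ser
    A₁ = Σˢ (otherSizes m) (λ (r₁ , r₂) → D r₁ ⊛ E r₂)
    A₂ = Σˢ (otherSizes m) (λ (r₂ , r₁) → E r₁ ⊛ E (l ℕ.+ r₂))
    A₃ = Σˢ (sizes m) (λ (r₁ , r₂) → Σˢ (innerSizes l′) (λ (l₁ , l₂) → E (suc l₁ ℕ.+ r₁) ⊛ E (suc l₂ ℕ.+ r₂)))
    ih : ∀ r → r ≤ m → Cone (l ℕ.+ r ℕ.∸ 2) (D r)
    ih r le = go n r (ℕP.≤-trans le m≤n)
    c₁ : Cone c (1+t ⊛ D m)
    c₁ = cone-weaken (below (l′ ℕ.+ m)) (cone-⊛ (sym⇒cone sym-1+t) (ih m ℕP.≤-refl))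
      where
      below : ∀ x → x ≤ suc (x ℕ.∸ 1)
      below zero    = z≤n
      below (suc x) = ℕP.≤-refl
    c₂ : Cone c (t ⊛ (E l ⊛ E m))
    c₂ = cone-weaken (ℕP.≤-trans (ℕP.n≤1+n c) (∸-split l m (l ℕ.+ m) refl)) (cone-t⊛ (cone-⊛ (E-cone l) (E-cone m)))
    c₃ : Cone c (t ⊛ A₁)
    c₃ = cone-Σ-t (All.map (λ { {r₁ , r₂} eq → cone-weaken (bound r₁ r₂ eq)
           (cone-t⊛ (cone-⊛ (ih r₁ (ℕP.≤-trans (ℕP.m≤m+n r₁ r₂) (ℕP.≤-reflexive eq))) (E-cone r₂))) }) (otherSizes-sum m))
      where
      bound : ∀ r₁ r₂ → r₁ ℕ.+ r₂ ≡ m → c ≤ 2 ℕ.+ ((l ℕ.+ r₁ ℕ.∸ 2) ℕ.+ (r₂ ℕ.∸ 1))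
      bound r₁ r₂ refl = ℕP.≤-trans (ℕP.≤-reflexive (≡-sym (ℕP.+-assoc l′ r₁ r₂))) (∸-split (l′ ℕ.+ r₁) r₂ _ refl)
    c₄ : Cone c (t ⊛ A₂)
    c₄ = cone-Σ-t (All.map (λ { {r₂ , r₁} eq → cone-weaken (bound r₁ r₂ eq) (cone-t⊛ (cone-⊛ (E-cone r₁) (E-cone (l ℕ.+ r₂)))) }) (otherSizes-sum m))
      where
      bound : ∀ r₁ r₂ → r₂ ℕ.+ r₁ ≡ m → c ≤ 2 ℕ.+ ((r₁ ℕ.∸ 1) ℕ.+ (l ℕ.+ r₂ ℕ.∸ 1))
      bound r₁ r₂ refl = ℕP.≤-trans (ℕP.n≤1+n _) (∸-split r₁ (l ℕ.+ r₂) _ (rearr r₁ l′ r₂))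
        where
        rearr : ∀ r₁ l r₂ → r₁ ℕ.+ (suc l ℕ.+ r₂) ≡ suc (l ℕ.+ (r₂ ℕ.+ r₁))
        rearr = solve-∀
    c₅ : Cone c (t ⊛ A₃)
    c₅ = cone-Σ-t (All.map (λ { {r₁ , r₂} eq → cone-Σ-t (All.map (λ { {l₁ , l₂} eq′ → cone-weaken (bound r₁ r₂ l₁ l₂ eq eq′)
           (cone-t⊛ (cone-⊛ (E-cone (suc l₁ ℕ.+ r₁)) (E-cone (suc l₂ ℕ.+ r₂)))) }) (innerSizes-sum l′)) }) (sizes-sum m))
      where
      bound : ∀ r₁ r₂ l₁ l₂ → r₁ ℕ.+ r₂ ≡ m → suc (l₁ ℕ.+ l₂) ≡ l′ → c ≤ 2 ℕ.+ ((l₁ ℕ.+ r₁) ℕ.+ (l₂ ℕ.+ r₂))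
      bound r₁ r₂ l₁ l₂ refl refl = ℕP.≤-trans (ℕP.≤-reflexive (rearr l₁ l₂ r₁ r₂)) (ℕP.n≤1+n _)
        where
        rearr : ∀ l₁ l₂ r₁ r₂ → suc (l₁ ℕ.+ l₂) ℕ.+ (r₁ ℕ.+ r₂) ≡ suc ((l₁ ℕ.+ r₁) ℕ.+ (l₂ ℕ.+ r₂))
        rearr = solve-∀
    sum₁ : Σˢ (sizes (l ℕ.+ m)) (λ (a , b) → E a ⊛ E b) ≈
      Σˢ (sizes m) (λ (r₁ , r₂) → E (l ℕ.+ r₁) ⊛ E r₂) ⊕ (E (l ℕ.+ m) ⊕ A₂) ⊕ A₃
    sum₁ = S.trans (Σˢ-sizes-+ l m (λ a b → E a ⊛ E b))
      (S.trans (Σˢ-cong (sizes m) λ (r₁ , r₂) → Σˢ-inner l′ (λ l₁ l₂ → E (l₁ ℕ.+ r₁) ⊛ E (l₂ ℕ.+ r₂)))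
      (S.trans (Σˢ-⊕ (sizes m) _ _) (S.+-cong (S.trans (Σˢ-⊕ (sizes m) _ _) (S.+-cong S.refl
        (S.trans (Σˢ-flip m (λ r₁ r₂ → E r₁ ⊛ E (l ℕ.+ r₂))) (S.trans (Σˢ-head m (λ r₂ r₁ → E r₁ ⊛ E (l ℕ.+ r₂)))
          (S.+-cong (S.trans (S.*-cong E-0 S.refl) (S.*-identityˡ _)) S.refl))))) S.refl)))
    sum₂ : Σˢ (sizes m) (λ (r₁ , r₂) → E (l ℕ.+ r₁) ⊛ E r₂) ≈ (D m ⊕ A₁) ⊕ E l ⊛ Σˢ (sizes m) (λ (r₁ , r₂) → E r₁ ⊛ E r₂)
    sum₂ = S.trans (Σˢ-cong (sizes m) λ (r₁ , r₂) → solve 4 (λ x y z w → x :* w := (x :+ :- (y :* z)) :* w :+ (z :* w) :* y) S.refl (E (l ℕ.+ r₁)) (E l) (E r₁) (E r₂))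
      (S.trans (Σˢ-⊕ (sizes m) _ _) (S.+-cong (S.trans (Σˢ-head m (λ r₁ r₂ → D r₁ ⊛ E r₂)) (S.+-cong (S.trans (S.*-cong S.refl E-0) (S.*-identityʳ _)) S.refl))
        (S.trans (Σˢ-⊛ (sizes m) _ (E l)) (S.*-comm _ (E l)))))
    expand : D (suc m) ≈ 1+t ⊛ D m ⊕ t ⊛ (E l ⊛ E m) ⊕ t ⊛ A₁ ⊕ t ⊛ A₂ ⊕ t ⊛ A₃
    expand = S.trans (S.+-cong
        (S.trans (subst (λ z → E (l ℕ.+ suc m) ≈ E z) (ℕP.+-suc l m) S.refl)
          (S.trans (E-suc (l ℕ.+ m)) (S.+-cong (S.*-cong S.refl (S.trans sum₁ (S.+-cong (S.+-cong sum₂ S.refl) S.refl))) S.refl)))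
        (S.-‿cong (S.*-cong S.refl (E-suc m))))
      (solve 8 (λ t elm el em a₁ a₂ a₃ q →
          (t :* ((((elm :+ :- (el :* em)) :+ a₁) :+ el :* q) :+ (elm :+ a₂) :+ a₃) :+ (con (+ 1) :+ :- t) :* elm)
            :+ :- (el :* (t :* q :+ (con (+ 1) :+ :- t) :* em))
          := (con (+ 1) :+ t) :* (elm :+ :- (el :* em)) :+ t :* (el :* em) :+ t :* a₁ :+ t :* a₂ :+ t :* a₃)
        S.refl t (E (l ℕ.+ m)) (E l) (E m) A₁ A₂ A₃ (Σˢ (sizes m) (λ (r₁ , r₂) → E r₁ ⊛ E r₂)))

-- Systems of rooted graphs

-- The condition i + i ≤ δ stands for i ≤ δ/2. Past the middle coefficients may be negative, and
-- `value` is unconstrained there.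
record MacaulayUpTo (δ : ℕ) (f : Ser) : Set where
  field
    value   : ℕ → ℕ
    coeff≡  : ∀ i → i ℕ.+ i ≤ δ → coeff f i ≡ + value i
    value-0 : value 0 ≡ 1
    grows   : ∀ i → (2 ℕ.+ i) ℕ.+ (2 ℕ.+ i) ≤ δ → value (2 ℕ.+ i) ≤ macaulay i (value (1 ℕ.+ i))
open MacaulayUpTo

macaulay-resp : ∀ {δ f g} → f ≈ g → MacaulayUpTo δ f → MacaulayUpTo δ g
macaulay-resp e M = record { value = value M ; coeff≡ = λ i le → trans (≡-sym (at e i)) (coeff≡ M i le) ; value-0 = value-0 M ; grows = grows M }

private
  double-pred : ∀ i {δ δ′} → suc i ℕ.+ suc i ≤ δ → δ ≤ 2 ℕ.+ δ′ → i ℕ.+ i ≤ δ′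
  double-pred i le le′ = ℕP.+-cancelˡ-≤ 2 _ _ (ℕP.≤-trans (ℕP.≤-reflexive (cong suc (≡-sym (ℕP.+-suc i i)))) (ℕP.≤-trans le le′))

-- Macaulay's inequalities for q + t p, where the degree-i part of p has to fit below that of
-- q + t p itself: this is an order ideal whose members divisible by a new variable x are x P.
macaulay-⊕ : ∀ {δ δ′ q p} → δ ≤ 2 ℕ.+ δ′ → MacaulayUpTo δ q → MacaulayUpTo δ′ p →
  (∀ i → suc i ℕ.+ suc i ≤ δ → + 0 ℤ.≤ coeff (q ⊝ 1-t ⊛ p) i) → MacaulayUpTo δ (q ⊕ t ⊛ p)
macaulay-⊕ {δ} {δ′} {q} {p} δ≤ Q P fits = record
  { value = v ; coeff≡ = v-coeff ; value-0 = value-0 Q ; grows = v-grows }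
  where
  g = value Q
  k = value P
  v : ℕ → ℕ
  v zero    = g 0
  v (suc i) = g (suc i) ℕ.+ k i
  v-coeff : ∀ i → i ℕ.+ i ≤ δ → coeff (q ⊕ t ⊛ p) i ≡ + v i
  v-coeff zero    le = trans (⊕-coeff q (t ⊛ p) 0) (trans (cong₂ ℤ._+_ (coeff≡ Q 0 le) (t⊛-coeff-0 p)) (ℤP.+-identityʳ _))
  v-coeff (suc i) le = trans (⊕-coeff q (t ⊛ p) (suc i)) (cong₂ ℤ._+_ (coeff≡ Q (suc i) le) (trans (t⊛-coeff-suc p i) (coeff≡ P i (double-pred i le δ≤))))
  half : ∀ i → suc i ℕ.+ suc i ≤ δ → i ℕ.+ i ≤ δ
  half i = ℕP.≤-trans (ℕP.+-mono-≤ (ℕP.n≤1+n i) (ℕP.n≤1+n i))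
  fits-suc : ∀ i → suc (suc i) ℕ.+ suc (suc i) ≤ δ → k (suc i) ≤ g (suc i) ℕ.+ k i
  fits-suc i le = ℤP.drop‿+≤+ (ℤP.≤-trans (ℤP.≤-reflexive (≡-sym (ℤP.+-identityˡ _))) (ℤP.≤-trans
    (ℤP.+-monoˡ-≤ (+ k (suc i)) (fits (suc i) le)) (ℤP.≤-reflexive (trans (cong (ℤ._+ + k (suc i)) here′) (cancel (+ g (suc i)) (+ k (suc i)) (+ k i))))))
    where
    cancel : ∀ a b c → a ℤ.- (b ℤ.- c) ℤ.+ b ≡ a ℤ.+ c
    cancel = ℤ-solve-∀
    le′ = double-pred (suc i) le δ≤
    here′ : coeff (q ⊝ 1-t ⊛ p) (suc i) ≡ + g (suc i) ℤ.- (+ k (suc i) ℤ.- + k i)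
    here′ = trans (⊝-coeff q (1-t ⊛ p) (suc i)) (cong₂ ℤ._-_ (coeff≡ Q (suc i) (half (suc i) le))
      (trans (1-t⊛-coeff-suc p i) (cong₂ ℤ._-_ (coeff≡ P (suc i) le′) (coeff≡ P i (ℕP.≤-trans (ℕP.+-mono-≤ (ℕP.n≤1+n i) (ℕP.n≤1+n i)) le′)))))
  v-grows : ∀ i → (2 ℕ.+ i) ℕ.+ (2 ℕ.+ i) ≤ δ → v (2 ℕ.+ i) ≤ macaulay i (v (1 ℕ.+ i))
  -- From g 1 to g 1 + 1 the function `multiset# 2` rises by g 1 + 1, which is the bound on k 1
  -- because k 0 = 1.
  v-grows zero le = begin
    g 2 ℕ.+ k 1                        ≤⟨ ℕP.+-mono-≤ (grows Q 0 le) (fits-suc 0 le) ⟩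
    multiset# 2 (g 1) ℕ.+ (g 1 ℕ.+ k 0) ≡⟨ cong (λ z → multiset# 2 (g 1) ℕ.+ (g 1 ℕ.+ z)) (value-0 P) ⟩
    multiset# 2 (g 1) ℕ.+ (g 1 ℕ.+ 1)  ≡⟨ cong (multiset# 2 (g 1) ℕ.+_) (ℕP.+-comm (g 1) 1) ⟩
    multiset# 2 (g 1) ℕ.+ suc (g 1)    ≡⟨ ≡-sym (multiset#-2-suc (g 1)) ⟩
    multiset# 2 (suc (g 1))            ≡⟨ cong (multiset# 2) (trans (ℕP.+-comm 1 (g 1)) (cong (g 1 ℕ.+_) (≡-sym (value-0 P)))) ⟩
    multiset# 2 (g 1 ℕ.+ k 0)          ∎ where open ℕP.≤-Reasoning
  -- x = k (2 + j) meets both bounds of `Gain`: the cap a + b by `fits-suc`, the other by Macaulay's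
  -- inequality for p.
  v-grows (suc j) le = ℕP.≤-trans (ℕP.+-monoˡ-≤ (k (2 ℕ.+ j)) (grows Q (suc j) le))
    (macaulay-gain j (g (2 ℕ.+ j)) (k (1 ℕ.+ j)) (k (2 ℕ.+ j)) (fits-suc (suc j) le) (grows P j (double-pred (2 ℕ.+ j) le δ≤)))

macaulay-≥0 : ∀ {δ f} → f ≈ 𝟘 ⊎ MacaulayUpTo δ f → ∀ i → i ℕ.+ i ≤ δ → + 0 ℤ.≤ coeff f i
macaulay-≥0 (inj₁ z) i le = ℤP.≤-reflexive (≡-sym (trans (at z i) (𝟘-coeff i)))
macaulay-≥0 (inj₂ M) i le = subst (+ 0 ℤ.≤_) (≡-sym (coeff≡ M i le)) (ℤ.+≤+ z≤n)

-- The summands are added one by one. It is enough that each fits below q₀: what has been added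
-- before is nonnegative in the relevant degrees and only makes more room.
macaulay-Σ : ∀ {δ δ₁} {B : Set} (xs : List B) (δ′ : B → ℕ) (p : B → Ser) {q₀} → δ ≤ 2 ℕ.+ δ₁ →
  MacaulayUpTo δ q₀ →
  All (λ x → δ₁ ≤ δ′ x × (p x ≈ 𝟘 ⊎ MacaulayUpTo (δ′ x) (p x)) × (∀ i → suc i ℕ.+ suc i ≤ δ → + 0 ℤ.≤ coeff (q₀ ⊝ 1-t ⊛ p x) i)) xs →
  MacaulayUpTo δ (q₀ ⊕ t ⊛ Σˢ xs p)
macaulay-Σ [] δ′ p {q₀} δ≤ M All.[] = macaulay-resp (solve 2 (λ q t → q := q :+ t :* con (+ 0)) S.refl q₀ t) M
macaulay-Σ {δ} {δ₁} (x ∷ xs) δ′ p {q₀} δ≤ M ((δ₁≤ , alt , fits) All.∷ rest) = add alt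
  where
  Q = q₀ ⊕ t ⊛ Σˢ xs p
  M′ : MacaulayUpTo δ Q
  M′ = macaulay-Σ xs δ′ p δ≤ M rest
  reorder : Q ⊕ t ⊛ p x ≈ q₀ ⊕ t ⊛ Σˢ (x ∷ xs) p
  reorder = solve 4 (λ q t a b → q :+ t :* a :+ t :* b := q :+ t :* (b :+ a)) S.refl q₀ t (Σˢ xs p) (p x)
  earlier : ∀ {ys} → All (λ y → δ₁ ≤ δ′ y × (p y ≈ 𝟘 ⊎ MacaulayUpTo (δ′ y) (p y)) × (∀ i → suc i ℕ.+ suc i ≤ δ → + 0 ℤ.≤ coeff (q₀ ⊝ 1-t ⊛ p y) i)) ys →
    ∀ i → i ℕ.+ i ≤ δ₁ → + 0 ℤ.≤ coeff (Σˢ ys p) i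
  earlier All.[] i le = ℤP.≤-reflexive (≡-sym (𝟘-coeff i))
  earlier {y ∷ ys} ((b , a , _) All.∷ as) i le = subst (+ 0 ℤ.≤_) (≡-sym (⊕-coeff (p y) (Σˢ ys p) i))
    (ℤP.+-mono-≤ (macaulay-≥0 a i (ℕP.≤-trans le b)) (earlier as i le))
  t-earlier : ∀ i → suc i ℕ.+ suc i ≤ δ → + 0 ℤ.≤ coeff (t ⊛ Σˢ xs p) i
  t-earlier zero    le = ℤP.≤-reflexive (≡-sym (t⊛-coeff-0 (Σˢ xs p)))
  t-earlier (suc i) le = subst (+ 0 ℤ.≤_) (≡-sym (t⊛-coeff-suc (Σˢ xs p) i))
    (earlier rest i (double-pred i (ℕP.≤-trans (ℕP.+-mono-≤ (ℕP.n≤1+n (suc i)) (ℕP.n≤1+n (suc i))) le) δ≤))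
  fits′ : ∀ i → suc i ℕ.+ suc i ≤ δ → + 0 ℤ.≤ coeff (Q ⊝ 1-t ⊛ p x) i
  fits′ i le = subst (+ 0 ℤ.≤_) (trans (≡-sym (⊕-coeff (q₀ ⊝ 1-t ⊛ p x) (t ⊛ Σˢ xs p) i))
      (at (solve 3 (λ q a b → (q :+ :- a) :+ b := (q :+ b) :+ :- a) S.refl q₀ (1-t ⊛ p x) (t ⊛ Σˢ xs p)) i))
    (ℤP.+-mono-≤ (fits i le) (t-earlier i le))
  add : p x ≈ 𝟘 ⊎ MacaulayUpTo (δ′ x) (p x) → MacaulayUpTo δ (q₀ ⊕ t ⊛ Σˢ (x ∷ xs) p)
  add (inj₂ P) = macaulay-resp reorder (macaulay-⊕ (ℕP.≤-trans δ≤ (ℕP.+-monoʳ-≤ 2 δ₁≤)) M′ P fits′)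
  add (inj₁ z) = macaulay-resp (S.trans (S.trans (solve 2 (λ q t → q := q :+ t :* con (+ 0)) S.refl Q t)
    (S.+-cong S.refl (S.*-cong S.refl (S.sym z)))) reorder) M′

Divisible : ℕ → Ser → Set
Divisible c f = Σ Ser λ I → Cone c I × f ≈ 1-t ⊛ I

divisible-Σ : ∀ {c} {B : Set} {xs : List B} {f} → All (λ x → Divisible c (f x)) xs → Divisible c (Σˢ xs f)
divisible-Σ All.[] = 𝟘 , zero , S.sym (S.zeroʳ 1-t)
divisible-Σ ((I , cI , e) All.∷ ds) with divisible-Σ ds
... | J , cJ , e′ = I ⊕ J , plus cI cJ , S.trans (S.+-cong e e′) (S.sym (S.distribˡ 1-t I J))

-- The induction over systems

module Systems {A : Set} (adj : A → A → Bool) (adj-sym : ∀ u v → adj u v ≡ adj v u)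
  (∗ : A) (∗-isolated : ∀ v → adj ∗ v ≡ false) where

  open Colourings adj adj-sym using (edgeFree)
  open RootedColourings adj adj-sym ∗ ∗-isolated

  record Extract (P : A → Set) (V : List A) : Set where
    constructor extract
    field
      {element} : A
      {others}  : List A
      perm      : V ↭ element ∷ others
      holds     : P element

  search : ∀ (X : A → Bool) V → Extract (λ v → X v ≡ true) V ⊎ All (λ v → X v ≡ false) V
  search X [] = inj₂ All.[]
  search X (v ∷ V) with X v in eq
  ... | true = inj₁ (extract Perm.refl eq)
  ... | false with search X V
  ...   | inj₁ (extract p h) = inj₁ (extract (↭-trans (Perm.prep v p) (Perm.swap v _ Perm.refl)) h)
  ...   | inj₂ fs = inj₂ (eq All.∷ fs)

  searchEdge : ∀ V → (∃ λ z → ∃ λ u → ∃ λ V′ → V ↭ z ∷ u ∷ V′ × adj z u ≡ true) ⊎ edgeFree V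
  searchEdge [] = inj₂ AllPairs.[]
  searchEdge (z ∷ V) with search (adj z) V
  ... | inj₁ (extract p h) = inj₁ (z , _ , _ , Perm.prep z p , h)
  ... | inj₂ fs with searchEdge V
  ...   | inj₂ ef = inj₂ (fs AllPairs.∷ ef)
  ...   | inj₁ (y , u , V′ , p , h) = inj₁ (y , u , z ∷ V′ , ↭-trans (Perm.prep z p)
            (↭-trans (Perm.swap z y Perm.refl) (Perm.prep y (Perm.swap z u Perm.refl))) , h)

  record Active (V : List A) (X : A → Bool) : Set where
    constructor active
    field
      {root}   : A
      {others} : List A
      {X′}     : A → Bool
      rooted   : X′ root ≡ true
      length≡  : length V ≡ suc (length others)
      W≈       : W V X ≈ W (root ∷ others) X′

  -- A vertex of V in X can serve as it is. Otherwise an edge z u is sought: trading z for an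
  -- isolated point makes `adj z` the avoiding set, and this contains u. Without edges W is
  -- Eulerian.
  classify : ∀ V X → Active V X ⊎ W V X ≈ E (length V)
  classify V X with search X V
  ... | inj₁ (extract {v} {V′} p h) = inj₁ (active {root = v} {V′} {X} h (↭-length p) (W-↭ X p))
  ... | inj₂ fs with searchEdge V
  ...   | inj₂ ef = inj₂ (W-edgeFree V X ef fs)
  ...   | inj₁ (z , u , V′ , p , h) = inj₁ (active {root = u} {∗ ∷ V′} {adj z} h (↭-length p)
            (S.trans (W-↭ X p) (S.trans (W-unrooted z (u ∷ V′) X (All-resp-↭ p fs)) (W-↭ (adj z) (Perm.swap ∗ u (Perm.refl {xs = V′}))))))

  private
    pred-sum : ∀ l r → l ℕ.+ r ≤ 2 ℕ.+ ((l ℕ.∸ 1) ℕ.+ (r ℕ.∸ 1))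
    pred-sum zero    zero    = z≤n
    pred-sum zero    (suc r) = s≤s (ℕP.n≤1+n r)
    pred-sum (suc l) zero    = s≤s (ℕP.n≤1+n _)
    pred-sum (suc l) (suc r) = ℕP.≤-reflexive (cong suc (ℕP.+-suc l r))

  -- The factor t moves the bound up by 2, which pays for the decrements in both |L| - 1 and |R| -
  -- 1.
  W-cone : ∀ V X → Cone (length V ℕ.∸ 1) (W V X)
  W-cone V X = go (length V) V X ℕP.≤-refl
    where
    go : ∀ n V X → length V ≤ n → Cone (length V ℕ.∸ 1) (W V X)
    go zero    [] X _ = resp (S.sym (W-[] X)) (sym⇒cone sym-𝟙)
    go (suc n) V  X le with classify V X
    ... | inj₂ free = resp (S.sym free) (E-cone (length V))
    ... | inj₁ (active {v} {V′} {X′} h len eq) = resp (S.sym (S.trans eq (W-∷ v V′ X′ h)))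
      (subst (λ z → Cone (z ℕ.∸ 1) (t ⊛ Σˢ (splits V′) (λ (L , R) → W L (adj v) ⊛ W R X′))) (≡-sym len)
        (cone-Σ-t (All.map (λ { {L , R} e → cone-weaken (ℕP.≤-trans (ℕP.≤-reflexive (≡-sym e)) (pred-sum (length L) (length R)))
          (cone-t⊛ (cone-⊛ (go n L (adj v) (bound (ℕP.≤-trans (ℕP.m≤m+n (length L) (length R)) (ℕP.≤-reflexive e))))
                           (go n R X′ (bound (ℕP.≤-trans (ℕP.m≤n+m (length R) (length L)) (ℕP.≤-reflexive e)))))) }) (splits-length V′))))
      where
      bound : ∀ {m} → m ≤ length V′ → m ≤ n
      bound m≤ = ℕP.≤-trans m≤ (ℕ.s≤s⁻¹ (ℕP.≤-trans (ℕP.≤-reflexive (≡-sym len)) le))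

  System : Set
  System = List (List A × (A → Bool))

  ΠE ΠW difference : System → Ser
  ΠE []            = 𝟙
  ΠE ((V , X) ∷ 𝒱) = E (length V) ⊛ ΠE 𝒱
  ΠW []            = 𝟙
  ΠW ((V , X) ∷ 𝒱) = W V X ⊛ ΠW 𝒱
  difference 𝒱 = ΠE 𝒱 ⊝ ΠW 𝒱

  -- `dim` is the degree of the palindromic polynomial ΠE; `size` is the measure for the induction.
  dim size : System → ℕ
  dim []             = 0
  dim ((V , _) ∷ 𝒱)  = (length V ℕ.∸ 1) ℕ.+ dim 𝒱
  size []            = 0
  size ((V , _) ∷ 𝒱) = length V ℕ.+ size 𝒱

  ΠE-sym : ∀ 𝒱 → Sym (dim 𝒱) (ΠE 𝒱)
  ΠE-sym []            = sym-𝟙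
  ΠE-sym ((V , _) ∷ 𝒱) = sym-⊛ (E-sym (length V)) (ΠE-sym 𝒱)

  ΠW-cone : ∀ 𝒱 → Cone (dim 𝒱) (ΠW 𝒱)
  ΠW-cone []            = sym⇒cone sym-𝟙
  ΠW-cone ((V , X) ∷ 𝒱) = cone-⊛ (W-cone V X) (ΠW-cone 𝒱)

  record ActiveSystem (𝒱 : System) : Set where
    constructor activeSystem
    field
      {root}   : A
      {others} : List A
      {X′}     : A → Bool
      {rest}   : System
      rooted   : X′ root ≡ true
      dim≡     : dim 𝒱 ≡ length others ℕ.+ dim rest
      size≡    : size 𝒱 ≡ suc (length others ℕ.+ size rest)
      ΠE≈      : ΠE 𝒱 ≈ E (suc (length others)) ⊛ ΠE rest
      ΠW≈      : ΠW 𝒱 ≈ W (root ∷ others) X′ ⊛ ΠW rest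

  private
    swap+ : ∀ a b c → a ℕ.+ (b ℕ.+ c) ≡ b ℕ.+ (a ℕ.+ c)
    swap+ = solve-∀
    swap⊛ : ∀ a b c → a ⊛ (b ⊛ c) ≈ b ⊛ (a ⊛ c)
    swap⊛ = solve 3 (λ a b c → a :* (b :* c) := b :* (a :* c)) S.refl

  classifySystem : ∀ 𝒱 → ActiveSystem 𝒱 ⊎ ΠW 𝒱 ≈ ΠE 𝒱
  classifySystem [] = inj₂ S.refl
  classifySystem ((V , X) ∷ 𝒱) with classify V X
  ... | inj₁ (active {v} {V′} {X′} h len eq) = inj₁ (activeSystem {root = v} {V′} {X′} {𝒱} h (cong (λ z → (z ℕ.∸ 1) ℕ.+ dim 𝒱) len) (cong (ℕ._+ size 𝒱) len)
          (S.*-cong (subst (λ z → E (length V) ≈ E z) len S.refl) S.refl) (S.*-cong eq S.refl))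
  ... | inj₂ free with classifySystem 𝒱
  ...   | inj₂ eq = inj₂ (S.*-cong free eq)
  ...   | inj₁ (activeSystem {v} {V′} {X′} {𝓡} h d s e w) = inj₁ (activeSystem {root = v} {V′} {X′} {(V , X) ∷ 𝓡} h
            (trans (cong ((length V ℕ.∸ 1) ℕ.+_) d) (swap+ (length V ℕ.∸ 1) (length V′) (dim 𝓡)))
            (trans (cong (length V ℕ.+_) s) (trans (ℕP.+-suc (length V) _) (cong suc (swap+ (length V) (length V′) (size 𝓡)))))
            (S.trans (S.*-cong S.refl e) (swap⊛ (E (length V)) _ _)) (S.trans (S.*-cong S.refl w) (swap⊛ (W V X) _ _)))

  -- A vanishing difference is an alternative of its own, because an M-vector starts with 1.
  Result : System → Set
  Result 𝒱 = Divisible (dim 𝒱 ℕ.∸ 1) (difference 𝒱) × (difference 𝒱 ≈ 𝟘 ⊎ MacaulayUpTo (dim 𝒱) (difference 𝒱))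

  -- (1 - t) ΠE 𝒱 is itself the difference of a system: isolated points, those of one
  -- nonempty piece all joined to the root.
  record FullyRooted (𝒱 : System) : Set where
    constructor fullyRooted
    field
      {system} : System
      dim≡     : dim system ≡ dim 𝒱
      size≡    : size system ≡ size 𝒱
      diff≈    : difference system ≈ 1-t ⊛ ΠE 𝒱

  free : System → System
  free []            = []
  free ((V , _) ∷ 𝒱) = (replicate (length V) ∗ , λ _ → false) ∷ free 𝒱

  free-dim : ∀ 𝒱 → dim (free 𝒱) ≡ dim 𝒱
  free-dim []            = refl
  free-dim ((V , _) ∷ 𝒱) = cong₂ (λ a b → (a ℕ.∸ 1) ℕ.+ b) (length-replicate (length V)) (free-dim 𝒱)

  free-size : ∀ 𝒱 → size (free 𝒱) ≡ size 𝒱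
  free-size []            = refl
  free-size ((V , _) ∷ 𝒱) = cong₂ ℕ._+_ (length-replicate (length V)) (free-size 𝒱)

  E-replicate : ∀ m → E (length (replicate m ∗)) ≈ E m
  E-replicate m = subst (λ z → E (length (replicate m ∗)) ≈ E z) (length-replicate m) S.refl

  free-ΠE : ∀ 𝒱 → ΠE (free 𝒱) ≈ ΠE 𝒱
  free-ΠE []            = S.refl
  free-ΠE ((V , _) ∷ 𝒱) = S.*-cong (E-replicate (length V)) (free-ΠE 𝒱)

  W-free : ∀ m → W (replicate m ∗) (λ _ → false) ≈ E m
  W-free m = S.trans (W-edgeFree (replicate m ∗) (λ _ → false) (∗-edgeFree m) (All.universal (λ _ → refl) _)) (E-replicate m)

  free-ΠW : ∀ 𝒱 → ΠW (free 𝒱) ≈ ΠE 𝒱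
  free-ΠW []            = S.refl
  free-ΠW ((V , _) ∷ 𝒱) = S.*-cong (W-free (length V)) (free-ΠW 𝒱)

  fullyRoot : ∀ 𝒱 → FullyRooted 𝒱 ⊎ (dim 𝒱 ≡ 0 × ΠE 𝒱 ≈ 𝟙)
  fullyRoot [] = inj₂ (refl , S.refl)
  fullyRoot (([] , X) ∷ 𝒱) with fullyRoot 𝒱
  ... | inj₂ (d , e) = inj₂ (d , S.trans (S.*-cong E-0 e) (S.*-identityˡ 𝟙))
  ... | inj₁ (fullyRooted {𝒰} d s e) = inj₁ (fullyRooted {system = 𝒰} d s (S.trans e (S.*-cong S.refl (S.sym (S.trans (S.*-cong E-0 S.refl) (S.*-identityˡ _))))))
  fullyRoot ((V@(_ ∷ V′) , X) ∷ 𝒱) = inj₁ (fullyRooted {system = (replicate (length V) ∗ , λ _ → true) ∷ free 𝒱}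
    (free-dim ((V , X) ∷ 𝒱)) (free-size ((V , X) ∷ 𝒱))
    (S.trans (S.+-cong (free-ΠE ((V , X) ∷ 𝒱)) (S.-‿cong (S.*-cong (W-∗-full (length V′)) (free-ΠW 𝒱))))
      (solve 3 (λ t a b → a :* b :+ :- ((t :* a) :* b) := (con (+ 1) :+ :- t) :* (a :* b)) S.refl t (E (length V)) (ΠE 𝒱))))

  E-coeff-0 : ∀ m → coeff (E m) 0 ≡ + 1
  E-coeff-0 zero          = trans (at E-0 0) (𝕔-coeff (+ 1) 0)
  E-coeff-0 (suc m) = trans (at (E-suc m) 0) (trans (⊕-coeff _ _ 0) (trans (cong₂ ℤ._+_ (t⊛-coeff-0 _) (trans (1-t⊛-coeff-0 (E m)) (E-coeff-0 m))) refl))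

  ΠE-coeff-0 : ∀ 𝒱 → coeff (ΠE 𝒱) 0 ≡ + 1
  ΠE-coeff-0 []            = 𝕔-coeff (+ 1) 0
  ΠE-coeff-0 ((V , _) ∷ 𝒱) = trans (⊛-coeff (E (length V)) (ΠE 𝒱) 0) (cong₂ ℤ._*_ (E-coeff-0 (length V)) (ΠE-coeff-0 𝒱))

  -- The fully rooted system reaches degrees i with 2 i ≤ dim 𝒱. One more may be asked for, with 2 i
  -- = dim 𝒱 + 1; there the coefficient of (1 - t) ΠE is the difference of the two equal middle
  -- coefficients of ΠE, so the default value 0 is correct.
  macaulay-base : ∀ 𝒱 {δ} → δ ≤ suc (dim 𝒱) → (∀ 𝒰 → size 𝒰 ≤ size 𝒱 → Result 𝒰) → MacaulayUpTo δ (1-t ⊛ ΠE 𝒱)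
  macaulay-base 𝒱 {δ} δ≤ ih with fullyRoot 𝒱
  ... | inj₂ (d , e) = record
    { value = λ _ → 1
    ; coeff≡ = λ { zero _ → trans (1-t⊛-coeff-0 (ΠE 𝒱)) (ΠE-coeff-0 𝒱) ; (suc i) le → ⊥-elim (absurd i (ℕP.≤-trans le δ≤1)) }
    ; value-0 = refl
    ; grows = λ i le → ⊥-elim (absurd (suc i) (ℕP.≤-trans le δ≤1)) }
    where
    δ≤1 : δ ≤ 1
    δ≤1 = ℕP.≤-trans δ≤ (s≤s (ℕP.≤-reflexive d))
    absurd : ∀ i → suc i ℕ.+ suc i ≤ 1 → ⊥
    absurd i (s≤s le) = ℕP.<-irrefl refl (ℕP.≤-trans (ℕP.m≤n+m 1 i) (ℕP.≤-trans (ℕP.+-monoʳ-≤ i (s≤s z≤n)) le))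
  ... | inj₁ (fullyRooted {𝒰} d s e) with proj₂ (ih 𝒰 (ℕP.≤-reflexive s))
  ...   | inj₁ z = ⊥-elim (1≢0 (trans (≡-sym (trans (1-t⊛-coeff-0 (ΠE 𝒱)) (ΠE-coeff-0 𝒱))) (trans (≡-sym (at e 0)) (trans (at z 0) (𝟘-coeff 0)))))
    where
    1≢0 : + 1 ≡ + 0 → ⊥
    1≢0 ()
  ...   | inj₂ M = record { value = v ; coeff≡ = v-coeff ; value-0 = trans (v-in 0 z≤n) (value-0 M) ; grows = v-grows }
    where
    v : ℕ → ℕ
    v i with i ℕ.+ i ℕ.≤? dim 𝒰
    ... | yes _ = value M i
    ... | no  _ = 0
    v-in : ∀ i → i ℕ.+ i ≤ dim 𝒰 → v i ≡ value M i
    v-in i le with i ℕ.+ i ℕ.≤? dim 𝒰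
    ... | yes _ = refl
    ... | no ¬p = ⊥-elim (¬p le)
    v-coeff : ∀ i → i ℕ.+ i ≤ δ → coeff (1-t ⊛ ΠE 𝒱) i ≡ + v i
    v-coeff i le with i ℕ.+ i ℕ.≤? dim 𝒰
    ... | yes p = trans (≡-sym (at e i)) (coeff≡ M i p)
    ... | no ¬p = beyond i le ¬p
      where
      beyond : ∀ i → i ℕ.+ i ≤ δ → (i ℕ.+ i ≤ dim 𝒰 → ⊥) → coeff (1-t ⊛ ΠE 𝒱) i ≡ + 0
      beyond zero    le ¬p = ⊥-elim (¬p z≤n)
      beyond (suc i) le ¬p = trans (1-t⊛-coeff-suc (ΠE 𝒱) i) (trans (cong (ℤ._- coeff (ΠE 𝒱) i)
        (≡-sym (sym-coeff (ΠE-sym 𝒱) i (suc i) (ℕP.≤-antisym (ℕ.s≤s⁻¹ (ℕP.≤-trans le δ≤))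
          (ℕP.≤-trans (ℕP.≤-reflexive (≡-sym d)) (ℕ.s≤s⁻¹ (ℕP.≰⇒> ¬p))))))) (ℤP.+-inverseʳ (coeff (ΠE 𝒱) i)))
    v-grows : ∀ i → (2 ℕ.+ i) ℕ.+ (2 ℕ.+ i) ≤ δ → v (2 ℕ.+ i) ≤ macaulay i (v (1 ℕ.+ i))
    v-grows i le with (2 ℕ.+ i) ℕ.+ (2 ℕ.+ i) ℕ.≤? dim 𝒰
    ... | no  _ = z≤n
    ... | yes p = ℕP.≤-trans (grows M i p) (ℕP.≤-reflexive (cong (macaulay i) (≡-sym (v-in (1 ℕ.+ i)
            (ℕP.≤-trans (ℕP.+-mono-≤ (ℕP.n≤1+n (1 ℕ.+ i)) (ℕP.n≤1+n (1 ℕ.+ i))) p)))))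

  -- Induction on the number of vertices: `base` and every `piece` have lost the vertex v, and the
  -- fully rooted system used for (1 - t) ΠE base is no larger than `base`.
  result : ∀ n 𝒱 → size 𝒱 ≤ n → Result 𝒱
  result n 𝒱 size≤ with classifySystem 𝒱
  ... | inj₂ eq = (𝟘 , zero , S.trans vanish (S.sym (S.zeroʳ 1-t))) , inj₁ vanish
    where
    vanish : difference 𝒱 ≈ 𝟘
    vanish = S.trans (S.+-cong S.refl (S.-‿cong eq)) (solve 1 (λ a → a :+ :- a := con (+ 0)) S.refl (ΠE 𝒱))
  result zero 𝒱 size≤ | inj₁ (activeSystem _ _ s _ _) = ⊥-elim (ℕP.<-irrefl refl (ℕP.≤-trans (s≤s z≤n) (ℕP.≤-trans (ℕP.≤-reflexive (≡-sym s)) size≤)))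
  result (suc n) 𝒱 size≤ | inj₁ (activeSystem {v} {V′} {X′} {𝓡} h d s e w) =
      (ΠE base ⊕ t ⊛ proj₁ inner , plus baseCone (cone-weaken (pred2 (dim 𝒱) (m+δ)) (cone-t⊛ (proj₁ (proj₂ inner)))) ,
        S.trans expand (S.trans (S.+-cong S.refl (S.*-cong S.refl (proj₂ (proj₂ inner))))
          (solve 3 (λ p a b → (con (+ 1) :+ :- p) :* a :+ p :* ((con (+ 1) :+ :- p) :* b) := (con (+ 1) :+ :- p) :* (a :+ p :* b)) S.refl t (ΠE base) (proj₁ inner))))
    , inj₂ (macaulay-resp (S.sym expand) (macaulay-Σ {δ₁ = dim 𝒱 ℕ.∸ 2} (splits V′) (dim ∘ piece) (difference ∘ piece) {1-t ⊛ ΠE base}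
        (m+δ)
        (macaulay-base base base-δ (λ 𝒰 le → result n 𝒰 (ℕP.≤-trans le base-size)))
        (All.map (λ { {L , R} len → dim≥ L R len , proj₂ (pieceResult L R len) , fits L R len }) (splits-length V′))))
    where
    m = length V′
    base : System
    base = (V′ , X′) ∷ 𝓡
    piece : List A × List A → System
    piece (L , R) = (L , adj v) ∷ (R , X′) ∷ 𝓡
    m+δ : dim 𝒱 ≤ 2 ℕ.+ (dim 𝒱 ℕ.∸ 2)
    m+δ = ℕP.m≤n+m∸n (dim 𝒱) 2
    expand : difference 𝒱 ≈ 1-t ⊛ ΠE base ⊕ t ⊛ Σˢ (splits V′) (difference ∘ piece)
    expand = S.trans (S.+-cong (S.trans e (S.*-cong (S.trans (E-suc m) (S.+-cong (S.*-cong S.refl (S.sym (Σˢ-splits V′ (λ l r → E l ⊛ E r)))) S.refl)) S.refl))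
                               (S.-‿cong (S.trans w (S.*-cong (W-∷ v V′ X′ h) S.refl))))
      (S.trans (solve 6 (λ t a b c x y → (t :* a :+ (con (+ 1) :+ :- t) :* b) :* x :+ :- ((t :* c) :* y) := (con (+ 1) :+ :- t) :* (b :* x) :+ t :* (a :* x :+ :- (c :* y)))
                 S.refl t (Σˢ (splits V′) (λ (L , R) → E (length L) ⊛ E (length R))) (E m) (Σˢ (splits V′) (λ (L , R) → W L (adj v) ⊛ W R X′)) (ΠE 𝓡) (ΠW 𝓡))
        (S.+-cong S.refl (S.*-cong S.refl (S.sym (S.trans (Σˢ-⊕ (splits V′) _ _) (S.+-cong
          (S.trans (Σˢ-cong (splits V′) λ (L , R) → S.sym (S.*-assoc _ _ _)) (Σˢ-⊛ (splits V′) _ (ΠE 𝓡)))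
          (S.trans (Σˢ-⊖ (splits V′) _) (S.-‿cong (S.trans (Σˢ-cong (splits V′) λ (L , R) → S.sym (S.*-assoc _ _ _)) (Σˢ-⊛ (splits V′) _ (ΠW 𝓡)))))))))))
    base-size : size base ≤ n
    base-size = ℕ.s≤s⁻¹ (ℕP.≤-trans (ℕP.≤-reflexive (≡-sym s)) size≤)
    pred≤ : ∀ m → m ≤ suc (m ℕ.∸ 1)
    pred≤ zero    = z≤n
    pred≤ (suc m) = ℕP.≤-refl
    base-δ : dim 𝒱 ≤ suc (dim base)
    base-δ = ℕP.≤-trans (ℕP.≤-reflexive d) (ℕP.+-monoˡ-≤ (dim 𝓡) (pred≤ m))
    baseCone : Cone (dim 𝒱 ℕ.∸ 1) (ΠE base)
    baseCone = cone-weaken (ℕP.∸-monoˡ-≤ 1 base-δ) (sym⇒cone (ΠE-sym base))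
    dim≥′ : ∀ L R → length L ℕ.+ length R ≡ m → dim 𝒱 ≤ 2 ℕ.+ dim (piece (L , R))
    dim≥′ L R len = ℕP.≤-trans (ℕP.≤-reflexive (trans d (cong (ℕ._+ dim 𝓡) (≡-sym len))))
      (ℕP.≤-trans (ℕP.+-monoˡ-≤ (dim 𝓡) (pred-sum (length L) (length R))) (ℕP.≤-reflexive (cong (λ z → suc (suc z)) (ℕP.+-assoc (length L ℕ.∸ 1) (length R ℕ.∸ 1) (dim 𝓡)))))
    dim≥ : ∀ L R → length L ℕ.+ length R ≡ m → dim 𝒱 ℕ.∸ 2 ≤ dim (piece (L , R))
    dim≥ L R len = ℕP.m≤n+o⇒m∸n≤o (dim 𝒱) 2 (dim≥′ L R len)
    pieceResult : ∀ L R → length L ℕ.+ length R ≡ m → Result (piece (L , R))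
    pieceResult L R len = result n (piece (L , R)) (ℕP.≤-trans (ℕP.≤-reflexive (trans (≡-sym (ℕP.+-assoc (length L) (length R) (size 𝓡))) (cong (ℕ._+ size 𝓡) len))) base-size)
    pred2 : ∀ δ {δ′} → δ ≤ 2 ℕ.+ δ′ → δ ℕ.∸ 1 ≤ 2 ℕ.+ (δ′ ℕ.∸ 1)
    pred2 δ {zero}   le = ℕP.≤-trans (ℕP.∸-monoˡ-≤ 1 le) (s≤s z≤n)
    pred2 δ {suc δ′} le = ℕP.∸-monoˡ-≤ 1 le
    inner : Divisible (dim 𝒱 ℕ.∸ 2 ℕ.∸ 1) (Σˢ (splits V′) (difference ∘ piece))
    inner = divisible-Σ (All.map (λ { {L , R} len → let (I , cI , eI) = proj₁ (pieceResult L R len) in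
      I , cone-weaken (ℕP.∸-monoˡ-≤ 1 (dim≥ L R len)) cI , eI }) (splits-length V′))
    -- As E m = E (l + r), the series is 1 - t times (E (l + r) - E l E r) ΠE 𝓡 + ΠW (piece (L ,
    -- R)), whose coefficients do not decrease in the range in question.
    fits : ∀ L R → length L ℕ.+ length R ≡ m → ∀ i → suc i ℕ.+ suc i ≤ dim 𝒱 → + 0 ℤ.≤ coeff (1-t ⊛ ΠE base ⊝ 1-t ⊛ difference (piece (L , R))) i
    fits L R len i le = subst (+ 0 ℤ.≤_) (at regroup i) (cone-1-t-≥0 both i
        (ℕP.≤-trans (ℕP.+-cancelˡ-≤ 2 _ _ (ℕP.≤-trans (ℕP.≤-reflexive (cong suc (≡-sym (ℕP.+-suc i i)))) (ℕP.≤-trans le m+δ))) (ℕP.n≤1+n _)))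
      where
      l = length L
      r = length R
      both : Cone (dim 𝒱 ℕ.∸ 2) ((E (l ℕ.+ r) ⊝ E l ⊛ E r) ⊛ ΠE 𝓡 ⊕ ΠW (piece (L , R)))
      both = plus (cone-weaken small (cone-⊛ (E-product l r) (sym⇒cone (ΠE-sym 𝓡)))) (cone-weaken (dim≥ L R len) (ΠW-cone (piece (L , R))))
        where
        small : dim 𝒱 ℕ.∸ 2 ≤ (l ℕ.+ r ℕ.∸ 2) ℕ.+ dim 𝓡
        small = ℕP.m≤n+o⇒m∸n≤o (dim 𝒱) 2 (ℕP.≤-trans (ℕP.≤-reflexive (trans d (cong (ℕ._+ dim 𝓡) (≡-sym len))))
          (ℕP.+-monoˡ-≤ (dim 𝓡) (ℕP.m≤n+m∸n (l ℕ.+ r) 2)))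
      regroup : 1-t ⊛ ((E (l ℕ.+ r) ⊝ E l ⊛ E r) ⊛ ΠE 𝓡 ⊕ ΠW (piece (L , R))) ≈ 1-t ⊛ ΠE base ⊝ 1-t ⊛ difference (piece (L , R))
      regroup = S.trans (solve 6 (λ p a b c x y → p :* ((a :+ :- (b :* c)) :* x :+ y) := p :* (a :* x) :+ :- (p :* (b :* (c :* x) :+ :- y)))
          S.refl 1-t (E (l ℕ.+ r)) (E l) (E r) (ΠE 𝓡) (ΠW (piece (L , R))))
        (S.+-cong (S.*-cong S.refl (S.*-cong (subst (λ z → E (l ℕ.+ r) ≈ E z) len S.refl) S.refl)) S.refl)

-- The chromatic polynomial

T-antisym : ∀ {a b} → (T a → T b) → (T b → T a) → a ≡ b
T-antisym {true}  {true}  _ _ = refl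
T-antisym {false} {false} _ _ = refl
T-antisym {true}  {false} f _ = ⊥-elim (f tt)
T-antisym {false} {true}  _ g = ⊥-elim (g tt)

∧-left : ∀ {a b} → T (a ∧ b) → T a
∧-left {true} _ = tt

∧-right : ∀ {a b} → T (a ∧ b) → T b
∧-right {true} p = p

∧-pair : ∀ {a b} → T a → T b → T (a ∧ b)
∧-pair {true} _ q = q

and⁻ : ∀ {B : Set} (f : B → Bool) {xs x} → T (and (map f xs)) → x ∈ xs → T (f x)
and⁻ f p (here refl) = ∧-left p
and⁻ f {y ∷ _} p (there x∈) = and⁻ f (∧-right {f y} p) x∈

and⁺ : ∀ {B : Set} (f : B → Bool) xs → (∀ x → T (f x)) → T (and (map f xs))
and⁺ f []       p = tt
and⁺ f (x ∷ xs) p = ∧-pair (p x) (and⁺ f xs p)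

length-filterᵇ : ∀ {B : Set} (P : B → Bool) xs → length (filterᵇ P xs) ≡ Σℕ xs (λ x → P x ∧∧ 1)
length-filterᵇ P [] = refl
length-filterᵇ P (x ∷ xs) with P x
... | true  = cong suc (length-filterᵇ P xs)
... | false = length-filterᵇ P xs

Σℕ-concatMap : ∀ {B C : Set} (f : B → List C) xs g → Σℕ (concatMap f xs) g ≡ Σℕ xs (λ x → Σℕ (f x) g)
Σℕ-concatMap f []       g = refl
Σℕ-concatMap f (x ∷ xs) g = trans (Σℕ-++ (f x) (concatMap f xs) g) (cong (Σℕ (f x) g ℕ.+_) (Σℕ-concatMap f xs g))

module Chromatic {n : ℕ} (G : Graph n) where

  -- The vertices of G together with one isolated point.
  Point : Set
  Point = Maybe (Fin n)

  adj : Point → Point → Bool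
  adj (just u) (just v) = Adj G u v
  adj _        _        = false

  adj-sym : ∀ u v → adj u v ≡ adj v u
  adj-sym (just u) (just v) = Graph.sym G u v
  adj-sym (just _) nothing  = refl
  adj-sym nothing  (just _) = refl
  adj-sym nothing  nothing  = refl

  nothing-isolated : ∀ v → adj nothing v ≡ false
  nothing-isolated _ = refl

  open Colourings adj adj-sym
  open RootedColourings adj adj-sym nothing nothing-isolated
  open Systems adj adj-sym nothing nothing-isolated

  same : ∀ {k} → Fin k → Fin k → Bool
  same x y = ⌊ x Fin.≟ y ⌋

  -- The recursion of `count`, followed along a single colouring.
  sequential : ∀ {m k} → Vec Point m → Vec (Fin k) m → (Point → Fin k → Bool) → Bool
  sequential Vec.[]       Vec.[]      ok = true
  sequential (w Vec.∷ vs) (x Vec.∷ c) ok = ok w x ∧ sequential vs c (λ w′ x′ → ok w′ x′ ∧ clashFree same w x w′ x′)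

  Σ-sequential : ∀ {m k} (vs : Vec Point m) ok →
    Σℕ (allColourings m k) (λ c → sequential vs c ok ∧∧ 1) ≡ count same (allFin k) (Vec.toList vs) ok
  Σ-sequential Vec.[] ok = refl
  Σ-sequential {suc m} {k} (w Vec.∷ vs) ok = begin
    Σℕ (concatMap (λ c → map (Vec._∷ c) (allFin k)) (allColourings m k)) (λ c → sequential (w Vec.∷ vs) c ok ∧∧ 1)
      ≡⟨ Σℕ-concatMap _ (allColourings m k) _ ⟩
    Σℕ (allColourings m k) (λ c → Σℕ (map (Vec._∷ c) (allFin k)) (λ c → sequential (w Vec.∷ vs) c ok ∧∧ 1))
      ≡⟨ Σℕ-cong (allColourings m k) (λ {c} _ → Σℕ-map (Vec._∷ c) (allFin k) _) ⟩
    Σℕ (allColourings m k) (λ c → Σℕ (allFin k) (λ x → (ok w x ∧ sequential vs c (ok′ x)) ∧∧ 1))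
      ≡⟨ Σℕ-swap (allColourings m k) (allFin k) _ ⟩
    Σℕ (allFin k) (λ x → Σℕ (allColourings m k) (λ c → (ok w x ∧ sequential vs c (ok′ x)) ∧∧ 1))
      ≡⟨ Σℕ-cong (allFin k) (λ {x} _ → trans (Σℕ-cong (allColourings m k) (λ {c} _ → ∧∧-∧ (ok w x) _ 1))
           (trans (≡-sym (Σℕ-∧∧ (ok w x) (allColourings m k) _)) (cong (ok w x ∧∧_) (Σ-sequential vs (ok′ x))))) ⟩
    count same (allFin k) (w ∷ Vec.toList vs) ok ∎
    where
    open ≡-Reasoning
    ok′ : Fin k → Point → Fin k → Bool
    ok′ x w′ x′ = ok w′ x′ ∧ clashFree same w x w′ x′

  sequential-ok : ∀ {m k} (vs : Vec Point m) (c : Vec (Fin k) m) {ok} → T (sequential vs c ok) → ∀ i → T (ok (lookup vs i) (lookup c i))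
  sequential-ok (w Vec.∷ vs) (x Vec.∷ c) p Fin.zero    = ∧-left p
  sequential-ok (w Vec.∷ vs) (x Vec.∷ c) {ok} p (Fin.suc i) = ∧-left (sequential-ok vs c (∧-right {ok w x} p) i)

  sequential-clash : ∀ {m k} (vs : Vec Point m) (c : Vec (Fin k) m) {ok} → T (sequential vs c ok) → ∀ i j → i Fin.< j →
    T (clashFree same (lookup vs i) (lookup c i) (lookup vs j) (lookup c j))
  sequential-clash (w Vec.∷ vs) (x Vec.∷ c) {ok} p Fin.zero (Fin.suc j) _ =
    ∧-right {ok (lookup vs j) (lookup c j)} (sequential-ok vs c (∧-right {ok w x} p) j)
  sequential-clash (w Vec.∷ vs) (x Vec.∷ c) {ok} p (Fin.suc i) (Fin.suc j) (s≤s lt) = sequential-clash vs c (∧-right {ok w x} p) i j lt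

  sequential⁺ : ∀ {m k} (vs : Vec Point m) (c : Vec (Fin k) m) {ok} → (∀ i → T (ok (lookup vs i) (lookup c i))) →
    (∀ i j → i Fin.< j → T (clashFree same (lookup vs i) (lookup c i) (lookup vs j) (lookup c j))) → T (sequential vs c ok)
  sequential⁺ Vec.[] Vec.[] _ _ = tt
  sequential⁺ (w Vec.∷ vs) (x Vec.∷ c) oks cf = ∧-pair (oks Fin.zero)
    (sequential⁺ vs c (λ i → ∧-pair (oks (Fin.suc i)) (cf Fin.zero (Fin.suc i) (s≤s z≤n))) (λ i j lt → cf (Fin.suc i) (Fin.suc j) (s≤s lt)))

  vertices : Vec Point n
  vertices = Vec.tabulate just

  module _ {k} (c : Vec (Fin k) n) where
    private
      test : Fin n × Fin n → Bool
      test uv = not (Adj G (proj₁ uv) (proj₂ uv)) ∨ not ⌊ lookup c (proj₁ uv) Fin.≟ lookup c (proj₂ uv) ⌋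

      deMorgan : ∀ a b → not a ∨ not b ≡ not (a ∧ b)
      deMorgan true  b = refl
      deMorgan false b = refl

      test≡ : ∀ u v → test (u , v) ≡ clashFree same (lookup vertices u) (lookup c u) (lookup vertices v) (lookup c v)
      test≡ u v = trans (deMorgan (Adj G u v) _) (cong₂ (λ a b → not (adj a b ∧ same (lookup c u) (lookup c v))) (≡-sym (lookup∘tabulate just u)) (≡-sym (lookup∘tabulate just v)))

      same-sym : ∀ (x y : Fin k) → same x y ≡ same y x
      same-sym x y with x Fin.≟ y | y Fin.≟ x
      ... | yes _ | yes _ = refl
      ... | no _  | no _  = refl
      ... | yes p | no ¬q = ⊥-elim (¬q (≡-sym p))
      ... | no ¬p | yes q = ⊥-elim (¬p (≡-sym q))

      test-sym : ∀ u v → test (u , v) ≡ test (v , u)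
      test-sym u v = cong₂ (λ a b → not a ∨ not b) (Graph.sym G u v) (same-sym (lookup c u) (lookup c v))

    isProper⁻ : T (isProper G c) → ∀ u v → T (test (u , v))
    isProper⁻ p u v = and⁻ test p (∈-cartesianProduct⁺ (∈-allFin u) (∈-allFin v))

    -- `isProper` tests all ordered pairs, `sequential` only those with i < j; symmetry of adjacency
    -- supplies the reversed pairs and irreflexivity the diagonal.
    isProper≡ : isProper G c ≡ sequential vertices c (λ _ _ → true)
    isProper≡ = T-antisym
      (λ p → sequential⁺ vertices c (λ _ → tt) (λ i j _ → subst T (test≡ i j) (isProper⁻ p i j)))
      (λ p → and⁺ test (cartesianProduct (allFin n) (allFin n)) (λ (u , v) → holds p u v))
      where
      holds : T (sequential vertices c (λ _ _ → true)) → ∀ u v → T (test (u , v))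
      holds p u v with FinP.<-cmp u v
      ... | tri< lt _ _ = subst T (≡-sym (test≡ u v)) (sequential-clash vertices c p u v lt)
      ... | tri> _ _ gt = subst T (trans (≡-sym (test≡ v u)) (test-sym v u)) (sequential-clash vertices c p v u gt)
      ... | tri≈ _ refl _ = subst (λ z → T (not z ∨ not ⌊ lookup c u Fin.≟ lookup c u ⌋)) (≡-sym (irrefl G u)) tt

  toℕ-allFin : ∀ k → map Fin.toℕ (allFin k) ≡ range k
  toℕ-allFin zero    = refl
  toℕ-allFin (suc k) = cong (0 ∷_) (trans (map-tabulate Fin.suc Fin.toℕ) (trans (≡-sym (map-tabulate Fin.toℕ suc)) (cong (map suc) (trans (≡-sym (map-tabulate id Fin.toℕ)) (toℕ-allFin k)))))

  same-toℕ : ∀ {k} (x y : Fin k) → same x y ≡ (Fin.toℕ x ≡ᵇ Fin.toℕ y)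
  same-toℕ x y with x Fin.≟ y
  ... | yes refl = ≡-sym (≡ᵇ-refl (Fin.toℕ x))
  ... | no ¬p = T-antisym (λ ()) (λ q → ¬p (FinP.toℕ-injective (ℕP.≡ᵇ⇒≡ (Fin.toℕ x) (Fin.toℕ y) q)))

  points : List Point
  points = Vec.toList vertices

  nowhere : Point → Bool
  nowhere _ = false

  chromPoly≡ : ∀ K → chromPoly G (suc K) ≡ rooted# points nowhere K
  chromPoly≡ K = begin
    length (filterᵇ (isProper G) (allColourings n (suc K)))       ≡⟨ length-filterᵇ (isProper G) (allColourings n (suc K)) ⟩
    Σℕ (allColourings n (suc K)) (λ c → isProper G c ∧∧ 1)         ≡⟨ Σℕ-cong (allColourings n (suc K)) (λ {c} _ → cong (_∧∧ 1) (isProper≡ c)) ⟩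
    Σℕ (allColourings n (suc K)) (λ c → sequential vertices c (λ _ _ → true) ∧∧ 1) ≡⟨ Σ-sequential vertices (λ _ _ → true) ⟩
    count same (allFin (suc K)) points (λ _ _ → true)             ≡⟨ cong (λ z → count same z points (λ _ _ → true)) (≡-sym (map-id (allFin (suc K)))) ⟩
    count same (map id (allFin (suc K))) points (λ _ _ → true)
      ≡⟨ count-relabel id Fin.toℕ (allFin (suc K)) (λ {x} {y} _ _ → same-toℕ x y) points (λ _ _ → refl) ⟩
    count _≡ᵇ_ (map Fin.toℕ (allFin (suc K))) points (avoid nowhere K) ≡⟨ cong (λ z → count _≡ᵇ_ z points (avoid nowhere K)) (toℕ-allFin (suc K)) ⟩
    rooted# points nowhere K ∎
    where
    open ≡-Reasoning

  length-points : length points ≡ n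
  length-points = length-toList vertices
    where
    length-toList : ∀ {m} (vs : Vec Point m) → length (Vec.toList vs) ≡ m
    length-toList Vec.[]       = refl
    length-toList (_ Vec.∷ vs) = cong suc (length-toList vs)

  -- This is how the edge enters: it makes the constant term h 0 equal to 1, which excludes a
  -- vanishing difference.
  chromPoly-1 : HasEdge G → chromPoly G 1 ≡ 0
  chromPoly-1 (u , v , uv) = cong length (filter-none (T? ∘ isProper G)
      (All.universal (λ c p → clash (lookup c u) (lookup c v) uv (isProper⁻ c p u v)) (allColourings n 1)))
    where
    clash : ∀ {a} (x y : Fin 1) → T a → ¬ T (not a ∨ not ⌊ x Fin.≟ y ⌋)
    clash {true} Fin.zero Fin.zero _ ()

  hSeries aSeries : Ser
  hSeries = ser (hCoeff G)
  aSeries = ser (aCoeff G)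

  sumUpTo-suc : ∀ m f → sumUpTo (suc m) f ≡ f 0 ℤ.+ sumUpTo m (f ∘ suc)
  sumUpTo-suc zero    f = refl
  sumUpTo-suc (suc m) f = trans (cong (ℤ._+ f (2 ℕ.+ m)) (sumUpTo-suc m f)) (ℤP.+-assoc (f 0) _ _)

  conv-sumUpTo : ∀ f g m → conv f g m ≡ sumUpTo m (λ k → f k ℤ.* g (m ℕ.∸ k))
  conv-sumUpTo f g zero    = refl
  conv-sumUpTo f g (suc m) = trans (cong (ℤ._+_ (f 0 ℤ.* g (suc m))) (conv-sumUpTo (f ∘ suc) g m)) (≡-sym (sumUpTo-suc m _))

  1-t^-coeff : ∀ m k → coeff (1-t ^ˢ m) k ≡ sign k ℤ.* + (m C k)
  1-t^-coeff zero    zero    = 𝕔-coeff (+ 1) 0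
  1-t^-coeff zero    (suc k) = trans (𝕔-coeff (+ 1) (suc k)) (≡-sym (trans (cong (λ z → sign (suc k) ℤ.* + z) (k>n⇒nCk≡0 {0} {suc k} (s≤s z≤n))) (ℤP.*-zeroʳ (sign (suc k)))))
  1-t^-coeff (suc m) zero    = trans (1-t⊛-coeff-0 (1-t ^ˢ m)) (1-t^-coeff m 0)
  1-t^-coeff (suc m) (suc k) = begin
    coeff (1-t ^ˢ suc m) (suc k) ≡⟨ 1-t⊛-coeff-suc (1-t ^ˢ m) k ⟩
    coeff (1-t ^ˢ m) (suc k) ℤ.- coeff (1-t ^ˢ m) k ≡⟨ cong₂ ℤ._-_ (1-t^-coeff m (suc k)) (1-t^-coeff m k) ⟩
    ℤ.- sign k ℤ.* + (m C suc k) ℤ.- sign k ℤ.* + (m C k) ≡⟨ regroup (sign k) (+ (m C suc k)) (+ (m C k)) ⟩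
    ℤ.- sign k ℤ.* + (m C k ℕ.+ m C suc k) ≡⟨ cong (λ z → ℤ.- sign k ℤ.* + z) (nCk+nC[k+1]≡[n+1]C[k+1] m k) ⟩
    sign (suc k) ℤ.* + (suc m C suc k) ∎
    where
    open ≡-Reasoning
    regroup : ∀ s a b → ℤ.- s ℤ.* a ℤ.- s ℤ.* b ≡ ℤ.- s ℤ.* (b ℤ.+ a)
    regroup = ℤ-solve-∀

  hSeries≈ : hSeries ≈ 1-t ^ˢ n ⊛ aSeries
  hSeries≈ = pointwise λ i → ≡-sym (trans (⊛-coeff (1-t ^ˢ n) aSeries i)
    (trans (conv-cong (1-t^-coeff n) (λ _ → refl) i) (conv-sumUpTo (λ k → sign k ℤ.* + (n C k)) (aCoeff G) i)))

  system : System
  system = (points , nowhere) ∷ []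

  -- E and W carry the power n + 1 of 1 - t, the h-numbers only the power n.
  difference≈ : difference system ≈ 1-t ⊛ hSeries
  difference≈ = S.trans (S.+-cong
      (S.trans (S.*-identityʳ _) (subst (λ z → E (length points) ≈ E z) length-points S.refl))
      (S.-‿cong (S.trans (S.*-identityʳ _) (S.*-cong (subst (λ z → 1-t ^ˢ suc (length points) ≈ 1-t ^ˢ suc z) length-points S.refl) S.refl))))
    (S.trans (solve 4 (λ x p a b → (x :* p) :* a :+ :- ((x :* p) :* b) := x :* (p :* (a :+ :- b))) S.refl 1-t (1-t ^ˢ n) (powerSeries n) (rootedSeries points nowhere))
      (S.*-cong S.refl (S.trans (S.*-cong S.refl (pointwise λ j → trans (⊝-coeff (powerSeries n) (rootedSeries points nowhere) j)
        (cong (λ z → + (suc j ℕ.^ n) ℤ.- + z) (≡-sym (chromPoly≡ j))))) (S.sym hSeries≈))))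

  dim-system : dim system ≡ n ℕ.∸ 1
  dim-system = trans (ℕP.+-identityʳ _) (cong (ℕ._∸ 1) length-points)

  diffSeq≡ : ∀ i → coeff (1-t ⊛ hSeries) i ≡ diffSeq (hCoeff G) i
  diffSeq≡ zero    = 1-t⊛-coeff-0 hSeries
  diffSeq≡ (suc i) = 1-t⊛-coeff-suc hSeries i

  hSeries-cone : Cone (n ℕ.∸ 2) hSeries
  hSeries-cone with proj₁ (result (size system) system ℕP.≤-refl)
  ... | I , cI , eq = resp (S.sym (1-t-cancel hSeries I (S.trans (S.sym difference≈) eq)))
    (subst (λ z → Cone z I) (trans (cong (ℕ._∸ 1) dim-system) (ℕP.∸-+-assoc n 1 1)) cI)

  hCoeff-0 : HasEdge G → hCoeff G 0 ≡ + 1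
  hCoeff-0 edge = trans (cong (λ z → + 1 ℤ.* + (n C 0) ℤ.* (+ (1 ℕ.^ n) ℤ.- + z)) (chromPoly-1 edge))
    (cong (λ z → + 1 ℤ.* + (n C 0) ℤ.* (+ z ℤ.- + 0)) (ℕP.^-zeroˡ n))

  macaulaySystem : HasEdge G → MacaulayUpTo (n ℕ.∸ 1) (1-t ⊛ hSeries)
  macaulaySystem edge with proj₂ (result (size system) system ℕP.≤-refl)
  ... | inj₂ M = subst (λ z → MacaulayUpTo z (1-t ⊛ hSeries)) dim-system (macaulay-resp difference≈ M)
  ... | inj₁ z = ⊥-elim (1≢0 (trans (≡-sym (hCoeff-0 edge)) (trans (≡-sym (diffSeq≡ 0)) (trans (≡-sym (at difference≈ 0)) (trans (at z 0) (𝟘-coeff 0))))))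
    where
    1≢0 : ¬ (+ 1 ≡ + 0)
    1≢0 ()

double-/2 : ∀ {i} m → i ≤ m ℕ./ 2 → i ℕ.+ i ≤ m
double-/2 {i} m le = ℕP.≤-trans (ℕP.≤-reflexive (trans (cong (i ℕ.+_) (≡-sym (ℕP.+-identityʳ i))) (ℕP.*-comm 2 i)))
  (ℕP.≤-trans (ℕP.*-monoˡ-≤ 2 le) (m/n*n≤m m 2))

theorem5p6 : ∀ (n : ℕ) (G : Graph n) → HasEdge G →
    let h = hCoeff G in
    (∀ i → suc i ≤ (n ∸ 2) / 2 → h i ≤ℤ h (suc i)) ×
    (∀ i → 2 * i ≤ n ∸ 2 → h i ≤ℤ h (n ∸ 2 ∸ i)) ×
    IsMVector (diffSeq h) ((n ∸ 1) / 2)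
theorem5p6 n G edge = increasing , lower≤upper , hCoeff-0 edge , r , ideal , counts , count-high
  where
  open Chromatic G
  M = macaulaySystem edge
  -- `dim system` is n ∸ 1, so Macaulay's inequalities reach exactly the degree (n ∸ 1) / 2, which
  -- is ⌈(n-2)/2⌉.
  isMacaulay : IsMacaulay ((n ℕ.∸ 1) ℕ./ 2) (value M)
  isMacaulay = record { start = value-0 M ; growth = λ i le → grows M i (double-/2 (n ℕ.∸ 1) le) }
  open Realisation ((n ℕ.∸ 1) ℕ./ 2) (value M) isMacaulay
  increasing : ∀ i → suc i ℕ.≤ (n ℕ.∸ 2) ℕ./ 2 → hCoeff G i ℤ.≤ hCoeff G (suc i)
  increasing i le = cone-mono hSeries-cone i (suc i) (ℕP.n≤1+n i) (ℕP.≤-trans (ℕP.n≤1+n _) (double-/2 (n ℕ.∸ 2) le))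
  lower≤upper : ∀ i → 2 ℕ.* i ℕ.≤ n ℕ.∸ 2 → hCoeff G i ℤ.≤ hCoeff G (n ℕ.∸ 2 ℕ.∸ i)
  lower≤upper i le = cone-mono hSeries-cone i (n ℕ.∸ 2 ℕ.∸ i)
      (ℕP.m+n≤o⇒m≤o∸n i (ℕP.≤-trans (ℕP.≤-reflexive (cong (i ℕ.+_) (≡-sym (ℕP.+-identityʳ i)))) le))
      (ℕP.≤-reflexive (ℕP.m+[n∸m]≡n (ℕP.≤-trans (ℕP.m≤m+n i _) le)))
  counts : ∀ i → i ℕ.≤ (n ℕ.∸ 1) ℕ./ 2 → + countDeg ideal i ≡ diffSeq (hCoeff G) i
  counts i le = trans (cong +_ (count i le)) (trans (≡-sym (coeff≡ M i (double-/2 (n ℕ.∸ 1) le))) (diffSeq≡ i))
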